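{- The test $T_{\mathrm{GN}}$ (repeated a constant number of times) is a tolerant tester for $\mathrm{RM}(d,n)$. That is, there exist absolute constants $c_1,c_2>0$ and an integer $r\ge 1$ such that for all integers $d\ge 0$ and $n\ge d+1$, the tester which runs $T_{\mathrm{GN}}^f$ independently $r$ times and accepts if and only if all $r$ runs accept satisfies, for every $f:\mathbb{F}_2^n\to\mathbb{F}_2$: 1. (acceptance condition) if $\delta_d(f)\le c_1 2^{ -d}$, then it accepts with probability at least $2/3$; 2. (rejection condition) if $\delta_d(f)\ge c_2 2^{ -d}$, then it rejects with probability at least $2/3$.
   Context: Every function $f:\mathbb{F}_2^n\to\mathbb{F}_2$ is uniquely a multilinear polynomial over $\mathbb{F}_2$; $\deg f$ is its degree. $\mathrm{RM}(d,n)=\{g:\mathbb{F}_2^n\to\mathbb{F}_2 : \deg g\le d\}$, a code of minimum relative distance $\delta_{\min}=2^{ -d}$. $\delta_d(f)=\min_{g\in\mathrm{RM}(d,n)}\Pr_{x}[f(x)\ne g(x)]$, with $x$ uniform in $\mathbb{F}_2^n$. A tolerant tester for a code of minimum relative distance $\delta_{\min}$ is a randomized oracle algorithm for which there are constants $c_1,c_2$ such that it accepts words within distance $c_1\delta_{\min}$ of the code with probability at least $2/3$ and rejects words at least $c_2\delta_{\min}$-far from the code with probability at least $2/3$. The test $T_{\mathrm{GN}}^f$ (with degree parameter $d$) picks a uniformly random $(d+1)$-dimensional affine subspace $A\subseteq\mathbb{F}_2^n$ and accepts if and only if $f|_A$ (viewed as a function on $\mathbb{F}_2^{d+1}$ through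 any affine parametrization of $A$) has degree at most $d$. -}

module Defs where

open import Data.Bool.Base using (Bool; true; false; _∧_; _xor_; if_then_else_)
open import Data.Bool.Properties using (∧-assoc; ∧-comm; ∧-zeroʳ; ∧-distribˡ-xor; xor-assoc; xor-comm; xor-identityʳ; xor-same) renaming (_≟_ to _≟ᵇ_)
open import Data.Empty using (⊥-elim)
open import Data.Fin.Subset using (Subset; ∣_∣)
open import Data.Fin.Subset.Properties using (anySubset?)
open import Data.Integer.Base using (+_)
open import Data.List.Base using (List; []; _∷_; _++_; map; filter; foldr; length; cartesianProductWith)
open import Data.List.Extrema.Nat using (max)
open import Data.List.Membership.Propositional using (_∈_; find)
open import Data.List.Membership.Propositional.Properties using (∈-map⁺; ∈-map⁻; ∈-filter⁺; ∈-filter⁻; ∈-cartesianProductWith⁺)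
open import Data.List.Properties using (map-++; map-cong; map-∘; filter-≐; ++-identityʳ)
open import Data.List.Relation.Unary.All using ([]; _∷_)
import Data.List.Relation.Unary.All as All
open import Data.List.Relation.Unary.AllPairs using ([]; _∷_)
open import Data.List.Relation.Unary.Any using (Any; here; there)
import Data.List.Relation.Unary.Any as Any
import Data.List.Relation.Unary.Any.Properties as Any
import Data.List.Relation.Unary.Unique.Propositional as Propositional
import Data.List.Relation.Unary.Unique.Propositional.Properties as Propositional
import Data.List.Relation.Unary.Unique.Setoid as Setoid
import Data.List.Relation.Unary.Unique.Setoid.Properties as Setoid
open import Data.Nat.Base using (ℕ; zero; suc; _≤_; z≤n; _^_)
open import Data.Nat.Properties using (_≤?_; m^n≢0)
open import Data.Product.Base using (Σ-syntax; ∃; ∃-syntax; _×_; _,_; proj₁; proj₂)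
open import Data.Rational.Base using (ℚ; 0ℚ; _/_) renaming (_≤_ to _≤ℚ_)
open import Data.Rational.Properties using (≤-decTotalOrder)
open import Data.Sum.Base using (inj₁; inj₂)
open import Data.Vec.Base using (Vec; []; _∷_; replicate; zipWith) renaming (map to mapᵛ)
open import Data.Vec.Properties using (∷-injective; ≡-dec)
open import Data.Vec.Relation.Unary.All using (All; all?)
open import Function.Base using (_∘_)
open import Function.Bundles using (_⇔_; mk⇔; Equivalence)
open import Level using (Level; 0ℓ)
open import Relation.Binary.Bundles using (DecTotalOrder)
open import Relation.Binary.PropositionalEquality using (_≡_; _≢_; _≗_; _→-setoid_; refl; sym; trans; cong; cong₂; subst; module ≡-Reasoning)
open import Relation.Nullary using (Dec; ¬_; ¬?; map′; _×-dec_; _→-dec_; decidable-stable)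
open import Relation.Unary using (Pred; Decidable; _≐_)

import Data.List.Extrema (DecTotalOrder.totalOrder ≤-decTotalOrder) as Extremaℚ

private
  variable
    a ℓ : Level
    k n : ℕ

-- Ω lists every outcome exactly once. The value on the empty list is
-- a convention.
Pr : {A : Set a} (Ω : List A) {P : Pred A ℓ} → Decidable P → ℚ
Pr []        P? = 0ℚ
Pr Ω@(_ ∷ _) P? = + length (filter P? Ω) / length Ω

vecs : {A : Set a} → List A → (r : ℕ) → List (Vec A r)
vecs xs zero    = [] ∷ []
vecs xs (suc r) = cartesianProductWith _∷_ xs (vecs xs r)

infix 30 2^-_ 𝔽₂^_

2^-_ : ℕ → ℚ
2^- d = (+ 1 / 2 ^ d) {{m^n≢0 2 d}}

-- The field 𝔽₂ is Bool with addition _xor_ and multiplication _∧_.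
𝔽₂^_ : ℕ → Set
𝔽₂^ n = Vec Bool n

BoolFun : ℕ → Set
BoolFun n = 𝔽₂^ n → Bool

cube : ∀ n → List (𝔽₂^ n)
cube n = vecs (false ∷ true ∷ []) n

glue : BoolFun n → BoolFun n → BoolFun (suc n)
glue f₀ f₁ (b ∷ x) = if b then f₁ x else f₀ x

-- Every function, exactly once up to _≗_: see functions-complete and
-- functions-unique.
functions : ∀ n → List (BoolFun n)
functions zero    = (λ _ → false) ∷ (λ _ → true) ∷ []
functions (suc n) = cartesianProductWith glue (functions n) (functions n)

-- The coefficient of ∏_{i ∈ S} xᵢ, for each S.
Poly : ℕ → Set
Poly n = Subset n → Bool

⨁ : List Bool → Bool
⨁ = foldr _xor_ false

monomial : Subset n → 𝔽₂^ n → Bool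
monomial []      []      = true
monomial (s ∷ S) (b ∷ x) = (if s then b else true) ∧ monomial S x

eval : Poly n → BoolFun n
eval {n} p x = ⨁ (map (λ S → p S ∧ monomial S x) (cube n))

-- The polynomial of a function, from
-- f(x₀, x) = f(0, x) + x₀ (f(0, x) + f(1, x)). By eval-anf and
-- anf-unique it is the only polynomial representing f.
anf : BoolFun n → Poly n
anf f []          = f []
anf f (false ∷ S) = anf (λ x → f (false ∷ x)) S
anf f (true  ∷ S) = anf (λ x → f (false ∷ x) xor f (true ∷ x)) S

-- The zero polynomial gets degree 0 instead of -∞, which does not
-- affect any comparison deg f ≤ d with d ∈ ℕ.
degPoly : Poly n → ℕ
degPoly {n} p = max 0 (map ∣_∣ (filter (λ S → p S ≟ᵇ true) (cube n)))

deg : BoolFun n → ℕ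
deg f = degPoly (anf f)

RM : (d n : ℕ) → List (BoolFun n)
RM d n = filter (λ g → deg g ≤? d) (functions n)

dist : BoolFun n → BoolFun n → ℚ
dist {n} f g = Pr (cube n) (λ x → ¬? (f x ≟ᵇ g x))

-- The minimum over RM d n. The initial value needed by min comes from
-- the zero codeword: see δ-attained and δ-minimal.
δ : ℕ → BoolFun n → ℚ
δ {n} d f = Extremaℚ.min (dist f (λ _ → false)) (map (dist f) (RM d n))

infixl 6 _⊕_
infixr 7 _·_

_⊕_ : 𝔽₂^ n → 𝔽₂^ n → 𝔽₂^ n
_⊕_ = zipWith _xor_

_·_ : Bool → 𝔽₂^ n → 𝔽₂^ n
t · v = mapᵛ (t ∧_) v

𝟎 : 𝔽₂^ n
𝟎 = replicate _ false

combination : 𝔽₂^ k → Vec (𝔽₂^ n) k → 𝔽₂^ n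
combination []       []       = 𝟎
combination (t ∷ ts) (v ∷ vs) = t · v ⊕ combination ts vs

LinearlyIndependent : Vec (𝔽₂^ n) k → Set
LinearlyIndependent vs = ∀ ts → combination ts vs ≡ 𝟎 → ts ≡ 𝟎

-- (u , vs) stands for the affine map t ↦ u + Σᵢ tᵢ vᵢ.
AffineMap : (k n : ℕ) → Set
AffineMap k n = 𝔽₂^ n × Vec (𝔽₂^ n) k

apply : AffineMap k n → 𝔽₂^ k → 𝔽₂^ n
apply (u , vs) t = u ⊕ combination t vs

-- Subsets A of 𝔽₂ⁿ are given by their characteristic functions.
_Parametrizes_ : AffineMap k n → BoolFun n → Set
φ Parametrizes A =
  LinearlyIndependent (proj₂ φ) × (∀ x → A x ≡ true ⇔ (∃[ t ] apply φ t ≡ x))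

IsAffineSubspace : (k : ℕ) → BoolFun n → Set
IsAffineSubspace {n} k A = Σ[ φ ∈ AffineMap k n ] φ Parametrizes A

private
  all-from-any : {A : Set} →
    (∀ {P : Pred A 0ℓ} → Decidable P → Dec (∃ P)) →
    ∀ {P : Pred A 0ℓ} → Decidable P → Dec (∀ x → P x)
  all-from-any any? P? = map′
    (λ ¬∃ x → decidable-stable (P? x) (λ ¬p → ¬∃ (x , ¬p)))
    (λ ∀p (x , ¬p) → ¬p (∀p x))
    (¬? (any? (λ x → ¬? (P? x))))

  anyVec? : {P : Pred (Vec (𝔽₂^ n) k) 0ℓ} → Decidable P → Dec (∃ P)
  anyVec? {k = zero}  P? = map′ ([] ,_) (λ { ([] , p) → p }) (P? [])
  anyVec? {k = suc k} P? = map′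
    (λ (v , vs , p) → (v ∷ vs) , p)
    (λ { ((v ∷ vs) , p) → v , vs , p })
    (anySubset? (λ v → anyVec? (λ vs → P? (v ∷ vs))))

  anyAffineMap? : {P : Pred (AffineMap k n) 0ℓ} → Decidable P → Dec (∃ P)
  anyAffineMap? P? = map′
    (λ (u , vs , p) → (u , vs) , p)
    (λ ((u , vs) , p) → u , vs , p)
    (anySubset? (λ u → anyVec? (λ vs → P? (u , vs))))

  _⇔-dec_ : {A B : Set} → Dec A → Dec B → Dec (A ⇔ B)
  a? ⇔-dec b? = map′ (λ (f , g) → mk⇔ f g)
    (λ e → Equivalence.to e , Equivalence.from e)
    ((a? →-dec b?) ×-dec (b? →-dec a?))

  _≟ᵛ_ : (x y : 𝔽₂^ n) → Dec (x ≡ y)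
  _≟ᵛ_ = ≡-dec _≟ᵇ_

_parametrizes?_ : (φ : AffineMap k n) (A : BoolFun n) → Dec (φ Parametrizes A)
φ parametrizes? A =
  all-from-any anySubset?
    (λ ts → (combination ts (proj₂ φ) ≟ᵛ 𝟎) →-dec (ts ≟ᵛ 𝟎))
  ×-dec
  all-from-any anySubset?
    (λ x → (A x ≟ᵇ true) ⇔-dec anySubset? (λ t → apply φ t ≟ᵛ x))

isAffineSubspace? : (k : ℕ) → Decidable (IsAffineSubspace {n} k)
isAffineSubspace? k A = anyAffineMap? (_parametrizes? A)

affineSubspaces : (k n : ℕ) → List (BoolFun n)
affineSubspaces k n = filter (isAffineSubspace? k) (functions n)

-- The degree does not depend on the parametrization of A, so quantifying
-- over all of them is the same as testing an arbitrary one.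
GNAccepts : (d : ℕ) → BoolFun n → Pred (BoolFun n) 0ℓ
GNAccepts {n} d f A =
  (φ : AffineMap (suc d) n) → φ Parametrizes A → deg (f ∘ apply φ) ≤ d

gnAccepts? : (d : ℕ) (f : BoolFun n) → Decidable (GNAccepts d f)
gnAccepts? d f A = all-from-any anyAffineMap?
  (λ φ → (φ parametrizes? A) →-dec (deg (f ∘ apply φ) ≤? d))

-- The outcomes of r independent choices of a (d+1)-dimensional affine
-- subspace; the uniform distribution on r-tuples is the product one.
runs : (r d n : ℕ) → List (Vec (BoolFun n) r)
runs r d n = vecs (affineSubspaces (suc d) n) r

AllAccept : ∀ {r} (d : ℕ) → BoolFun n → Pred (Vec (BoolFun n) r) 0ℓ
AllAccept d f = All (GNAccepts d f)

allAccept? : ∀ {r} (d : ℕ) (f : BoolFun n) → Decidable (AllAccept {r = r} d f)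
allAccept? d f = all? (gnAccepts? d f)

Pr[accept] Pr[reject] : (r d : ℕ) → BoolFun n → ℚ
Pr[accept] {n} r d f = Pr (runs r d n) (allAccept? d f)
Pr[reject] {n} r d f = Pr (runs r d n) (λ As → ¬? (allAccept? d f As))

cube-complete : (x : 𝔽₂^ n) → x ∈ cube n
cube-complete []      = here refl
cube-complete (b ∷ x) = ∈-cartesianProductWith⁺ _∷_ (bit b) (cube-complete x)
  where
  bit : ∀ b → b ∈ false ∷ true ∷ []
  bit false = here refl
  bit true  = there (here refl)

cube-unique : ∀ n → Propositional.Unique (cube n)
cube-unique zero    = [] ∷ []
cube-unique (suc n) = Propositional.cartesianProductWith⁺ _∷_ ∷-injective
  (((λ ()) ∷ []) ∷ [] ∷ []) (cube-unique n)

functions-complete : (f : BoolFun n) → Any (f ≗_) (functions n)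
functions-complete {zero} f with f [] in eq
... | false = here (λ { [] → eq })
... | true  = there (here (λ { [] → eq }))
functions-complete {suc n} f =
  Any.cartesianProductWith⁺ glue
    (λ e₀ e₁ → λ { (false ∷ x) → e₀ x ; (true ∷ x) → e₁ x })
    (functions-complete (λ x → f (false ∷ x)))
    (functions-complete (λ x → f (true ∷ x)))

functions-unique : ∀ n → Setoid.Unique (𝔽₂^ n →-setoid Bool) (functions n)
functions-unique zero    =
  ((λ e → false≢true (e [])) ∷ []) ∷ [] ∷ []
  where
  false≢true : false ≢ true
  false≢true ()
functions-unique (suc n) = Setoid.cartesianProductWith⁺
  (𝔽₂^ n →-setoid Bool) (𝔽₂^ n →-setoid Bool) (𝔽₂^ suc n →-setoid Bool) glue
  (λ e → (λ x → e (false ∷ x)) , (λ x → e (true ∷ x)))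
  (functions-unique n) (functions-unique n)

private
  ⨁-++ : ∀ xs ys → ⨁ (xs ++ ys) ≡ ⨁ xs xor ⨁ ys
  ⨁-++ []       ys = refl
  ⨁-++ (x ∷ xs) ys = trans (cong (x xor_) (⨁-++ xs ys)) (sym (xor-assoc x _ _))

  ⨁-∧ : ∀ {A : Set} b (h : A → Bool) xs →
    ⨁ (map (λ y → b ∧ h y) xs) ≡ b ∧ ⨁ (map h xs)
  ⨁-∧ b h []       = sym (∧-zeroʳ b)
  ⨁-∧ b h (x ∷ xs) = trans (cong ((b ∧ h x) xor_) (⨁-∧ b h xs))
    (sym (∧-distribˡ-xor b (h x) _))

  ∧-swap : ∀ x y z → x ∧ (y ∧ z) ≡ y ∧ (x ∧ z)
  ∧-swap x y z = trans (sym (∧-assoc x y z))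
    (trans (cong (_∧ z) (∧-comm x y)) (∧-assoc y x z))

eval-∷ : (p : Poly (suc n)) (b : Bool) (x : 𝔽₂^ n) →
  eval p (b ∷ x) ≡
  eval (λ S → p (false ∷ S)) x xor (b ∧ eval (λ S → p (true ∷ S)) x)
eval-∷ {n} p b x = begin
  ⨁ (map h (map (false ∷_) C ++ (map (true ∷_) C ++ [])))
    ≡⟨ cong (λ l → ⨁ (map h (map (false ∷_) C ++ l))) (++-identityʳ _) ⟩
  ⨁ (map h (map (false ∷_) C ++ map (true ∷_) C))
    ≡⟨ cong ⨁ (map-++ h (map (false ∷_) C) _) ⟩
  ⨁ (map h (map (false ∷_) C) ++ map h (map (true ∷_) C))
    ≡⟨ ⨁-++ (map h (map (false ∷_) C)) _ ⟩
  ⨁ (map h (map (false ∷_) C)) xor ⨁ (map h (map (true ∷_) C))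
    ≡⟨ cong₂ (λ l m → ⨁ l xor ⨁ m) (sym (map-∘ C)) (sym (map-∘ C)) ⟩
  ⨁ (map (λ S → h (false ∷ S)) C) xor ⨁ (map (λ S → h (true ∷ S)) C)
    ≡⟨ cong (λ l → s₀ xor ⨁ l)
         (map-cong (λ S → ∧-swap (p (true ∷ S)) b (monomial S x)) C) ⟩
  s₀ xor ⨁ (map (λ S → b ∧ (p (true ∷ S) ∧ monomial S x)) C)
    ≡⟨ cong (s₀ xor_) (⨁-∧ b (λ S → p (true ∷ S) ∧ monomial S x) C) ⟩
  s₀ xor (b ∧ eval (λ S → p (true ∷ S)) x) ∎
  where
  open ≡-Reasoning
  C = cube n
  s₀ = eval (λ S → p (false ∷ S)) x
  h : Subset (suc n) → Bool
  h S = p S ∧ monomial S (b ∷ x)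

anf-cong : {f g : BoolFun n} → f ≗ g → anf f ≗ anf g
anf-cong f≗g []          = f≗g []
anf-cong f≗g (false ∷ S) = anf-cong (λ x → f≗g (false ∷ x)) S
anf-cong f≗g (true  ∷ S) =
  anf-cong (λ x → cong₂ _xor_ (f≗g (false ∷ x)) (f≗g (true ∷ x))) S

eval-anf : (f : BoolFun n) → eval (anf f) ≗ f
eval-anf f [] with f []
... | false = refl
... | true  = refl
eval-anf f (false ∷ x) = trans (eval-∷ (anf f) false x)
  (trans (xor-identityʳ _) (eval-anf (λ y → f (false ∷ y)) x))
eval-anf f (true ∷ x) = begin
  eval (anf f) (true ∷ x)
    ≡⟨ eval-∷ (anf f) true x ⟩
  _
    ≡⟨ cong₂ _xor_ (eval-anf (λ y → f (false ∷ y)) x)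
         (eval-anf (λ y → f (false ∷ y) xor f (true ∷ y)) x) ⟩
  f (false ∷ x) xor (f (false ∷ x) xor f (true ∷ x))
    ≡⟨ sym (xor-assoc (f (false ∷ x)) _ _) ⟩
  (f (false ∷ x) xor f (false ∷ x)) xor f (true ∷ x)
    ≡⟨ cong (_xor f (true ∷ x)) (xor-same (f (false ∷ x))) ⟩
  f (true ∷ x) ∎
  where open ≡-Reasoning

private
  anf-eval : (p : Poly n) → anf (eval p) ≗ p
  anf-eval p [] with p []
  ... | false = refl
  ... | true  = refl
  anf-eval p (false ∷ S) = trans
    (anf-cong (λ x → trans (eval-∷ p false x) (xor-identityʳ _)) S)
    (anf-eval (λ T → p (false ∷ T)) S)
  anf-eval {suc n} p (true ∷ S) = trans
    (anf-cong difference S)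
    (anf-eval (λ T → p (true ∷ T)) S)
    where
    open ≡-Reasoning
    difference : ∀ x → eval p (false ∷ x) xor eval p (true ∷ x) ≡
      eval (λ T → p (true ∷ T)) x
    difference x = begin
      eval p (false ∷ x) xor eval p (true ∷ x)
        ≡⟨ cong₂ _xor_ (trans (eval-∷ p false x) (xor-identityʳ e₀)) (eval-∷ p true x) ⟩
      e₀ xor (e₀ xor e₁)  ≡⟨ sym (xor-assoc e₀ e₀ e₁) ⟩
      (e₀ xor e₀) xor e₁  ≡⟨ cong (_xor e₁) (xor-same e₀) ⟩
      e₁                  ∎
      where
      e₀ = eval (λ T → p (false ∷ T)) x
      e₁ = eval (λ T → p (true ∷ T)) x

anf-unique : (f : BoolFun n) (p : Poly n) → eval p ≗ f → p ≗ anf f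
anf-unique f p e S = trans (sym (anf-eval p S)) (anf-cong e S)

deg-cong : {f g : BoolFun n} → f ≗ g → deg f ≡ deg g
deg-cong {n} {f} {g} f≗g = cong (λ l → max 0 (map ∣_∣ l))
  (filter-≐ (λ S → anf f S ≟ᵇ true) (λ S → anf g S ≟ᵇ true)
    ( (λ {S} → trans (sym (anf-cong f≗g S)))
    , (λ {S} → trans (anf-cong f≗g S)))
    (cube n))

Pr-cong : {A : Set a} (Ω : List A) {P Q : Pred A ℓ}
  (P? : Decidable P) (Q? : Decidable Q) → P ≐ Q → Pr Ω P? ≡ Pr Ω Q?
Pr-cong []        P? Q? P≐Q = refl
Pr-cong Ω@(_ ∷ _) P? Q? P≐Q =
  cong (λ l → + length l / length Ω) (filter-≐ P? Q? P≐Q Ω)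

dist-congʳ : (f : BoolFun n) {g h : BoolFun n} → g ≗ h → dist f g ≡ dist f h
dist-congʳ {n} f g≗h = Pr-cong (cube n) _ _
  ( (λ {x} f≢g f≡h → f≢g (trans f≡h (sym (g≗h x))))
  , (λ {x} f≢h f≡g → f≢h (trans f≡g (g≗h x))))

private
  deg-zero : ∀ n → deg {n} (λ _ → false) ≡ 0
  deg-zero n = cong (λ l → max 0 (map ∣_∣ l)) (none (cube n))
    where
    anf-zero : ∀ {m} (S : Subset m) → anf (λ _ → false) S ≡ false
    anf-zero []          = refl
    anf-zero (false ∷ S) = anf-zero S
    anf-zero (true  ∷ S) = anf-zero S
    none : ∀ (xs : List (Subset n)) →
      filter (λ S → anf (λ _ → false) S ≟ᵇ true) xs ≡ []
    none []       = refl
    none (S ∷ xs) rewrite anf-zero S = none xs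

δ-attained : (d : ℕ) (f : BoolFun n) → ∃[ g ] deg g ≤ d × δ d f ≡ dist f g
δ-attained {n} d f
  with Extremaℚ.argmin-sel (λ q → q) (dist f (λ _ → false)) (map (dist f) (RM d n))
... | inj₁ eq = _ , subst (_≤ d) (sym (deg-zero n)) z≤n , eq
... | inj₂ m with ∈-map⁻ (dist f) m
...   | g , g∈RM , eq =
  g , proj₂ (∈-filter⁻ (λ g → deg g ≤? d) {xs = functions n} g∈RM) , eq

δ-minimal : (d : ℕ) (f g : BoolFun n) → deg g ≤ d → δ d f ≤ℚ dist f g
δ-minimal {n} d f g deg≤d with find (functions-complete g)
... | h , h∈ , g≗h = subst (δ d f ≤ℚ_) (sym (dist-congʳ f g≗h))
  (All.lookup (Extremaℚ.min≤xs (dist f (λ _ → false)) (map (dist f) (RM d n)))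
    (∈-map⁺ (dist f)
      (∈-filter⁺ (λ g → deg g ≤? d) h∈ (subst (_≤ d) (deg-cong g≗h) deg≤d))))

module Submission where

-- The test is analysed through hyperplanes, following Bhattacharyya, Kopparty,
-- Schoenebeck, Sudan and Zuckerman. Restrict f repeatedly to a random graph
-- {(ℓ(x), x)} of an affine form ℓ, down to dimension d + 4, and say that f is near if
-- its distance to RM(d, n) is below 2⁻ᵈ / 8. By induction on the dimension, a function
-- that is not near keeps degree > d with probability at least (1 + 2⁻ʲ) / 8 after j
-- restrictions. If few graphs carry a near restriction, average over the others. If
-- more than 8 · 2ᵈ do, the nearby codewords agree on intersections, so they
-- interpolate to one polynomial of degree ≤ d, which is at distance between 2⁻ᵈ / 8
-- and 3 · 2⁻ᵈ / 8 from f; the number of errors on a random restriction is then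
-- concentrated, by pairwise independence, strictly between 0 and the minimum distance.
-- Going from dimension d + 4 to d + 1 costs a factor 2 per step, and replacing graphs
-- by arbitrary affine subspaces costs a factor 4, because a quarter of all affine maps
-- of 𝔽₂ⁿ are invertible. Acceptance of close functions is a union bound over the
-- points of the subspace.

open import Defs
open import Data.Bool.Base using (Bool; true; false; not; _∧_; _xor_)
open import Data.Bool.Properties using (xor-assoc; xor-comm; xor-same; xor-identityʳ; ∧-distribʳ-xor; ∧-distribˡ-xor; ∧-zeroʳ; ∧-comm; ∧-assoc; ∧-identityʳ; ¬-not) renaming (_≟_ to _≟ᵇ_)
open import Data.Bool.Solver using (module xor-∧-Solver)
open import Data.Fin.Subset using (∣_∣)
open import Data.Fin.Subset.Properties using (anySubset?)
import Data.Integer.Base as ℤ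
import Data.Integer.Properties as ℤ
open import Data.List.Base using (List; []; _∷_; _++_; map; length; filter; cartesianProductWith; cartesianProduct)
open import Data.List.Extrema.Nat using (xs≤max; max≤v⁺)
open import Data.List.Membership.Propositional using (_∈_; find)
open import Data.List.Membership.Propositional.Properties using (∈-map⁺; ∈-filter⁺; ∈-filter⁻; ∈-cartesianProductWith⁺; ∈-cartesianProduct⁺)
open import Data.List.Relation.Unary.All as ListAll using ([]; _∷_)
import Data.List.Relation.Unary.All.Properties as ListAll
open import Data.List.Relation.Unary.AllPairs using (AllPairs; []; _∷_)
open import Data.List.Relation.Unary.Any as Any using (Any; here; there)
open import Data.List.Relation.Unary.Unique.Propositional using (Unique)
open import Data.List.Relation.Unary.Unique.Propositional.Properties using (cartesianProductWith⁺; cartesianProduct⁺)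
open import Data.Nat.Base using (ℕ; suc; s≤s; z≤n)
open import Data.Nat.Tactic.RingSolver using (solve-∀)
open import Data.Product.Base using (∃; ∃-syntax; _×_; _,_; proj₁; proj₂)
import Data.Product.Properties as Product
open import Data.Rational.Properties using (positive⁻¹)
import Data.Rational.Properties as ℚ
import Data.Rational.Unnormalised.Properties as ℚᵘ
open import Data.Sum.Base using (_⊎_; inj₁; inj₂)
open import Data.Vec.Base using (Vec; []; _∷_; head; tail; replicate; zipWith) renaming (map to mapᵛ)
open import Data.Vec.Properties using (∷-injective; ≡-dec; zipWith-assoc; zipWith-comm; zipWith-identityʳ)
open import Data.Vec.Relation.Unary.All as All using (All; all?; []; _∷_)
open import Function.Base using (_∘_)
open import Function.Bundles using (mk⇔; Equivalence)
open import Level using (0ℓ)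
open import Relation.Binary.PropositionalEquality
open import Relation.Nullary using (Dec; yes; no; ¬_; ¬?; does; contradiction; decidable-stable; map′; _×-dec_; _→-dec_)
open import Relation.Unary using (Pred; Decidable)

-- The obstacle is loss. Halving the probability at every restriction would leave nothing after
-- `n - d - 1` of them, so that bound is spent only on the last three, below dimension `d + 4`;
-- above, the guarantee falls from 1/4 to no less than 1/8 in total. The threshold `d + 4` comes
-- from the concentration argument: a nonzero polynomial of degree at most `d` in `d + 4` variables
-- has at least 16 ones, while the number of errors has mean between 2 and 6 and variance at most
-- its mean. Restricting to graphs, and not to all hyperplanes, makes the hyperplanes a vector space
-- indexed by `s`, in which translation arguments are available; a random affine change of
-- coordinates restores the symmetry. A run of the test on a function that is not near then rejects
-- with probability at least 1 / (8 · 2³ · 4) = 1/256, and 512 runs suffice. Subspaces are handled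
-- through their parametrizations, because affine maps form a product space whose sums can be
-- reindexed. Probabilities are cleared of denominators and treated as inequalities between natural
-- numbers.

module Counting where

  open import Data.Nat.Base
  open import Data.Nat.Properties

  private variable k m n d e : ℕ

  -- Finite sums

  ∑ : {A : Set} → List A → (A → ℕ) → ℕ
  ∑ []       f = 0
  ∑ (x ∷ xs) f = f x + ∑ xs f

  ⟦_⟧ : Bool → ℕ
  ⟦ false ⟧ = 0
  ⟦ true  ⟧ = 1

  module _ {A : Set} where

    ∑-cong : (xs : List A) {f g : A → ℕ} → f ≗ g → ∑ xs f ≡ ∑ xs g
    ∑-cong []       e = refl
    ∑-cong (x ∷ xs) e = cong₂ _+_ (e x) (∑-cong xs e)

    ∑-mono : (xs : List A) {f g : A → ℕ} → (∀ x → f x ≤ g x) → ∑ xs f ≤ ∑ xs g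
    ∑-mono []       le = z≤n
    ∑-mono (x ∷ xs) le = +-mono-≤ (le x) (∑-mono xs le)

    ∑-+ : (xs : List A) (f g : A → ℕ) → ∑ xs (λ x → f x + g x) ≡ ∑ xs f + ∑ xs g
    ∑-+ []       f g = refl
    ∑-+ (x ∷ xs) f g = trans (cong (f x + g x +_) (∑-+ xs f g))
      (shuffle (f x) (g x) (∑ xs f) (∑ xs g))
      where
      shuffle : ∀ a b c d → a + b + (c + d) ≡ a + c + (b + d)
      shuffle = solve-∀

    ∑-*ˡ : (xs : List A) (c : ℕ) (f : A → ℕ) → ∑ xs (λ x → c * f x) ≡ c * ∑ xs f
    ∑-*ˡ []       c f = sym (*-zeroʳ c)
    ∑-*ˡ (x ∷ xs) c f = trans (cong (c * f x +_) (∑-*ˡ xs c f))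
      (sym (*-distribˡ-+ c (f x) _))

    ∑-*ʳ : (xs : List A) (f : A → ℕ) (c : ℕ) → ∑ xs (λ x → f x * c) ≡ ∑ xs f * c
    ∑-*ʳ xs f c = trans (∑-cong xs (λ x → *-comm (f x) c))
      (trans (∑-*ˡ xs c f) (*-comm c _))

    ∑-const : (xs : List A) (c : ℕ) → ∑ xs (λ _ → c) ≡ length xs * c
    ∑-const []       c = refl
    ∑-const (x ∷ xs) c = cong (c +_) (∑-const xs c)

    ∑-++ : (xs ys : List A) (f : A → ℕ) → ∑ (xs ++ ys) f ≡ ∑ xs f + ∑ ys f
    ∑-++ []       ys f = refl
    ∑-++ (x ∷ xs) ys f = trans (cong (f x +_) (∑-++ xs ys f)) (sym (+-assoc (f x) _ _))

    ∑-∈ : {xs : List A} {x : A} (f : A → ℕ) → x ∈ xs → f x ≤ ∑ xs f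
    ∑-∈ f (here refl) = m≤m+n (f _) _
    ∑-∈ f (there x∈)  = ≤-trans (∑-∈ f x∈) (m≤n+m _ _)

    length-filter : (xs : List A) {P : Pred A 0ℓ} (P? : Decidable P) →
      length (filter P? xs) ≡ ∑ xs (λ x → ⟦ does (P? x) ⟧)
    length-filter []       P? = refl
    length-filter (x ∷ xs) P? with does (P? x)
    ... | true  = cong suc (length-filter xs P?)
    ... | false = length-filter xs P?

    ∑-filter : (xs : List A) {P : Pred A 0ℓ} (P? : Decidable P) (f : A → ℕ) →
      ∑ (filter P? xs) f ≡ ∑ xs (λ x → ⟦ does (P? x) ⟧ * f x)
    ∑-filter []       P? f = refl
    ∑-filter (x ∷ xs) P? f with does (P? x)
    ... | true  = cong₂ _+_ (sym (+-identityʳ (f x))) (∑-filter xs P? f)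
    ... | false = ∑-filter xs P? f

  ∑-map : {A B : Set} (h : A → B) (xs : List A) (f : B → ℕ) →
    ∑ (map h xs) f ≡ ∑ xs (f ∘ h)
  ∑-map h []       f = refl
  ∑-map h (x ∷ xs) f = cong (f (h x) +_) (∑-map h xs f)

  ∑-cartesianProductWith : {A B C : Set} (h : A → B → C) (xs : List A) (ys : List B)
    (f : C → ℕ) → ∑ (cartesianProductWith h xs ys) f ≡ ∑ xs (λ x → ∑ ys (λ y → f (h x y)))
  ∑-cartesianProductWith h []       ys f = refl
  ∑-cartesianProductWith h (x ∷ xs) ys f =
    trans (∑-++ (map (h x) ys) _ f)
      (cong₂ _+_ (∑-map (h x) ys f) (∑-cartesianProductWith h xs ys f))

  ∑-swap : {A B : Set} (xs : List A) (ys : List B) (f : A → B → ℕ) →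
    ∑ xs (λ x → ∑ ys (f x)) ≡ ∑ ys (λ y → ∑ xs (λ x → f x y))
  ∑-swap []       ys f = sym (trans (∑-const ys 0) (*-zeroʳ (length ys)))
  ∑-swap (x ∷ xs) ys f = trans (cong (∑ ys (f x) +_) (∑-swap xs ys f))
    (sym (∑-+ ys (f x) _))

  ∑-* : {A B : Set} (xs : List A) (ys : List B) (f : A → ℕ) (g : B → ℕ) →
    ∑ xs f * ∑ ys g ≡ ∑ xs (λ x → ∑ ys (λ y → f x * g y))
  ∑-* xs ys f g = trans (sym (∑-*ʳ xs f _))
    (∑-cong xs (λ x → sym (∑-*ˡ ys (f x) g)))

  ∑-length : {A : Set} (xs : List A) → ∑ xs (λ _ → 1) ≡ length xs
  ∑-length xs = trans (∑-const xs 1) (*-identityʳ _)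

  ⟦⟧≤1 : ∀ b → ⟦ b ⟧ ≤ 1
  ⟦⟧≤1 false = z≤n
  ⟦⟧≤1 true  = ≤-refl

  ⟦⟧-mono : ∀ {b c} → (b ≡ true → c ≡ true) → ⟦ b ⟧ ≤ ⟦ c ⟧
  ⟦⟧-mono {false} h = z≤n
  ⟦⟧-mono {true}  h = ≤-reflexive (cong ⟦_⟧ (sym (h refl)))

  ⟦⟧+⟦not⟧ : ∀ b → ⟦ b ⟧ + ⟦ not b ⟧ ≡ 1
  ⟦⟧+⟦not⟧ false = refl
  ⟦⟧+⟦not⟧ true  = refl

  does-true : {P : Set} (P? : Dec P) → P → does P? ≡ true
  does-true (yes _) _ = refl
  does-true (no ¬p) p = contradiction p ¬p

  does-false : {P : Set} (P? : Dec P) → ¬ P → does P? ≡ false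
  does-false (yes p) ¬p = contradiction p ¬p
  does-false (no _)  _  = refl

  does⇒ : {P : Set} (P? : Dec P) → does P? ≡ true → P
  does⇒ (yes p) _ = p

  ∑≡0 : {A : Set} (xs : List A) (p : A → Bool) → (∀ x → x ∈ xs → p x ≡ false) →
    ∑ xs (⟦_⟧ ∘ p) ≡ 0
  ∑≡0 []       p h = refl
  ∑≡0 (x ∷ xs) p h rewrite h x (here refl) = ∑≡0 xs p (λ y y∈ → h y (there y∈))

  -- An arbitrary pairwise relation `R` is allowed because the entries of `functions` are distinct
  -- only up to `_≗_`, while vectors are distinct up to `_≡_`.
  ∑≤1-AllPairs : {A : Set} {R : A → A → Set} {xs : List A} → AllPairs R xs → (p : A → Bool) →
    (∀ x y → p x ≡ true → p y ≡ true → ¬ R x y) → ∑ xs (⟦_⟧ ∘ p) ≤ 1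
  ∑≤1-AllPairs []                      p incompatible = z≤n
  ∑≤1-AllPairs {xs = x ∷ xs} (Rx ∷ Rxs) p incompatible with p x in px
  ... | false = ∑≤1-AllPairs Rxs p incompatible
  ... | true  = ≤-reflexive (cong suc (∑≡0 xs p outside))
    where
    outside : ∀ y → y ∈ xs → p y ≡ false
    outside y y∈ with p y in py
    ... | false = refl
    ... | true  = contradiction (ListAll.lookup Rx y∈) (incompatible x y px py)

  ∑≤1 : {A : Set} {xs : List A} → Unique xs → (p : A → Bool) →
    (∀ x y → p x ≡ true → p y ≡ true → x ≡ y) → ∑ xs (⟦_⟧ ∘ p) ≤ 1
  ∑≤1 u p inj = ∑≤1-AllPairs u p (λ x y px py x≢y → x≢y (inj x y px py))

  -- R plays the role of an injection from {x ∈ xs : p x} to {y ∈ ys : q y}.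
  ∑-inject : {A B : Set} {xs : List A} {ys : List B} → Unique xs →
    (p : A → ℕ) (q : B → ℕ) (R : A → B → Bool) →
    (∀ x x′ y → R x y ≡ true → R x′ y ≡ true → x ≡ x′) →
    (∀ x → ∃[ y ] y ∈ ys × p x ≤ ⟦ R x y ⟧ * q y) →
    ∑ xs p ≤ ∑ ys q
  ∑-inject {xs = xs} {ys} u p q R inj h = begin
    ∑ xs p
      ≤⟨ ∑-mono xs (λ x → let y , y∈ , le = h x in
           ≤-trans le (∑-∈ (λ y → ⟦ R x y ⟧ * q y) y∈)) ⟩
    ∑ xs (λ x → ∑ ys (λ y → ⟦ R x y ⟧ * q y))
      ≡⟨ ∑-swap xs ys _ ⟩
    ∑ ys (λ y → ∑ xs (λ x → ⟦ R x y ⟧ * q y))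
      ≡⟨ ∑-cong ys (λ y → ∑-*ʳ xs _ (q y)) ⟩
    ∑ ys (λ y → ∑ xs (λ x → ⟦ R x y ⟧) * q y)
      ≤⟨ ∑-mono ys (λ y → *-monoˡ-≤ (q y) (∑≤1 u (λ x → R x y) (λ x x′ → inj x x′ y))) ⟩
    ∑ ys (λ y → 1 * q y)
      ≡⟨ ∑-cong ys (λ y → *-identityˡ (q y)) ⟩
    ∑ ys q ∎
    where open ≤-Reasoning

  ∑ᶜ : ∀ n → (𝔽₂^ n → ℕ) → ℕ
  ∑ᶜ n = ∑ (cube n)

  ∑ᶜ-suc : ∀ n (f : 𝔽₂^ suc n → ℕ) →
    ∑ᶜ (suc n) f ≡ ∑ᶜ n (λ x → f (false ∷ x)) + ∑ᶜ n (λ x → f (true ∷ x))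
  ∑ᶜ-suc n f = trans (∑-cartesianProductWith _∷_ (false ∷ true ∷ []) (cube n) f)
    (cong (∑ᶜ n (λ x → f (false ∷ x)) +_) (+-identityʳ _))

  ∑ᶜ-one : ∀ n → ∑ᶜ n (λ _ → 1) ≡ 2 ^ n
  ∑ᶜ-one zero    = refl
  ∑ᶜ-one (suc n) = trans (∑ᶜ-suc n _)
    (trans (cong₂ _+_ (∑ᶜ-one n) (∑ᶜ-one n)) (cong (2 ^ n +_) (sym (+-identityʳ _))))

  ∑ᶜ-const : ∀ n c → ∑ᶜ n (λ _ → c) ≡ 2 ^ n * c
  ∑ᶜ-const n c = trans (∑-cong (cube n) (λ _ → sym (*-identityˡ c)))
    (trans (∑-*ʳ (cube n) _ c) (cong (_* c) (∑ᶜ-one n)))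

  count : ∀ {n} → BoolFun n → ℕ
  count {n} p = ∑ᶜ n (⟦_⟧ ∘ p)

  count-mono : ∀ {n} (p q : BoolFun n) → (∀ x → p x ≡ true → q x ≡ true) →
    count p ≤ count q
  count-mono {n} p q h = ∑-mono (cube n) (λ x → ⟦⟧-mono (h x))

  -- Affine forms and affine maps over 𝔽₂

  ⊕-assoc : (x y z : 𝔽₂^ n) → (x ⊕ y) ⊕ z ≡ x ⊕ (y ⊕ z)
  ⊕-assoc = zipWith-assoc xor-assoc

  ⊕-comm : (x y : 𝔽₂^ n) → x ⊕ y ≡ y ⊕ x
  ⊕-comm = zipWith-comm xor-comm

  ⊕-identityʳ : (x : 𝔽₂^ n) → x ⊕ 𝟎 ≡ x
  ⊕-identityʳ = zipWith-identityʳ xor-identityʳ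

  ⊕-identityˡ : (x : 𝔽₂^ n) → 𝟎 ⊕ x ≡ x
  ⊕-identityˡ x = trans (⊕-comm 𝟎 x) (⊕-identityʳ x)

  ⊕-self : (x : 𝔽₂^ n) → x ⊕ x ≡ 𝟎
  ⊕-self []      = refl
  ⊕-self (b ∷ x) = cong₂ _∷_ (xor-same b) (⊕-self x)

  ⊕-cancelʳ : (x y : 𝔽₂^ n) → (x ⊕ y) ⊕ y ≡ x
  ⊕-cancelʳ x y = trans (⊕-assoc x y y) (trans (cong (x ⊕_) (⊕-self y)) (⊕-identityʳ x))

  ⊕≡𝟎⇒≡ : (x y : 𝔽₂^ n) → x ⊕ y ≡ 𝟎 → x ≡ y
  ⊕≡𝟎⇒≡ x y e = trans (sym (⊕-cancelʳ x y)) (trans (cong (_⊕ y) e) (⊕-identityˡ y))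

  xor-cancelˡ : ∀ a b → a xor (a xor b) ≡ b
  xor-cancelˡ a b = trans (sym (xor-assoc a a b)) (cong (_xor b) (xor-same a))

  ≢⇒xor : ∀ {a b} → a ≢ b → a xor b ≡ true
  ≢⇒xor {false} {false} a≢b = contradiction refl a≢b
  ≢⇒xor {false} {true}  a≢b = refl
  ≢⇒xor {true}  {false} a≢b = refl
  ≢⇒xor {true}  {true}  a≢b = contradiction refl a≢b

  xor-interchange : ∀ a b c d → (a xor b) xor (c xor d) ≡ (a xor c) xor (b xor d)
  xor-interchange = solve 4 (λ a b c d → (a :+ b) :+ (c :+ d) := (a :+ c) :+ (b :+ d)) refl
    where open xor-∧-Solver

  ⊕-interchange : (x y z w : 𝔽₂^ n) → (x ⊕ y) ⊕ (z ⊕ w) ≡ (x ⊕ z) ⊕ (y ⊕ w)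
  ⊕-interchange []      []      []      []      = refl
  ⊕-interchange (a ∷ x) (b ∷ y) (c ∷ z) (d ∷ w) =
    cong₂ _∷_ (xor-interchange a b c d) (⊕-interchange x y z w)

  ∑ᶜ-translate : (e : 𝔽₂^ n) (f : 𝔽₂^ n → ℕ) → ∑ᶜ n (λ x → f (x ⊕ e)) ≡ ∑ᶜ n f
  ∑ᶜ-translate         []          f = refl
  ∑ᶜ-translate {suc n} (false ∷ e) f = trans (∑ᶜ-suc n _)
    (trans (cong₂ _+_ (∑ᶜ-translate e _) (∑ᶜ-translate e _)) (sym (∑ᶜ-suc n f)))
  ∑ᶜ-translate {suc n} (true  ∷ e) f = trans (∑ᶜ-suc n _)
    (trans (cong₂ _+_ (∑ᶜ-translate e _) (∑ᶜ-translate e _))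
      (trans (+-comm (∑ᶜ n (λ x → f (true ∷ x))) _) (sym (∑ᶜ-suc n f))))

  infix 7 _∙_

  _∙_ : 𝔽₂^ n → 𝔽₂^ n → Bool
  []      ∙ []      = false
  (a ∷ x) ∙ (b ∷ y) = (a ∧ b) xor (x ∙ y)

  ∙-comm : (x y : 𝔽₂^ n) → x ∙ y ≡ y ∙ x
  ∙-comm []      []      = refl
  ∙-comm (a ∷ x) (b ∷ y) = cong₂ _xor_ (∧-comm a b) (∙-comm x y)

  ∙-distribˡ-⊕ : (a x y : 𝔽₂^ n) → a ∙ (x ⊕ y) ≡ (a ∙ x) xor (a ∙ y)
  ∙-distribˡ-⊕ []      []      []      = refl
  ∙-distribˡ-⊕ (a ∷ c) (b ∷ x) (b′ ∷ y) =
    trans (cong ((a ∧ (b xor b′)) xor_) (∙-distribˡ-⊕ c x y)) (expand a b b′ (c ∙ x) (c ∙ y))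
    where
    open xor-∧-Solver
    expand : ∀ a b c d e → (a ∧ (b xor c)) xor (d xor e) ≡ ((a ∧ b) xor d) xor ((a ∧ c) xor e)
    expand = solve 5 (λ a b c d e →
      (a :* (b :+ c)) :+ (d :+ e) := ((a :* b) :+ d) :+ ((a :* c) :+ e)) refl

  ∙-distribʳ-⊕ : (a x y : 𝔽₂^ n) → (x ⊕ y) ∙ a ≡ (x ∙ a) xor (y ∙ a)
  ∙-distribʳ-⊕ a x y = trans (∙-comm (x ⊕ y) a)
    (trans (∙-distribˡ-⊕ a x y) (cong₂ _xor_ (∙-comm a x) (∙-comm a y)))

  ∙-zeroʳ : (x : 𝔽₂^ n) → x ∙ 𝟎 ≡ false
  ∙-zeroʳ []      = refl
  ∙-zeroʳ (a ∷ x) = cong₂ _xor_ (∧-zeroʳ a) (∙-zeroʳ x)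

  ∙-zeroˡ : (x : 𝔽₂^ n) → 𝟎 ∙ x ≡ false
  ∙-zeroˡ x = trans (∙-comm 𝟎 x) (∙-zeroʳ x)

  ∙-separates : (x y : 𝔽₂^ n) → x ≢ y → ∃[ a ] a ∙ x ≢ a ∙ y
  ∙-separates []      []      x≢y = contradiction refl x≢y
  ∙-separates (b ∷ x) (c ∷ y) x≢y with b ≟ᵇ c
  ... | no b≢c = (true ∷ 𝟎) , λ e → b≢c
    (trans (sym (unit b x)) (trans e (unit c y)))
    where
    unit : ∀ b (x : 𝔽₂^ n) → (true ∷ 𝟎) ∙ (b ∷ x) ≡ b
    unit b x = trans (cong (b xor_) (∙-zeroˡ x)) (xor-identityʳ b)
  ... | yes refl = let a , ne = ∙-separates x y (x≢y ∘ cong (b ∷_)) in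
    (false ∷ a) , ne

  -- An identity between values, without coefficients: `ℓ` plus its value at 𝟎 is additive. Closure
  -- under sums and composition is then a Boolean calculation.
  AffineForm : BoolFun n → Set
  AffineForm ℓ = ∀ x y → ℓ (x ⊕ y) ≡ (ℓ x xor ℓ y) xor ℓ 𝟎

  Affine : (𝔽₂^ m → 𝔽₂^ n) → Set
  Affine φ = ∀ x y → φ (x ⊕ y) ≡ (φ x ⊕ φ y) ⊕ φ 𝟎

  affineForm-∘ : {ℓ : BoolFun n} {φ : 𝔽₂^ m → 𝔽₂^ n} → AffineForm ℓ → Affine φ →
    AffineForm (ℓ ∘ φ)
  affineForm-∘ {ℓ = ℓ} {φ} aℓ aφ x y = begin
    ℓ (φ (x ⊕ y))                                               ≡⟨ cong ℓ (aφ x y) ⟩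
    ℓ ((φ x ⊕ φ y) ⊕ φ 𝟎)                                       ≡⟨ aℓ _ _ ⟩
    (ℓ (φ x ⊕ φ y) xor ℓ (φ 𝟎)) xor ℓ 𝟎                         ≡⟨ cong (λ b → (b xor ℓ (φ 𝟎)) xor ℓ 𝟎) (aℓ _ _) ⟩
    (((ℓ (φ x) xor ℓ (φ y)) xor ℓ 𝟎) xor ℓ (φ 𝟎)) xor ℓ 𝟎       ≡⟨ cancel (ℓ (φ x)) (ℓ (φ y)) (ℓ 𝟎) (ℓ (φ 𝟎)) ⟩
    (ℓ (φ x) xor ℓ (φ y)) xor ℓ (φ 𝟎)                           ∎
    where
    open ≡-Reasoning
    open xor-∧-Solver
    cancel : ∀ a b c d → (((a xor b) xor c) xor d) xor c ≡ (a xor b) xor d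
    cancel = solve 4 (λ a b c d → (((a :+ b) :+ c) :+ d) :+ c := (a :+ b) :+ d) refl

  ∙-affineForm : (b : Bool) (a : 𝔽₂^ n) → AffineForm (λ x → b xor (a ∙ x))
  ∙-affineForm b a x y = trans (cong (b xor_) (∙-distribˡ-⊕ a x y))
    (trans (regroup b (a ∙ x) (a ∙ y))
      (cong (λ c → ((b xor (a ∙ x)) xor (b xor (a ∙ y))) xor (b xor c)) (sym (∙-zeroʳ a))))
    where
    open xor-∧-Solver
    regroup : ∀ b c d → b xor (c xor d) ≡ ((b xor c) xor (b xor d)) xor (b xor false)
    regroup = solve 3 (λ b c d → b :+ (c :+ d) := ((b :+ c) :+ (b :+ d)) :+ (b :+ con false)) refl

  xor-affineForm : (ℓ ℓ′ : BoolFun n) → AffineForm ℓ → AffineForm ℓ′ →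
    AffineForm (λ x → ℓ x xor ℓ′ x)
  xor-affineForm ℓ ℓ′ aℓ aℓ′ x y = trans (cong₂ _xor_ (aℓ x y) (aℓ′ x y))
    (trans (xor-interchange (ℓ x xor ℓ y) (ℓ 𝟎) (ℓ′ x xor ℓ′ y) (ℓ′ 𝟎))
      (cong (_xor (ℓ 𝟎 xor ℓ′ 𝟎)) (xor-interchange (ℓ x) (ℓ y) (ℓ′ x) (ℓ′ y))))

  const-affineForm : ∀ b → AffineForm {n} (λ _ → b)
  const-affineForm b x y = cong (_xor b) (sym (xor-same b))

  head-affineForm : AffineForm {suc n} head
  head-affineForm (false ∷ x) (c ∷ y) = sym (xor-identityʳ c)
  head-affineForm (true ∷ x) (c ∷ y) = sym (xor-identityʳ _)

  tail-affine : Affine {suc n} tail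
  tail-affine (b ∷ x) (c ∷ y) = sym (⊕-identityʳ _)

  ∷-affine : {ℓ : BoolFun m} {φ : 𝔽₂^ m → 𝔽₂^ n} → AffineForm ℓ → Affine φ →
    Affine (λ x → ℓ x ∷ φ x)
  ∷-affine aℓ aφ x y = cong₂ _∷_ (aℓ x y) (aφ x y)

  id-affine : Affine {n} (λ x → x)
  id-affine x y = sym (⊕-identityʳ _)

  ⊕-affine : {φ ψ : 𝔽₂^ m → 𝔽₂^ n} → Affine φ → Affine ψ → Affine (λ x → φ x ⊕ ψ x)
  ⊕-affine {φ = φ} {ψ} aφ aψ x y = trans (cong₂ _⊕_ (aφ x y) (aψ x y))
    (trans (⊕-interchange (φ x ⊕ φ y) (φ 𝟎) (ψ x ⊕ ψ y) (ψ 𝟎))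
      (cong (_⊕ (φ 𝟎 ⊕ ψ 𝟎)) (⊕-interchange (φ x) (φ y) (ψ x) (ψ y))))

  const-affine : (e : 𝔽₂^ n) → Affine {m} (λ _ → e)
  const-affine e x y = trans (sym (⊕-identityˡ e)) (cong (_⊕ e) (sym (⊕-self e)))

  translate-affine : (e : 𝔽₂^ n) → Affine (_⊕ e)
  translate-affine e = ⊕-affine id-affine (const-affine e)

  const-∷-affine : (b : Bool) → Affine {n} (b ∷_)
  const-∷-affine b x y = cong₂ _∷_ (sym (trans (cong (_xor b) (xor-same b)) refl)) (id-affine x y)

  ·-distribʳ-xor : ∀ s t (v : 𝔽₂^ n) → (s xor t) · v ≡ s · v ⊕ t · v
  ·-distribʳ-xor s t []      = refl
  ·-distribʳ-xor s t (b ∷ v) = cong₂ _∷_ (∧-distribʳ-xor b s t) (·-distribʳ-xor s t v)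

  ·-zeroˡ : (v : 𝔽₂^ n) → false · v ≡ 𝟎
  ·-zeroˡ []      = refl
  ·-zeroˡ (_ ∷ v) = cong (false ∷_) (·-zeroˡ v)

  ·-identityˡ : (v : 𝔽₂^ n) → true · v ≡ v
  ·-identityˡ []      = refl
  ·-identityˡ (b ∷ v) = cong (b ∷_) (·-identityˡ v)

  combination-⊕ : (x y : 𝔽₂^ k) (vs : Vec (𝔽₂^ n) k) →
    combination (x ⊕ y) vs ≡ combination x vs ⊕ combination y vs
  combination-⊕ []      []      []       = sym (⊕-self 𝟎)
  combination-⊕ (s ∷ x) (t ∷ y) (v ∷ vs) = trans
    (cong₂ _⊕_ (·-distribʳ-xor s t v) (combination-⊕ x y vs))
    (⊕-interchange (s · v) (t · v) _ _)

  combination-𝟎 : (vs : Vec (𝔽₂^ n) k) → combination 𝟎 vs ≡ 𝟎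
  combination-𝟎 []       = refl
  combination-𝟎 (v ∷ vs) = trans (cong₂ _⊕_ (·-zeroˡ v) (combination-𝟎 vs)) (⊕-self 𝟎)

  combination-affine : (vs : Vec (𝔽₂^ n) k) → Affine (λ x → combination x vs)
  combination-affine vs x y = trans (combination-⊕ x y vs)
    (sym (trans (cong ((combination x vs ⊕ combination y vs) ⊕_) (combination-𝟎 vs)) (⊕-identityʳ _)))

  apply-affine : (φ : AffineMap k n) → Affine (apply φ)
  apply-affine (u , vs) = ⊕-affine (const-affine u) (combination-affine vs)

  ·-affine : {ℓ : BoolFun m} → AffineForm ℓ → (e : 𝔽₂^ n) → Affine (λ x → ℓ x · e)
  ·-affine {ℓ = ℓ} aℓ e x y = trans (cong (_· e) (aℓ x y))
    (trans (·-distribʳ-xor (ℓ x xor ℓ y) (ℓ 𝟎) e)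
      (cong (_⊕ ℓ 𝟎 · e) (·-distribʳ-xor (ℓ x) (ℓ y) e)))

  ∙-· : (c : 𝔽₂^ n) (t : Bool) (e : 𝔽₂^ n) → c ∙ (t · e) ≡ t ∧ (c ∙ e)
  ∙-· c false e = trans (cong (c ∙_) (·-zeroˡ e)) (∙-zeroʳ c)
  ∙-· c true  e = cong (c ∙_) (·-identityˡ e)

  -- Degree

  -- Strict bounds give the zero function degree -∞: Deg< 0 f says f = 0.
  data Deg< {n : ℕ} : ℕ → BoolFun n → Set where
    deg<-zero : Deg< e (λ _ → false)
    deg<-one  : Deg< (suc e) (λ _ → true)
    deg<-xor  : ∀ {f g} → Deg< e f → Deg< e g → Deg< e (λ x → f x xor g x)
    deg<-∧    : ∀ {ℓ f} → AffineForm ℓ → Deg< e f → Deg< (suc e) (λ x → ℓ x ∧ f x)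
    deg<-cong : ∀ {f g} → f ≗ g → Deg< e f → Deg< e g

  deg<0⇒zero : {f : BoolFun n} → Deg< 0 f → ∀ x → f x ≡ false
  deg<0⇒zero deg<-zero         x = refl
  deg<0⇒zero (deg<-xor f g)    x = cong₂ _xor_ (deg<0⇒zero f x) (deg<0⇒zero g x)
  deg<0⇒zero (deg<-cong f≗g f) x = trans (sym (f≗g x)) (deg<0⇒zero f x)

  deg<-∧const : ∀ b {f : BoolFun n} → Deg< e f → Deg< e (λ x → b ∧ f x)
  deg<-∧const false f = deg<-zero
  deg<-∧const true  f = f

  deg<-∘ : {f : BoolFun n} {φ : 𝔽₂^ m → 𝔽₂^ n} → Affine φ → Deg< e f → Deg< e (f ∘ φ)
  deg<-∘ aφ deg<-zero         = deg<-zero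
  deg<-∘ aφ deg<-one          = deg<-one
  deg<-∘ aφ (deg<-xor f g)    = deg<-xor (deg<-∘ aφ f) (deg<-∘ aφ g)
  deg<-∘ aφ (deg<-∧ {ℓ = ℓ} aℓ f) = deg<-∧ (affineForm-∘ {ℓ = ℓ} aℓ aφ) (deg<-∘ aφ f)
  deg<-∘ aφ (deg<-cong f≗g f) = deg<-cong (λ x → f≗g _) (deg<-∘ aφ f)

  -- Induction on the construction of `f`. For a product with an affine form, the product rule
  -- leaves `ℓ` times the derivative of `f`, plus a constant times a translate of `f`, because the
  -- derivative of `ℓ` is constant.
  deg<-derivative : {f : BoolFun n} (v : 𝔽₂^ n) → Deg< e f →
    Deg< (pred e) (λ x → f x xor f (x ⊕ v))
  deg<-derivative v deg<-zero = deg<-zero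
  deg<-derivative v deg<-one  = deg<-zero
  deg<-derivative v (deg<-xor {f = f} {g} df dg) = deg<-cong
    (λ x → xor-interchange (f x) (f (x ⊕ v)) (g x) (g (x ⊕ v)))
    (deg<-xor (deg<-derivative v df) (deg<-derivative v dg))
  deg<-derivative v (deg<-∧ {e = e} {ℓ} {f} aℓ df) = deg<-cong
    (λ x → trans (product-rule (ℓ x) (ℓ v) (ℓ 𝟎) (f x) (f (x ⊕ v)))
      (cong (λ b → (ℓ x ∧ f x) xor (b ∧ f (x ⊕ v))) (sym (aℓ x v))))
    (deg<-xor (first e (deg<-derivative v df))
      (deg<-∧const (ℓ v xor ℓ 𝟎) (deg<-∘ (translate-affine v) df)))
    where
    first : ∀ e → Deg< (pred e) (λ x → f x xor f (x ⊕ v)) →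
      Deg< e (λ x → ℓ x ∧ (f x xor f (x ⊕ v)))
    first zero    Df = deg<-cong
      (λ x → sym (trans (cong (ℓ x ∧_) (deg<0⇒zero Df x)) (∧-zeroʳ (ℓ x)))) deg<-zero
    first (suc e) Df = deg<-∧ aℓ Df
    open xor-∧-Solver
    product-rule : ∀ a b c d e → (a ∧ (d xor e)) xor ((b xor c) ∧ e) ≡
      (a ∧ d) xor (((a xor b) xor c) ∧ e)
    product-rule = solve 5 (λ a b c d e → (a :* (d :+ e)) :+ ((b :+ c) :* e) :=
      (a :* d) :+ (((a :+ b) :+ c) :* e)) refl
  deg<-derivative v (deg<-cong f≗g df) = deg<-cong
    (λ x → cong₂ _xor_ (f≗g x) (f≗g _)) (deg<-derivative v df)

  restrict : Bool → BoolFun (suc n) → BoolFun n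
  restrict b f x = f (b ∷ x)

  ∂ : BoolFun (suc n) → BoolFun n
  ∂ f x = f (false ∷ x) xor f (true ∷ x)

  deg<-restrict : ∀ b {f : BoolFun (suc n)} → Deg< e f → Deg< e (restrict b f)
  deg<-restrict b = deg<-∘ (const-∷-affine b)

  deg<-∂ : {f : BoolFun (suc n)} → Deg< e f → Deg< (pred e) (∂ f)
  deg<-∂ {f = f} df = deg<-cong
    (λ x → cong (λ y → f (false ∷ x) xor f (true ∷ y)) (⊕-identityʳ x))
    (deg<-restrict false (deg<-derivative (true ∷ 𝟎) df))

  -- f(x₀, x) = f(0, x) + x₀ ∂f(x)
  deg<-join : {f : BoolFun (suc n)} → Deg< (suc e) (restrict false f) → Deg< e (∂ f) →
    Deg< (suc e) f
  deg<-join {f = f} df₀ d∂f = deg<-cong eq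
    (deg<-xor (deg<-∘ tail-affine df₀) (deg<-∧ head-affineForm (deg<-∘ tail-affine d∂f)))
    where
    eq : ∀ x → f (false ∷ tail x) xor (head x ∧ ∂ f (tail x)) ≡ f x
    eq (false ∷ x) = xor-identityʳ _
    eq (true ∷ x)  = xor-cancelˡ (f (false ∷ x)) (f (true ∷ x))

  -- The recursion of `anf` takes one `∂` for each member of `S`, and each `∂` lowers the strict
  -- bound by one. With the converse `anf⇒deg<`, this ties the inductive notion to `deg`.
  deg<⇒anf : {f : BoolFun n} → Deg< e f → ∀ S → anf f S ≡ true → ∣ S ∣ < e
  deg<⇒anf {e = zero} df [] eq = contradiction (trans (sym (deg<0⇒zero df [])) eq) λ ()
  deg<⇒anf {e = suc e} df [] eq = s≤s z≤n
  deg<⇒anf df (false ∷ S) eq = deg<⇒anf (deg<-restrict false df) S eq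
  deg<⇒anf {e = zero} df (true ∷ S) eq = contradiction (deg<⇒anf (deg<-∂ df) S eq) λ ()
  deg<⇒anf {e = suc e} df (true ∷ S) eq = s≤s (deg<⇒anf (deg<-∂ df) S eq)

  anf⇒deg< : (f : BoolFun n) → (∀ S → anf f S ≡ true → ∣ S ∣ < e) → Deg< e f
  anf⇒deg< {zero} {e} f h with f [] in eq
  ... | false = deg<-cong (λ { [] → sym eq }) deg<-zero
  ... | true with e | h [] eq
  ...   | suc _ | _ = deg<-cong (λ { [] → sym eq }) deg<-one
  anf⇒deg< {suc n} {zero} f h = deg<-cong zero≗f deg<-zero
    where
    f₀ : ∀ x → f (false ∷ x) ≡ false
    f₀ = deg<0⇒zero (anf⇒deg< (restrict false f) (λ S → h (false ∷ S)))
    ∂f : ∀ x → ∂ f x ≡ false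
    ∂f = deg<0⇒zero (anf⇒deg< (∂ f) (λ S eq → contradiction (h (true ∷ S) eq) λ ()))
    zero≗f : ∀ x → false ≡ f x
    zero≗f (false ∷ x) = sym (f₀ x)
    zero≗f (true  ∷ x) = sym (trans (sym (cong (_xor f (true ∷ x)) (f₀ x))) (∂f x))
  anf⇒deg< {suc n} {suc e} f h = deg<-join
    (anf⇒deg< (restrict false f) (λ S → h (false ∷ S)))
    (anf⇒deg< (∂ f) (λ S eq → s≤s⁻¹ (h (true ∷ S) eq)))

  deg≤⇒deg< : {f : BoolFun n} → deg f ≤ d → Deg< (suc d) f
  deg≤⇒deg< {n} {d} {f} deg≤d = anf⇒deg< f λ S eq → s≤s (≤-trans
    (ListAll.lookup (xs≤max 0 _) (∈-map⁺ ∣_∣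
      (∈-filter⁺ (λ S → anf f S ≟ᵇ true) (cube-complete S) eq)))
    deg≤d)

  deg<⇒deg≤ : {f : BoolFun n} → Deg< (suc d) f → deg f ≤ d
  deg<⇒deg≤ {n} {d} {f} df = max≤v⁺ z≤n (ListAll.map⁺ (ListAll.tabulate λ {S} S∈ →
    s≤s⁻¹ (deg<⇒anf df S (proj₂ (∈-filter⁻ (λ S → anf f S ≟ᵇ true) {xs = cube n} S∈)))))

  deg<? : ∀ d (f : BoolFun n) → Dec (Deg< (suc d) f)
  deg<? d f with deg f ≤? d
  ... | yes p = yes (deg≤⇒deg< p)
  ... | no ¬p = no (¬p ∘ deg<⇒deg≤)

  -- Either ∂ f vanishes and f has two copies of the zeros of its restriction, or
  -- the support of ∂ f, of smaller degree, is covered by those of the restrictions.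
  schwartz-zippel : {f : BoolFun n} → Deg< (suc d) f → ∀ x → f x ≡ true →
    2 ^ n ≤ 2 ^ d * count f
  schwartz-zippel {zero} {d} {f} df [] eq rewrite eq =
    ≤-trans (^-monoʳ-≤ 2 {0} {d} z≤n) (≤-reflexive (sym (*-identityʳ _)))
  schwartz-zippel {suc n} {d} {f} df x eq with anySubset? (λ y → ∂ f y ≟ᵇ true)
  schwartz-zippel {suc n} {zero} {f} df x eq | yes (y , ∂fy) =
    contradiction (trans (sym (deg<0⇒zero (deg<-∂ df) y)) ∂fy) λ ()
  schwartz-zippel {suc n} {suc d} {f} df x eq | yes (y , ∂fy) = begin
    2 * 2 ^ n                                   ≤⟨ *-monoʳ-≤ 2 (schwartz-zippel (deg<-∂ df) y ∂fy) ⟩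
    2 * (2 ^ d * count (∂ f))                   ≡⟨ sym (*-assoc 2 (2 ^ d) _) ⟩
    2 ^ suc d * count (∂ f)                     ≤⟨ *-monoʳ-≤ (2 ^ suc d) ∂≤ ⟩
    2 ^ suc d * count f                         ∎
    where
    open ≤-Reasoning
    ⟦xor⟧≤ : ∀ a b → ⟦ a xor b ⟧ ≤ ⟦ a ⟧ + ⟦ b ⟧
    ⟦xor⟧≤ false b = ≤-refl
    ⟦xor⟧≤ true  b = ≤-trans (⟦⟧≤1 (not b)) (s≤s z≤n)
    ∂≤ : count (∂ f) ≤ count f
    ∂≤ = begin
      count (∂ f)                                       ≤⟨ ∑-mono (cube n) (λ x → ⟦xor⟧≤ (f (false ∷ x)) _) ⟩
      ∑ᶜ n (λ x → ⟦ f (false ∷ x) ⟧ + ⟦ f (true ∷ x) ⟧) ≡⟨ ∑-+ (cube n) _ _ ⟩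
      count (restrict false f) + count (restrict true f) ≡⟨ sym (∑ᶜ-suc n _) ⟩
      count f                                           ∎
  schwartz-zippel {suc n} {d} {f} df (b ∷ x) eq | no ∂f≡0 = begin
    2 * 2 ^ n                          ≤⟨ *-monoʳ-≤ 2 (schwartz-zippel (deg<-restrict false df) x (at b eq)) ⟩
    2 * (2 ^ d * c₀)                   ≡⟨ double (2 ^ d) c₀ ⟩
    2 ^ d * (c₀ + c₀)                  ≡⟨ cong (λ c → 2 ^ d * (c₀ + c)) (∑-cong (cube n) (λ x → cong ⟦_⟧ (same x))) ⟩
    2 ^ d * (c₀ + count (restrict true f)) ≡⟨ cong (2 ^ d *_) (sym (∑ᶜ-suc n _)) ⟩
    2 ^ d * count f                    ∎
    where
    open ≤-Reasoning
    c₀ = count (restrict false f)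
    double : ∀ a b → 2 * (a * b) ≡ a * (b + b)
    double = solve-∀
    same : ∀ x → f (false ∷ x) ≡ f (true ∷ x)
    same x with f (false ∷ x) in e₀ | f (true ∷ x) in e₁
    ... | false | false = refl
    ... | true  | true  = refl
    ... | false | true  = contradiction (x , cong₂ _xor_ e₀ e₁) ∂f≡0
    ... | true  | false = contradiction (x , cong₂ _xor_ e₀ e₁) ∂f≡0
    at : ∀ b → f (b ∷ x) ≡ true → f (false ∷ x) ≡ true
    at false eq = eq
    at true  eq = trans (same x) eq

  -- Restriction to graphs of affine forms

  infix 4 _≟ⱽ_

  _≟ⱽ_ : (x y : 𝔽₂^ n) → Dec (x ≡ y)
  _≟ⱽ_ = ≡-dec _≟ᵇ_

  form : 𝔽₂^ suc m → BoolFun m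
  form (b ∷ a) x = b xor (a ∙ x)

  -- The hyperplanes transversal to the first coordinate direction are the graphs
  -- of the affine forms.
  graph : 𝔽₂^ suc m → 𝔽₂^ m → 𝔽₂^ suc m
  graph s x = form s x ∷ x

  form-⊕ : (s t : 𝔽₂^ suc m) (x : 𝔽₂^ m) → form (s ⊕ t) x ≡ form s x xor form t x
  form-⊕ (b ∷ a) (c ∷ a′) x = trans (cong ((b xor c) xor_) (∙-distribʳ-⊕ x a a′))
    (xor-interchange b c (a ∙ x) (a′ ∙ x))

  form-affine : (s : 𝔽₂^ suc m) → AffineForm (form s)
  form-affine (b ∷ a) = ∙-affineForm b a

  graph-affine : (s : 𝔽₂^ suc m) → Affine (graph s)
  graph-affine s = ∷-affine {ℓ = form s} (form-affine s) id-affine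

  ∘-graph : (f : BoolFun (suc m)) (s : 𝔽₂^ suc m) (x : 𝔽₂^ m) →
    f (graph s x) ≡ f (false ∷ x) xor (form s x ∧ ∂ f x)
  ∘-graph f s x with form s x
  ... | false = sym (xor-identityʳ _)
  ... | true  = sym (xor-cancelˡ (f (false ∷ x)) (f (true ∷ x)))

  -- A monomial of degree d of h and a variable xᵢ outside it give a monomial of
  -- degree d + 1 of xᵢ h.
  deg<-pred : {h : BoolFun m} → d < m → Deg< (suc d) h →
    (∀ a → Deg< (suc d) (λ x → (a ∙ x) ∧ h x)) → Deg< d h
  deg<-pred {suc m} {d} {h} d<m dh dxh = go d d<m dh dxh deg-h₁
    where
    -- `∂` turns the product of `h` with its first variable into the restriction of `h` to first
    -- coordinate 1, and lowers the bound.
    deg-h₁ : Deg< d (restrict true h)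
    deg-h₁ = deg<-cong
      (λ x → cong (λ b → (b ∧ h (false ∷ x)) xor ((true xor b) ∧ h (true ∷ x))) (∙-zeroˡ x))
      (deg<-∂ (dxh (true ∷ 𝟎)))
    go : ∀ d → d < suc m → Deg< (suc d) h → (∀ a → Deg< (suc d) (λ x → (a ∙ x) ∧ h x)) →
      Deg< d (restrict true h) → Deg< d h
    go zero _ dh _ dh₁ = deg<-cong
      (λ { (false ∷ x) → sym (trans (sym (xor-identityʳ _))
             (trans (cong (h (false ∷ x) xor_) (sym (deg<0⇒zero dh₁ x))) (deg<0⇒zero (deg<-∂ dh) x)))
         ; (true ∷ x) → sym (deg<0⇒zero dh₁ x) })
      deg<-zero
    go (suc d) d<m dh dxh dh₁ = deg<-join
      (deg<-cong
        (λ x → trans (cong (_xor h (true ∷ x)) (xor-comm (h (false ∷ x)) _))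
          (trans (xor-comm _ (h (true ∷ x)))
          (xor-cancelˡ (h (true ∷ x)) (h (false ∷ x)))))
        (deg<-xor (deg<-∂ dh) dh₁))
      (deg<-pred (s<s⁻¹ d<m) (deg<-∂ dh) (λ a → deg<-cong
        (λ x → sym (∧-distribˡ-xor (a ∙ x) (h (false ∷ x)) _))
        (deg<-∂ (dxh (false ∷ a)))))

  -- The graph of the zero form bounds f(0, x). By `∘-graph`, removing this part from the other
  -- restrictions bounds the product of `∂ f` with every affine form, so `deg<-pred` bounds `∂ f`
  -- itself. For `d = m` the claim fails: the product of all variables becomes a polynomial of
  -- degree at most `m` on every graph.
  deg<-from-graphs : {f : BoolFun (suc m)} → d < m →
    (∀ s → Deg< (suc d) (f ∘ graph s)) → Deg< (suc d) f
  deg<-from-graphs {m} {d} {f} d<m h = deg<-join deg-f₀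
    (deg<-pred d<m
      (deg<-cong (λ x → cong (λ b → not b ∧ ∂ f x) (∙-zeroˡ x)) (form∧∂ (true ∷ 𝟎)))
      (λ a → form∧∂ (false ∷ a)))
    where
    deg-f₀ : Deg< (suc d) (restrict false f)
    deg-f₀ = deg<-cong (λ x → cong (λ b → f (b ∷ x)) (∙-zeroˡ x)) (h 𝟎)
    form∧∂ : ∀ s → Deg< (suc d) (λ x → form s x ∧ ∂ f x)
    form∧∂ s = deg<-cong
      (λ x → trans (cong (f (false ∷ x) xor_) (∘-graph f s x))
        (xor-cancelˡ (f (false ∷ x)) (form s x ∧ ∂ f x)))
      (deg<-xor deg-f₀ (h s))

  bad : ∀ d → BoolFun n → ℕ
  bad d f = ⟦ not (does (deg<? d f)) ⟧

  bad-intro : {f : BoolFun n} → ¬ Deg< (suc d) f → bad d f ≡ 1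
  bad-intro {d = d} {f} ¬df = cong (⟦_⟧ ∘ not) (does-false (deg<? d f) ¬df)

  -- The graphs on which f has degree ≤ d form an affine subspace of the space of
  -- affine forms, by ∘-graph; it is proper, so at most half of everything.
  half-bad : {f : BoolFun (suc m)} → d < m → ¬ Deg< (suc d) f →
    2 ^ suc m ≤ 2 * ∑ᶜ (suc m) (λ s → bad d (f ∘ graph s))
  half-bad {m} {d} {f} d<m ¬df
    with anySubset? (λ s → ¬? (deg<? d (f ∘ graph s))) | anySubset? (λ s → deg<? d (f ∘ graph s))
  ... | no none | _ = contradiction
    (deg<-from-graphs d<m (λ s → decidable-stable (deg<? d _) (λ ¬d → none (s , ¬d)))) ¬df
  ... | yes _ | no none = ≤-trans (≤-reflexive (sym (trans (∑-cong (cube (suc m))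
      (λ s → bad-intro (λ d → none (s , d)))) (∑ᶜ-one (suc m))))) (m≤m+n _ _)
  ... | yes (s , bad-s) | yes (t , good-t) = begin
    2 ^ suc m                                        ≡⟨ sym (∑ᶜ-one (suc m)) ⟩
    ∑ᶜ (suc m) (λ _ → 1)                             ≡⟨ ∑-cong (cube (suc m)) (λ r → sym (⟦⟧+⟦not⟧ (good r))) ⟩
    ∑ᶜ (suc m) (λ r → ⟦ good r ⟧ + ⟦ not (good r) ⟧) ≡⟨ ∑-+ (cube (suc m)) _ _ ⟩
    count good + B                                   ≤⟨ +-monoˡ-≤ B (∑-mono (cube (suc m)) (λ r → ⟦⟧-mono (moved r))) ⟩
    ∑ᶜ (suc m) (λ r → ⟦ not (good (r ⊕ (s ⊕ t))) ⟧) + B ≡⟨ cong (_+ B) (∑ᶜ-translate (s ⊕ t) (λ r → ⟦ not (good r) ⟧)) ⟩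
    B + B                                            ≡⟨ cong (B +_) (sym (+-identityʳ B)) ⟩
    2 * B                                            ∎
    where
    open ≤-Reasoning
    good : BoolFun (suc m)
    good r = does (deg<? d (f ∘ graph r))
    B = ∑ᶜ (suc m) (λ s → bad d (f ∘ graph s))
    -- Restrictions depend on the form in an affine way, and `r`, `r ⊕ (s ⊕ t)` and `t` add up to
    -- `s`. With `t` good and `s` bad, `r` and `r ⊕ (s ⊕ t)` cannot both be good.
    sum₃ : ∀ r x → (f (graph r x) xor f (graph (r ⊕ (s ⊕ t)) x)) xor f (graph t x) ≡ f (graph s x)
    sum₃ r x = trans (cong₂ _xor_ (cong₂ _xor_ (∘-graph f r x)
        (trans (∘-graph f (r ⊕ (s ⊕ t)) x) (cong (λ b → f (false ∷ x) xor (b ∧ ∂ f x))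
          (trans (form-⊕ r (s ⊕ t) x) (cong (form r x xor_) (form-⊕ s t x))))))
        (∘-graph f t x))
      (trans (collect (f (false ∷ x)) (∂ f x) (form r x) (form s x) (form t x)) (sym (∘-graph f s x)))
      where
      open xor-∧-Solver
      collect : ∀ a b r s t → ((a xor (r ∧ b)) xor (a xor ((r xor (s xor t)) ∧ b))) xor (a xor (t ∧ b)) ≡ a xor (s ∧ b)
      collect = solve 5 (λ a b r s t →
        ((a :+ (r :* b)) :+ (a :+ ((r :+ (s :+ t)) :* b))) :+ (a :+ (t :* b)) := a :+ (s :* b)) refl
    moved : ∀ r → good r ≡ true → not (good (r ⊕ (s ⊕ t))) ≡ true
    moved r good-r = cong not (does-false (deg<? d (f ∘ graph (r ⊕ (s ⊕ t)))) (λ good-r′ → bad-s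
      (deg<-cong (sum₃ r) (deg<-xor (deg<-xor (does⇒ (deg<? d (f ∘ graph r)) good-r) good-r′) good-t))))

  -- Moments of the number of errors on a random graph

  uniform₁ : (x : 𝔽₂^ m) (F : Bool → ℕ) →
    2 * ∑ᶜ (suc m) (λ s → F (form s x)) ≡ 2 ^ suc m * (F false + F true)
  uniform₁ {m} x F = begin
    S + (S + 0)                                            ≡⟨ cong (S +_) (+-identityʳ S) ⟩
    S + S                                                  ≡⟨ cong (S +_) (sym (∑ᶜ-translate (true ∷ 𝟎) (λ s → F (form s x)))) ⟩
    S + ∑ᶜ (suc m) (λ s → F (form (s ⊕ (true ∷ 𝟎)) x))     ≡⟨ sym (∑-+ (cube (suc m)) _ _) ⟩
    ∑ᶜ (suc m) (λ s → F (form s x) + F (form (s ⊕ (true ∷ 𝟎)) x)) ≡⟨ ∑-cong (cube (suc m)) both ⟩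
    ∑ᶜ (suc m) (λ s → F false + F true)                    ≡⟨ ∑ᶜ-const (suc m) _ ⟩
    2 ^ suc m * (F false + F true)                         ∎
    where
    open ≡-Reasoning
    S = ∑ᶜ (suc m) (λ s → F (form s x))
    flip : ∀ b → F b + F (b xor true) ≡ F false + F true
    flip false = refl
    flip true  = +-comm (F true) _
    both : ∀ s → F (form s x) + F (form (s ⊕ (true ∷ 𝟎)) x) ≡ F false + F true
    both s = trans (cong (λ b → F (form s x) + F b) (trans (form-⊕ s (true ∷ 𝟎) x)
      (cong (λ b → form s x xor not b) (∙-zeroˡ x)))) (flip (form s x))

  form-separates : (x y : 𝔽₂^ m) → x ≢ y → ∃[ s ] form s x ≡ true × form s y ≡ false
  form-separates x y x≢y with ∙-separates x y x≢y
  ... | a , ne = (not (a ∙ x) ∷ a) , true-at (a ∙ x) , false-at (a ∙ x) (a ∙ y) ne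
    where
    true-at : ∀ b → not b xor b ≡ true
    true-at false = refl
    true-at true  = refl
    false-at : ∀ b c → b ≢ c → not b xor c ≡ false
    false-at false false ne = contradiction refl ne
    false-at false true  ne = refl
    false-at true  false ne = refl
    false-at true  true  ne = contradiction refl ne

  -- Pairwise independence. Adding a form that is 1 at `x` and 0 at `y`, one with the roles
  -- exchanged, or their sum flips the two values in every possible way; averaging over these four
  -- translations gives all four pairs equal weight.
  uniform₂ : (x y : 𝔽₂^ m) → x ≢ y → (F : Bool → Bool → ℕ) →
    4 * ∑ᶜ (suc m) (λ s → F (form s x) (form s y)) ≡
    2 ^ suc m * ((F false false + F false true) + (F true false + F true true))
  uniform₂ {m} x y x≢y F
    with form-separates x y x≢y | form-separates y x (x≢y ∘ sym)
  ... | s₁ , s₁x , s₁y | s₂ , s₂y , s₂x = begin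
    4 * S                  ≡⟨ four S ⟩
    (S + S) + (S + S)      ≡⟨ cong₂ _+_ (cong (S +_) (shift s₂)) (cong₂ _+_ (shift s₁) (shift (s₁ ⊕ s₂))) ⟩
    _                      ≡⟨ cong₂ _+_ (sym (∑-+ (cube (suc m)) _ _)) (sym (∑-+ (cube (suc m)) _ _)) ⟩
    _                      ≡⟨ sym (∑-+ (cube (suc m)) _ _) ⟩
    ∑ᶜ (suc m) (λ s → (F (form s x) (form s y) + at s₂ s) + (at s₁ s + at (s₁ ⊕ s₂) s)) ≡⟨ ∑-cong (cube (suc m)) all-four ⟩
    ∑ᶜ (suc m) (λ s → T)   ≡⟨ ∑ᶜ-const (suc m) T ⟩
    2 ^ suc m * T          ∎
    where
    open ≡-Reasoning
    T = (F false false + F false true) + (F true false + F true true)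
    S = ∑ᶜ (suc m) (λ s → F (form s x) (form s y))
    at : 𝔽₂^ suc m → 𝔽₂^ suc m → ℕ
    at t s = F (form (s ⊕ t) x) (form (s ⊕ t) y)
    shift : ∀ t → S ≡ ∑ᶜ (suc m) (at t)
    shift t = sym (∑ᶜ-translate t (λ s → F (form s x) (form s y)))
    four : ∀ a → 4 * a ≡ (a + a) + (a + a)
    four = solve-∀
    all-four : ∀ s → (F (form s x) (form s y) + at s₂ s) + (at s₁ s + at (s₁ ⊕ s₂) s) ≡ T
    all-four s
      rewrite form-⊕ s s₂ x | form-⊕ s s₂ y | form-⊕ s s₁ x | form-⊕ s s₁ y
            | form-⊕ s (s₁ ⊕ s₂) x | form-⊕ s (s₁ ⊕ s₂) y | form-⊕ s₁ s₂ x | form-⊕ s₁ s₂ y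
            | s₁x | s₁y | s₂x | s₂y
      with form s x | form s y
    ... | false | false = refl
    ... | false | true  = cong₂ _+_ (+-comm (F false true) _) (+-comm (F true true) _)
    ... | true  | false = +-comm (F true false + F true true) _
    ... | true  | true  = trans (+-comm (F true true + F true false) _)
      (cong₂ _+_ (+-comm (F false true) _) (+-comm (F true true) _))

  fibre : BoolFun (suc m) → 𝔽₂^ m → ℕ
  fibre e x = ⟦ e (false ∷ x) ⟧ + ⟦ e (true ∷ x) ⟧

  ∑-fibre : (e : BoolFun (suc m)) → ∑ᶜ m (fibre e) ≡ count e
  ∑-fibre {m} e = trans (∑-+ (cube m) _ _) (sym (∑ᶜ-suc m _))

  first-moment : (e : BoolFun (suc m)) →
    2 * ∑ᶜ (suc m) (λ s → count (e ∘ graph s)) ≡ 2 ^ suc m * count e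
  first-moment {m} e = begin
    2 * ∑ᶜ (suc m) (λ s → count (e ∘ graph s))
      ≡⟨ cong (2 *_) (∑-swap (cube (suc m)) (cube m) _) ⟩
    2 * ∑ᶜ m (λ x → ∑ᶜ (suc m) (λ s → ⟦ e (graph s x) ⟧))
      ≡⟨ sym (∑-*ˡ (cube m) 2 _) ⟩
    ∑ᶜ m (λ x → 2 * ∑ᶜ (suc m) (λ s → ⟦ e (graph s x) ⟧))
      ≡⟨ ∑-cong (cube m) (λ x → uniform₁ x (λ b → ⟦ e (b ∷ x) ⟧)) ⟩
    ∑ᶜ m (λ x → 2 ^ suc m * fibre e x)
      ≡⟨ ∑-*ˡ (cube m) (2 ^ suc m) _ ⟩
    2 ^ suc m * ∑ᶜ m (fibre e)
      ≡⟨ cong (2 ^ suc m *_) (∑-fibre e) ⟩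
    2 ^ suc m * count e ∎
    where open ≡-Reasoning

  -- Pairs of distinct base points contribute exactly the product of their means. On the diagonal
  -- the square of an indicator is the indicator, and the excess is absorbed by `2 ν ≤ ν² + ν`,
  -- valid because a fibre has 0, 1 or 2 points.
  second-moment : (e : BoolFun (suc m)) →
    4 * ∑ᶜ (suc m) (λ s → count (e ∘ graph s) * count (e ∘ graph s)) ≤
    2 ^ suc m * (count e * count e + count e)
  second-moment {m} e = begin
    4 * ∑ᶜ (suc m) (λ s → count (e ∘ graph s) * count (e ∘ graph s))
      ≡⟨ cong (4 *_) (∑-cong (cube (suc m)) (λ s → ∑-* (cube m) (cube m) _ _)) ⟩
    4 * ∑ᶜ (suc m) (λ s → ∑ᶜ m (λ x → ∑ᶜ m (λ y → X s x * X s y)))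
      ≡⟨ cong (4 *_) (∑-swap (cube (suc m)) (cube m) _) ⟩
    4 * ∑ᶜ m (λ x → ∑ᶜ (suc m) (λ s → ∑ᶜ m (λ y → X s x * X s y)))
      ≡⟨ sym (∑-*ˡ (cube m) 4 _) ⟩
    ∑ᶜ m (λ x → 4 * ∑ᶜ (suc m) (λ s → ∑ᶜ m (λ y → X s x * X s y)))
      ≡⟨ ∑-cong (cube m) (λ x → trans (cong (4 *_) (∑-swap (cube (suc m)) (cube m) _)) (sym (∑-*ˡ (cube m) 4 _))) ⟩
    ∑ᶜ m (λ x → ∑ᶜ m (λ y → 4 * ∑ᶜ (suc m) (λ s → X s x * X s y)))
      ≤⟨ ∑-mono (cube m) (λ x → ∑-mono (cube m) (λ y → correlation x y)) ⟩
    ∑ᶜ m (λ x → ∑ᶜ m (λ y → q * (ν x * ν y + ν x * ⟦ does (x ≟ⱽ y) ⟧)))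
      ≡⟨ ∑-cong (cube m) (λ x → trans (∑-*ˡ (cube m) q _) (cong (q *_) (trans (∑-+ (cube m) _ _)
           (cong₂ _+_ (∑-*ˡ (cube m) (ν x) _) (∑-*ˡ (cube m) (ν x) _))))) ⟩
    ∑ᶜ m (λ x → q * (ν x * ∑ᶜ m ν + ν x * ∑ᶜ m (λ y → ⟦ does (x ≟ⱽ y) ⟧)))
      ≤⟨ ∑-mono (cube m) (λ x → *-monoʳ-≤ q (+-monoʳ-≤ (ν x * ∑ᶜ m ν) (*-monoʳ-≤ (ν x) (diagonal x)))) ⟩
    ∑ᶜ m (λ x → q * (ν x * ∑ᶜ m ν + ν x * 1))
      ≡⟨ trans (∑-*ˡ (cube m) q _) (cong (q *_) (trans (∑-+ (cube m) _ _)
           (cong₂ _+_ (∑-*ʳ (cube m) ν _) (∑-*ʳ (cube m) ν 1)))) ⟩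
    q * (∑ᶜ m ν * ∑ᶜ m ν + ∑ᶜ m ν * 1)
      ≡⟨ cong₂ (λ a b → q * (a * a + b)) (∑-fibre e) (trans (*-identityʳ _) (∑-fibre e)) ⟩
    q * (count e * count e + count e) ∎
    where
    open ≤-Reasoning
    q = 2 ^ suc m
    ν = fibre e
    X : 𝔽₂^ suc m → 𝔽₂^ m → ℕ
    X s x = ⟦ e (graph s x) ⟧
    diagonal : ∀ x → ∑ᶜ m (λ y → ⟦ does (x ≟ⱽ y) ⟧) ≤ 1
    diagonal x = ∑≤1 (cube-unique m) (λ y → does (x ≟ⱽ y))
      (λ y z ey ez → trans (sym (does⇒ (x ≟ⱽ y) ey)) (does⇒ (x ≟ⱽ z) ez))
    split : ∀ a b c d → (a * c + a * d) + (b * c + b * d) ≡ (a + b) * (c + d)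
    split = solve-∀
    small : ∀ b c → 2 * (⟦ b ⟧ + ⟦ c ⟧) ≤ (⟦ b ⟧ + ⟦ c ⟧) * (⟦ b ⟧ + ⟦ c ⟧) + (⟦ b ⟧ + ⟦ c ⟧) * 1
    small false false = z≤n
    small false true  = ≤-refl
    small true  false = ≤-refl
    small true  true  = m≤m+n 4 2
    idem : ∀ b → ⟦ b ⟧ * ⟦ b ⟧ ≡ ⟦ b ⟧
    idem false = refl
    idem true  = refl
    correlation : ∀ x y → 4 * ∑ᶜ (suc m) (λ s → X s x * X s y) ≤
      q * (ν x * ν y + ν x * ⟦ does (x ≟ⱽ y) ⟧)
    correlation x y with x ≟ⱽ y
    ... | no x≢y = ≤-reflexive (trans
      (uniform₂ x y x≢y (λ b c → ⟦ e (b ∷ x) ⟧ * ⟦ e (c ∷ y) ⟧))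
      (cong (q *_) (trans (split ⟦ e (false ∷ x) ⟧ _ ⟦ e (false ∷ y) ⟧ _)
        (sym (trans (cong (ν x * ν y +_) (*-zeroʳ (ν x))) (+-identityʳ _))))))
    ... | yes refl = begin
      4 * ∑ᶜ (suc m) (λ s → X s x * X s x)   ≡⟨ cong (4 *_) (∑-cong (cube (suc m)) (λ s → idem (e (graph s x)))) ⟩
      4 * ∑ᶜ (suc m) (λ s → X s x)           ≡⟨ *-assoc 2 2 (∑ᶜ (suc m) (λ s → X s x)) ⟩
      2 * (2 * ∑ᶜ (suc m) (λ s → X s x))     ≡⟨ cong (2 *_) (uniform₁ x (λ b → ⟦ e (b ∷ x) ⟧)) ⟩
      2 * (q * ν x)                          ≡⟨ swap₂ q (ν x) ⟩
      q * (2 * ν x)                          ≤⟨ *-monoʳ-≤ q (small (e (false ∷ x)) _) ⟩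
      q * (ν x * ν x + ν x * 1)              ∎
      where
      swap₂ : ∀ a b → 2 * (a * b) ≡ a * (2 * b)
      swap₂ = solve-∀

  -- Iterated random restrictions

  chains : ℕ → ℕ → ℕ
  chains zero    m = 1
  chains (suc j) m = 2 ^ suc (j + m) * chains j m

  -- Divided by `chains j m`, this is the mean of `w` over the functions obtained from `f` by `j`
  -- uniformly random restrictions.
  chainSum : ∀ j → (BoolFun m → ℕ) → BoolFun (j + m) → ℕ
  chainSum zero    w f = w f
  chainSum (suc j) w f = ∑ᶜ (suc (j + _)) (λ s → chainSum j w (f ∘ graph s))

  chain-first-moment : ∀ j (e : BoolFun (j + m)) →
    2 ^ j * chainSum j count e ≡ chains j m * count e
  chain-first-moment zero e = refl
  chain-first-moment {m} (suc j) e = begin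
    2 * 2 ^ j * ∑ᶜ dim (λ s → chainSum j count (e ∘ graph s))     ≡⟨ *-assoc 2 (2 ^ j) _ ⟩
    2 * (2 ^ j * ∑ᶜ dim (λ s → chainSum j count (e ∘ graph s)))   ≡⟨ cong (2 *_) (sym (∑-*ˡ (cube dim) (2 ^ j) _)) ⟩
    2 * ∑ᶜ dim (λ s → 2 ^ j * chainSum j count (e ∘ graph s))     ≡⟨ cong (2 *_) (∑-cong (cube dim) (λ s → chain-first-moment j (e ∘ graph s))) ⟩
    2 * ∑ᶜ dim (λ s → chains j m * count (e ∘ graph s))           ≡⟨ cong (2 *_) (∑-*ˡ (cube dim) (chains j m) _) ⟩
    2 * (chains j m * ∑ᶜ dim (λ s → count (e ∘ graph s)))         ≡⟨ swap₂ (chains j m) _ ⟩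
    chains j m * (2 * ∑ᶜ dim (λ s → count (e ∘ graph s)))         ≡⟨ cong (chains j m *_) (first-moment e) ⟩
    chains j m * (2 ^ dim * count e)                              ≡⟨ rotate (chains j m) (2 ^ dim) (count e) ⟩
    2 ^ dim * chains j m * count e                                ∎
    where
    open ≡-Reasoning
    dim = suc (j + m)
    swap₂ : ∀ a b → 2 * (a * b) ≡ a * (2 * b)
    swap₂ = solve-∀
    rotate : ∀ a b c → a * (b * c) ≡ b * a * c
    rotate = solve-∀

  -- The extra term on the left makes the induction close. Each restriction changes the coefficient
  -- `a` of the linear term into `2 a + 1`, a recurrence that starts at 0 and is solved by
  -- `2 ^ j - 1`, not by `2 ^ j`. In terms of the mean `μ`, the variance is at most `μ (1 - 2⁻ʲ)`.
  chain-second-moment : ∀ j (e : BoolFun (j + m)) →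
    4 ^ j * chainSum j (λ g → count g * count g) e + chains j m * count e ≤
    chains j m * (count e * count e + 2 ^ j * count e)
  chain-second-moment zero e = ≤-reflexive (base (count e))
    where
    base : ∀ a → 1 * (a * a) + 1 * a ≡ 1 * (a * a + 1 * a)
    base = solve-∀
  chain-second-moment {m} (suc j) e = +-cancelʳ-≤ (C * (2 ^ dim * N)) _ _ (begin
    4 * 4 ^ j * S + 2 ^ dim * C * N + C * (2 ^ dim * N)
      ≡⟨ regroup (4 ^ j) S (2 ^ dim) C N ⟩
    4 * (4 ^ j * S) + 2 * (C * (2 ^ dim * N))
      ≡⟨ cong₂ (λ a b → 4 * a + 2 * (C * b)) (sym (∑-*ˡ (cube dim) (4 ^ j) _)) (sym (first-moment e)) ⟩
    4 * ∑ᶜ dim (λ s → 4 ^ j * Y s) + 2 * (C * (2 * ∑ᶜ dim X))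
      ≡⟨ cong (4 * ∑ᶜ dim (λ s → 4 ^ j * Y s) +_) (regroup₂ C (∑ᶜ dim X)) ⟩
    4 * ∑ᶜ dim (λ s → 4 ^ j * Y s) + 4 * (C * ∑ᶜ dim X)
      ≡⟨ cong (λ a → 4 * ∑ᶜ dim (λ s → 4 ^ j * Y s) + 4 * a) (sym (∑-*ˡ (cube dim) C X)) ⟩
    4 * ∑ᶜ dim (λ s → 4 ^ j * Y s) + 4 * ∑ᶜ dim (λ s → C * X s)
      ≡⟨ trans (sym (*-distribˡ-+ 4 (∑ᶜ dim (λ s → 4 ^ j * Y s)) _)) (cong (4 *_) (sym (∑-+ (cube dim) _ _))) ⟩
    4 * ∑ᶜ dim (λ s → 4 ^ j * Y s + C * X s)
      ≤⟨ *-monoʳ-≤ 4 (∑-mono (cube dim) (λ s → chain-second-moment j (e ∘ graph s))) ⟩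
    4 * ∑ᶜ dim (λ s → C * (X s * X s + 2 ^ j * X s))
      ≡⟨ cong (4 *_) (trans (∑-*ˡ (cube dim) C _) (cong (C *_) (trans (∑-+ (cube dim) _ _)
           (cong (∑ᶜ dim (λ s → X s * X s) +_) (∑-*ˡ (cube dim) (2 ^ j) X))))) ⟩
    4 * (C * (∑ᶜ dim (λ s → X s * X s) + 2 ^ j * ∑ᶜ dim X))
      ≡⟨ regroup₃ C (∑ᶜ dim (λ s → X s * X s)) (2 ^ j) (∑ᶜ dim X) ⟩
    C * (4 * ∑ᶜ dim (λ s → X s * X s) + 2 * 2 ^ j * (2 * ∑ᶜ dim X))
      ≤⟨ *-monoʳ-≤ C (+-mono-≤ (second-moment e) (≤-reflexive (cong (2 * 2 ^ j *_) (first-moment e)))) ⟩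
    C * (2 ^ dim * (N * N + N) + 2 * 2 ^ j * (2 ^ dim * N))
      ≡⟨ regroup₄ C (2 ^ dim) N (2 * 2 ^ j) ⟩
    2 ^ dim * C * (N * N + 2 * 2 ^ j * N) + C * (2 ^ dim * N) ∎)
    where
    open ≤-Reasoning
    dim = suc (j + m)
    C = chains j m
    N = count e
    X Y : 𝔽₂^ dim → ℕ
    X s = count (e ∘ graph s)
    Y s = chainSum j (λ g → count g * count g) (e ∘ graph s)
    S = ∑ᶜ dim Y
    regroup : ∀ f S q C N → 4 * f * S + q * C * N + C * (q * N) ≡ 4 * (f * S) + 2 * (C * (q * N))
    regroup = solve-∀
    regroup₂ : ∀ C x → 2 * (C * (2 * x)) ≡ 4 * (C * x)
    regroup₂ = solve-∀
    regroup₃ : ∀ C x p y → 4 * (C * (x + p * y)) ≡ C * (4 * x + 2 * p * (2 * y))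
    regroup₃ = solve-∀
    regroup₄ : ∀ C q N p → C * (q * (N * N + N) + p * (q * N)) ≡ q * C * (N * N + p * N) + C * (q * N)
    regroup₄ = solve-∀

  -- Interpolation from hyperplanes

  off : 𝔽₂^ suc m → BoolFun (suc m)
  off s z = head z xor form s (tail z)

  off-graph : (s : 𝔽₂^ suc m) (x : 𝔽₂^ m) → off s (graph s x) ≡ false
  off-graph s x = xor-same (form s x)

  -- The coefficient vector of the linear part of `off s`. The constant of the form is discarded, so
  -- two parallel graphs share a normal.
  normal : 𝔽₂^ suc m → 𝔽₂^ suc m
  normal (_ ∷ a) = true ∷ a

  off-⊕ : (s z e : 𝔽₂^ suc m) → off s (z ⊕ e) ≡ off s z xor (normal s ∙ e)
  off-⊕ (b ∷ a) (c ∷ x) (c′ ∷ y) = trans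
    (cong (λ p → (c xor c′) xor (b xor p)) (∙-distribˡ-⊕ a x y))
    (regroup b c c′ (a ∙ x) (a ∙ y))
    where
    open xor-∧-Solver
    regroup : ∀ b c d p q → (c xor d) xor (b xor (p xor q)) ≡ (c xor (b xor p)) xor (d xor q)
    regroup = solve 5 (λ b c d p q →
      (c :+ d) :+ (b :+ (p :+ q)) := (c :+ (b :+ p)) :+ (d :+ q)) refl

  off-affine : (s : 𝔽₂^ suc m) → AffineForm (off s)
  off-affine s z w = trans (off-⊕ s z w) (trans (pad (off s z) (off s 𝟎) (normal s ∙ w))
    (cong (λ b → (off s z xor b) xor off s 𝟎)
      (trans (sym (off-⊕ s 𝟎 w)) (cong (off s) (⊕-identityˡ w)))))
    where
    open xor-∧-Solver
    pad : ∀ a b c → a xor c ≡ (a xor (b xor c)) xor b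
    pad = solve 3 (λ a b c → a :+ c := (a :+ (b :+ c)) :+ b) refl

  -- The Fredholm alternative, by induction on the vectors. If the dual vector `e` found for `cs`
  -- fails at `c₁`, the recursion is repeated for `c ⊕ c₁`. A dual vector `e′` for that sum is 1 at
  -- exactly one of `c` and `c₁`: either `e′` works, or `e ⊕ e′` does, as the values at `c₁` cancel.
  span-or-dual : (cs : Vec (𝔽₂^ n) k) (c : 𝔽₂^ n) →
    (∃[ t ] combination t cs ≡ c) ⊎
    (∃[ e ] All (λ c′ → c′ ∙ e ≡ false) cs × c ∙ e ≡ true)
  span-or-dual [] c with c ≟ⱽ 𝟎
  ... | yes c≡𝟎 = inj₁ ([] , sym c≡𝟎)
  ... | no  c≢𝟎 with ∙-separates c 𝟎 c≢𝟎
  ...   | e , ne = inj₂ (e , [] , trans (∙-comm c e)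
    (trans (¬-not ne) (cong not (∙-zeroʳ e))))
  span-or-dual (c₁ ∷ cs) c with span-or-dual cs c
  ... | inj₁ (t , eq) = inj₁ (false ∷ t , trans (cong (_⊕ combination t cs) (·-zeroˡ c₁))
    (trans (⊕-identityˡ _) eq))
  ... | inj₂ (e , cs⊥e , ce) with c₁ ∙ e in c₁e
  ...   | false = inj₂ (e , c₁e ∷ cs⊥e , ce)
  ...   | true with span-or-dual cs (c ⊕ c₁)
  ...     | inj₁ (t , eq) = inj₁ (true ∷ t , trans (cong₂ _⊕_ (·-identityˡ c₁) eq)
    (trans (⊕-comm c₁ _) (⊕-cancelʳ c c₁)))
  ...     | inj₂ (e′ , cs⊥e′ , sum) with c₁ ∙ e′ in c₁e′ | c ∙ e′ in ce′
                                     | trans (sym (∙-distribʳ-⊕ e′ c c₁)) sum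
  ...       | false | true  | _ = inj₂ (e′ , c₁e′ ∷ cs⊥e′ , ce′)
  ...       | true  | false | _ = inj₂ (e ⊕ e′
    , trans (∙-distribˡ-⊕ c₁ e e′) (cong₂ _xor_ c₁e c₁e′)
      ∷ All.map (λ {c′} (z , z′) → trans (∙-distribˡ-⊕ c′ e e′) (cong₂ _xor_ z z′)) (All.zip (cs⊥e , cs⊥e′))
    , trans (∙-distribˡ-⊕ c e e′) (cong₂ _xor_ ce ce′))

  count-∘-graph : (p : BoolFun (suc m)) (s : 𝔽₂^ suc m) → count (p ∘ graph s) ≤ count p
  count-∘-graph {m} p s = ≤-trans (∑-mono (cube m) (λ x → le x (form s x)))
    (≤-reflexive (∑-fibre p))
    where
    le : ∀ x b → ⟦ p (b ∷ x) ⟧ ≤ fibre p x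
    le x false = m≤m+n _ _
    le x true  = m≤n+m _ _

  uncovered : Vec (𝔽₂^ suc m) k → BoolFun (suc m)
  uncovered []       z = true
  uncovered (s ∷ ss) z = off s z ∧ uncovered ss z

  uncovered-⊕ : (ss : Vec (𝔽₂^ suc m) k) (e : 𝔽₂^ suc m) →
    All (λ c → c ∙ e ≡ false) (mapᵛ normal ss) → ∀ z → uncovered ss (z ⊕ e) ≡ uncovered ss z
  uncovered-⊕ []       e []            z = refl
  uncovered-⊕ (s ∷ ss) e (s⊥e ∷ ss⊥e) z = cong₂ _∧_
    (trans (off-⊕ s z e) (trans (cong (off s z xor_) s⊥e) (xor-identityʳ _)))
    (uncovered-⊕ ss e ss⊥e z)

  -- Translation by e exchanges the two sides of the graph of form s.
  halve-uncovered : (s : 𝔽₂^ suc m) (ss : Vec (𝔽₂^ suc m) k) (e : 𝔽₂^ suc m) →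
    All (λ c → c ∙ e ≡ false) (mapᵛ normal ss) → normal s ∙ e ≡ true →
    2 * count (uncovered (s ∷ ss)) ≡ count (uncovered ss)
  halve-uncovered {m} s ss e ss⊥e se = begin
    N + (N + 0)                ≡⟨ cong (N +_) (+-identityʳ N) ⟩
    N + N                      ≡⟨ cong (N +_) (sym (∑ᶜ-translate e (λ z → ⟦ uncovered (s ∷ ss) z ⟧))) ⟩
    N + ∑ᶜ (suc m) (λ z → ⟦ uncovered (s ∷ ss) (z ⊕ e) ⟧)
      ≡⟨ sym (∑-+ (cube (suc m)) _ _) ⟩
    ∑ᶜ (suc m) (λ z → ⟦ uncovered (s ∷ ss) z ⟧ + ⟦ uncovered (s ∷ ss) (z ⊕ e) ⟧)
      ≡⟨ ∑-cong (cube (suc m)) (λ z → trans (cong (λ b → ⟦ uncovered (s ∷ ss) z ⟧ + ⟦ b ⟧) (flipped z))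
           (both (off s z) (uncovered ss z))) ⟩
    count (uncovered ss) ∎
    where
    open ≡-Reasoning
    N = count (uncovered (s ∷ ss))
    both : ∀ a b → ⟦ a ∧ b ⟧ + ⟦ not a ∧ b ⟧ ≡ ⟦ b ⟧
    both false b = refl
    both true  b = +-identityʳ _
    flipped : ∀ z → uncovered (s ∷ ss) (z ⊕ e) ≡ not (off s z) ∧ uncovered ss z
    flipped z = cong₂ _∧_
      (trans (off-⊕ s z e) (trans (cong (off s z xor_) se) (xor-comm (off s z) true)))
      (uncovered-⊕ ss e ss⊥e z)

  module Interpolation {m d : ℕ} (S : BoolFun (suc m)) (P : 𝔽₂^ suc m → BoolFun m)
    (degP : ∀ s → S s ≡ true → Deg< (suc d) (P s))
    (compatible : ∀ s t z → S s ≡ true → S t ≡ true → off s z ≡ false → off t z ≡ false →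
      P s (tail z) ≡ P t (tail z)) where

    _ExtendsTo_ : 𝔽₂^ suc m → BoolFun (suc m) → Set
    s ExtendsTo Q = ∀ z → off s z ≡ false → Q z ≡ P s (tail z)

    -- Independence of the normals is remembered only through `sparse`: at most a fraction 2⁻ˡ of
    -- the space avoids all `l` node graphs.
    record Interpolant (l : ℕ) : Set where
      field
        nodes    : Vec (𝔽₂^ suc m) l
        nodes∈S  : All (λ s → S s ≡ true) nodes
        value     : BoolFun (suc m)
        deg-value : Deg< (suc d) value
        extends  : All (_ExtendsTo value) nodes
        sparse   : 2 ^ l * count (uncovered nodes) ≤ 2 ^ suc m

    -- The correction at s vanishes on the earlier graphs, because the projection π
    -- along e onto the graph of form s preserves each of them.
    extend : ∀ {l} (I : Interpolant l) (s e : 𝔽₂^ suc m) → S s ≡ true →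
      All (λ c → c ∙ e ≡ false) (mapᵛ normal (Interpolant.nodes I)) → normal s ∙ e ≡ true →
      Interpolant (suc l)
    extend {l} I s e Ss ss⊥e se = record
      { nodes    = s ∷ nodes
      ; nodes∈S  = Ss ∷ nodes∈S
      ; value     = Q
      ; deg-value = deg<-xor deg-value (deg<-xor
          (deg<-∘ {φ = tail} tail-affine (degP s Ss)) deg-value ∘π)
      ; extends  = new ∷ old nodes nodes∈S extends ss⊥e
      ; sparse   = ≤-trans (≤-reflexive (trans (reassoc (2 ^ l) _)
          (cong (2 ^ l *_) (halve-uncovered s nodes e ss⊥e se)))) sparse
      }
      where
      open Interpolant I
      π : 𝔽₂^ suc m → 𝔽₂^ suc m
      π z = z ⊕ off s z · e
      π-affine : Affine π
      π-affine = ⊕-affine id-affine (·-affine (off-affine s) e)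
      _∘π : ∀ {f} → Deg< (suc d) f → Deg< (suc d) (f ∘ π)
      _∘π = deg<-∘ π-affine
      Q : BoolFun (suc m)
      Q z = value z xor (P s (tail (π z)) xor value (π z))
      reassoc : ∀ a b → 2 * a * b ≡ a * (2 * b)
      reassoc = solve-∀
      off-π : ∀ t z → off t (π z) ≡ off t z xor (off s z ∧ (normal t ∙ e))
      off-π t z = trans (off-⊕ t z _) (cong (off t z xor_) (∙-· (normal t) (off s z) e))
      π∈s : ∀ z → off s (π z) ≡ false
      π∈s z = trans (off-π s z) (trans (cong (λ b → off s z xor (off s z ∧ b)) se)
        (trans (cong (off s z xor_) (∧-identityʳ (off s z))) (xor-same (off s z))))
      new : s ExtendsTo Q
      new z s∋z = begin
        value z xor (P s (tail (π z)) xor value (π z))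
          ≡⟨ cong (λ w → value z xor (P s (tail w) xor value w))
               (trans (cong (λ b → z ⊕ b · e) s∋z) (trans (cong (z ⊕_) (·-zeroˡ e)) (⊕-identityʳ z))) ⟩
        value z xor (P s (tail z) xor value z)
          ≡⟨ cancel (value z) _ ⟩
        P s (tail z) ∎
        where
        open ≡-Reasoning
        open xor-∧-Solver
        cancel : ∀ a b → a xor (b xor a) ≡ b
        cancel = solve 2 (λ a b → a :+ (b :+ a) := b) refl
      old : ∀ {l} (ss : Vec (𝔽₂^ suc m) l) → All (λ s → S s ≡ true) ss →
        All (_ExtendsTo value) ss → All (λ c → c ∙ e ≡ false) (mapᵛ normal ss) →
        All (_ExtendsTo Q) ss
      old []       []        []          []          = []
      old (t ∷ ts) (St ∷ Sts) (ext ∷ exts) (t⊥e ∷ ts⊥e) = ext′ ∷ old ts Sts exts ts⊥e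
        where
        ext′ : t ExtendsTo Q
        ext′ z t∋z = trans (cong (value z xor_) (trans
          (cong (_xor value (π z)) (compatible s t (π z) Ss St (π∈s z) t∋πz))
          (trans (cong (P t (tail (π z)) xor_) (ext (π z) t∋πz)) (xor-same (P t (tail (π z)))))))
          (trans (xor-identityʳ (value z)) (ext z t∋z))
          where
          t∋πz : off t (π z) ≡ false
          t∋πz = trans (off-π t z) (trans (cong₂ (λ b c → b xor (off s z ∧ c)) t∋z t⊥e) (∧-zeroʳ (off s z)))

    -- A span of `l` vectors contains at most 2ˡ normals, and each normal belongs to two forms,
    -- which differ in their constant.
    span-count : ∀ {l} (cs : Vec (𝔽₂^ suc m) l) →
      (∀ s → S s ≡ true → ∃[ t ] combination t cs ≡ normal s) → count S ≤ 2 * 2 ^ l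
    span-count {l} cs inSpan = begin
      count S
        ≤⟨ ∑-mono (cube (suc m)) listed ⟩
      ∑ᶜ (suc m) (λ s → ∑ᶜ l (λ t → same t s))
        ≡⟨ ∑-swap (cube (suc m)) (cube l) _ ⟩
      ∑ᶜ l (λ t → ∑ᶜ (suc m) (λ s → same t s))
        ≤⟨ ∑-mono (cube l) (λ t → ≤-trans (≤-reflexive (∑ᶜ-suc m _)) (+-mono-≤ (once t false) (once t true))) ⟩
      ∑ᶜ l (λ t → 2)
        ≡⟨ trans (∑ᶜ-const l 2) (*-comm (2 ^ l) 2) ⟩
      2 * 2 ^ l ∎
      where
      open ≤-Reasoning
      same : 𝔽₂^ l → 𝔽₂^ suc m → ℕ
      same t s = ⟦ does (combination t cs ≟ⱽ normal s) ⟧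
      listed : ∀ s → ⟦ S s ⟧ ≤ ∑ᶜ l (λ t → same t s)
      listed s with S s in Ss
      ... | false = z≤n
      ... | true with inSpan s Ss
      ...   | t , eq = ≤-trans (≤-reflexive (sym (cong ⟦_⟧ (does-true (combination t cs ≟ⱽ normal s) eq))))
        (∑-∈ (λ t → same t s) (cube-complete t))
      once : ∀ t b → ∑ᶜ m (λ a → same t (b ∷ a)) ≤ 1
      once t b = ∑≤1 (cube-unique m) (λ a → does (combination t cs ≟ⱽ (true ∷ a)))
        (λ a a′ e e′ → cong tail (trans (sym (does⇒ (combination t cs ≟ⱽ (true ∷ a)) e))
          (does⇒ (combination t cs ≟ⱽ (true ∷ a′)) e′)))

    -- Greedy choice of nodes: by `span-count`, more than 2ˡ⁺¹ members of `S` cannot all have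
    -- normals in the span of the `l` previous ones. A member outside the span comes with the
    -- direction `e` along which `extend` projects.
    interpolant : ∀ l → 2 ^ l < count S → Interpolant l
    interpolant zero _ = record
      { nodes = [] ; nodes∈S = [] ; value = λ _ → false ; deg-value = deg<-zero ; extends = []
      ; sparse = ≤-reflexive (trans (+-identityʳ _) (∑ᶜ-one (suc m))) }
    interpolant (suc l) 2^l< with interpolant l (≤-<-trans (m≤m+n (2 ^ l) _) 2^l<)
    ... | I with anySubset? (λ s → (S s ≟ᵇ true) ×-dec ¬? (anySubset? (λ t →
              combination t (mapᵛ normal (Interpolant.nodes I)) ≟ⱽ normal s)))
    ... | no none = contradiction (span-count (mapᵛ normal (Interpolant.nodes I))
      (λ s Ss → decidable-stable (anySubset? (λ t → combination t _ ≟ⱽ normal s)) (λ ¬t → none (s , Ss , ¬t))))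
      (<⇒≱ 2^l<)
    ... | yes (s , Ss , ¬span) with span-or-dual (mapᵛ normal (Interpolant.nodes I)) (normal s)
    ...   | inj₁ span = contradiction span ¬span
    ...   | inj₂ (e , ss⊥e , se) = extend I s e Ss ss⊥e se

    -- On the graph of `s`, the interpolant and `P s` can differ only at points that lie on no node
    -- graph. With `d + 2` nodes there are at most 2ᵐ⁺¹ / 2ᵈ⁺² of these, half of the 2ᵐ⁻ᵈ ones that
    -- a nonzero difference of degree at most `d` must have.
    interpolant-agrees : (I : Interpolant (suc (suc d))) → let open Interpolant I in
      ∀ s → S s ≡ true → ∀ x → value (graph s x) ≡ P s x
    interpolant-agrees I = agrees
      where
      open Interpolant I
      agrees : ∀ s → S s ≡ true → ∀ x → value (graph s x) ≡ P s x
      agrees s Ss x with value (graph s x) ≟ᵇ P s x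
      ... | yes eq = eq
      ... | no  ne = contradiction too-small (<⇒≱ (m<m+n (2 ^ m) (m^n>0 2 m)))
        where
        h : BoolFun m
        h y = value (graph s y) xor P s y
        deg-h : Deg< (suc d) h
        deg-h = deg<-xor (deg<-∘ (graph-affine s) deg-value) (degP s Ss)
        supported : ∀ {l} (ss : Vec (𝔽₂^ suc m) l) → All (λ s → S s ≡ true) ss →
          All (_ExtendsTo value) ss → ∀ y → h y ≡ true → uncovered ss (graph s y) ≡ true
        supported []       []         []           y hy = refl
        supported (t ∷ ts) (St ∷ Sts) (ext ∷ exts) y hy with off t (graph s y) in t∌
        ... | true  = supported ts Sts exts y hy
        ... | false = contradiction (trans (sym (trans (cong (_xor P s y)
          (trans (ext (graph s y) t∌) (compatible t s (graph s y) St Ss t∌ (off-graph s y))))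
          (xor-same (P s y)))) hy) λ ()
        U = count (uncovered nodes)
        too-small : 2 ^ m + 2 ^ m ≤ 2 ^ m
        too-small = squeeze (2 ^ m) (2 ^ d) U (≤-trans (schwartz-zippel deg-h x (≢⇒xor ne))
          (*-monoʳ-≤ (2 ^ d) (≤-trans
            (count-mono h (uncovered nodes ∘ graph s) (supported nodes nodes∈S extends))
            (count-∘-graph (uncovered nodes) s)))) sparse
          where
          squeeze : ∀ a b u → a ≤ b * u → 2 * (2 * b) * u ≤ 2 * a → a + a ≤ a
          squeeze a b u a≤ ≤2a = *-cancelˡ-≤ 2 (begin
            2 * (a + a)       ≡⟨ four a ⟩
            4 * a             ≤⟨ *-monoʳ-≤ 4 a≤ ⟩
            4 * (b * u)       ≡⟨ regroup b u ⟩
            2 * (2 * b) * u   ≤⟨ ≤2a ⟩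
            2 * a             ∎)
            where
            open ≤-Reasoning
            four : ∀ a → 2 * (a + a) ≡ 4 * a
            four = solve-∀
            regroup : ∀ a b → 4 * (a * b) ≡ 2 * (2 * a) * b
            regroup = solve-∀

    interpolate : 4 * 2 ^ d < count S →
      ∃[ Q ] Deg< (suc d) Q × (∀ s → S s ≡ true → ∀ x → Q (graph s x) ≡ P s x)
    interpolate large = let I = interpolant (suc (suc d)) (subst (_< count S) (*-assoc 2 2 (2 ^ d)) large) in
      Interpolant.value I , Interpolant.deg-value I , interpolant-agrees I

  -- Functions near RM(d, n)

  2xy≤x²+y² : ∀ x y → 2 * (x * y) ≤ x * x + y * y
  2xy≤x²+y² x y with ≤-total x y
  ... | inj₁ x≤y = subst (λ y → 2 * (x * y) ≤ x * x + y * y) (m+[n∸m]≡n x≤y) (step x (y ∸ x))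
    where
    step : ∀ x t → 2 * (x * (x + t)) ≤ x * x + (x + t) * (x + t)
    step x t = ≤-trans (m≤m+n _ (t * t)) (≤-reflexive (square x t))
      where
      square : ∀ x t → 2 * (x * (x + t)) + t * t ≡ x * x + (x + t) * (x + t)
      square = solve-∀
  ... | inj₂ y≤x = subst (λ x → 2 * (x * y) ≤ x * x + y * y) (m+[n∸m]≡n y≤x) (step y (x ∸ y))
    where
    step : ∀ y t → 2 * ((y + t) * y) ≤ (y + t) * (y + t) + y * y
    step y t = ≤-trans (m≤m+n _ (t * t)) (≤-reflexive (square y t))
      where
      square : ∀ y t → 2 * ((y + t) * y) + t * t ≡ (y + t) * (y + t) + y * y
      square = solve-∀

  infixl 6 _⊻_

  _⊻_ : BoolFun n → BoolFun n → BoolFun n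
  (f ⊻ g) x = f x xor g x

  -- f lies within distance 2⁻ᵈ / 8 of RM(d, n).
  Near : ℕ → BoolFun n → Set
  Near {n} d f = ∃[ g ] Deg< (suc d) g × 8 * (2 ^ d * count (f ⊻ g)) < 2 ^ n

  near? : ∀ d (f : BoolFun n) → Dec (Near d f)
  near? {n} d f = map′ Any.satisfied listed
    (Any.any? (λ g → deg<? d g ×-dec (8 * (2 ^ d * count (f ⊻ g)) <? 2 ^ n)) (functions n))
    where
    listed : Near d f → Any (λ g → Deg< (suc d) g × 8 * (2 ^ d * count (f ⊻ g)) < 2 ^ n) (functions n)
    listed (g , dg , close) = Any.map
      (λ {h} g≗h → deg<-cong g≗h dg
        , subst (λ c → 8 * (2 ^ d * c) < 2 ^ n)
            (∑-cong (cube n) (λ x → cong (λ b → ⟦ f x xor b ⟧) (g≗h x))) close)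
      (functions-complete g)

  deg<⇒near : {f : BoolFun n} → Deg< (suc d) f → Near d f
  deg<⇒near {n} {d} {f} df = f , df , subst (λ c → 8 * (2 ^ d * c) < 2 ^ n)
    (sym (∑≡0 (cube n) (f ⊻ f) (λ x _ → xor-same (f x))))
    (subst (_< 2 ^ n) (sym (trans (cong (8 *_) (*-zeroʳ (2 ^ d))) (*-zeroʳ 8))) (m^n>0 2 n))

  ∑-graph : (s : 𝔽₂^ suc m) (F : 𝔽₂^ suc m → ℕ) →
    ∑ᶜ (suc m) (λ z → F z * ⟦ not (off s z) ⟧) ≡ ∑ᶜ m (F ∘ graph s)
  ∑-graph {m} s F = trans (∑ᶜ-suc m _) (trans (sym (∑-+ (cube m) _ _))
    (∑-cong (cube m) (λ x → select x (form s x))))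
    where
    select : ∀ x b → F (false ∷ x) * ⟦ not (false xor b) ⟧ + F (true ∷ x) * ⟦ not (true xor b) ⟧ ≡ F (b ∷ x)
    select x false = trans (cong₂ _+_ (*-identityʳ _) (*-zeroʳ (F (true ∷ x)))) (+-identityʳ _)
    select x true  = trans (cong (_+ F (true ∷ x) * 1) (*-zeroʳ (F (false ∷ x)))) (*-identityʳ _)

  off-sym : (s z : 𝔽₂^ suc m) → off s z ≡ off z s
  off-sym (b ∷ a) (c ∷ x) = trans (sym (xor-assoc c b (a ∙ x)))
    (trans (cong₂ _xor_ (xor-comm c b) (∙-comm a x)) (xor-assoc b c _))

  -- Incidence of z with the graph of form s is symmetric in s and z.
  ∑-duality : (p q : BoolFun (suc m)) →
    ∑ᶜ (suc m) (λ s → ⟦ p s ⟧ * count (q ∘ graph s)) ≡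
    ∑ᶜ (suc m) (λ z → ⟦ q z ⟧ * count (p ∘ graph z))
  ∑-duality {m} p q = begin
    ∑ᶜ (suc m) (λ s → ⟦ p s ⟧ * count (q ∘ graph s))
      ≡⟨ expand p q ⟩
    ∑ᶜ (suc m) (λ s → ∑ᶜ (suc m) (λ z → ⟦ p s ⟧ * (⟦ q z ⟧ * ⟦ not (off s z) ⟧)))
      ≡⟨ ∑-swap (cube (suc m)) (cube (suc m)) _ ⟩
    ∑ᶜ (suc m) (λ z → ∑ᶜ (suc m) (λ s → ⟦ p s ⟧ * (⟦ q z ⟧ * ⟦ not (off s z) ⟧)))
      ≡⟨ ∑-cong (cube (suc m)) (λ z → ∑-cong (cube (suc m)) (λ s → trans
           (cong (λ b → ⟦ p s ⟧ * (⟦ q z ⟧ * ⟦ not b ⟧)) (off-sym s z))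
           (exchange ⟦ p s ⟧ ⟦ q z ⟧ ⟦ not (off z s) ⟧))) ⟩
    ∑ᶜ (suc m) (λ z → ∑ᶜ (suc m) (λ s → ⟦ q z ⟧ * (⟦ p s ⟧ * ⟦ not (off z s) ⟧)))
      ≡⟨ sym (expand q p) ⟩
    ∑ᶜ (suc m) (λ z → ⟦ q z ⟧ * count (p ∘ graph z)) ∎
    where
    open ≡-Reasoning
    exchange : ∀ a b c → a * (b * c) ≡ b * (a * c)
    exchange = solve-∀
    expand : ∀ p q → ∑ᶜ (suc m) (λ s → ⟦ p s ⟧ * count (q ∘ graph s)) ≡
      ∑ᶜ (suc m) (λ s → ∑ᶜ (suc m) (λ z → ⟦ p s ⟧ * (⟦ q z ⟧ * ⟦ not (off s z) ⟧)))
    expand p q = ∑-cong (cube (suc m)) (λ s → trans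
      (cong (⟦ p s ⟧ *_) (sym (∑-graph s (⟦_⟧ ∘ q)))) (sym (∑-*ˡ (cube (suc m)) ⟦ p s ⟧ _)))

  ⟦xor⟧-triangle : ∀ a b c → ⟦ a xor b ⟧ ≤ ⟦ c xor a ⟧ + ⟦ c xor b ⟧
  ⟦xor⟧-triangle false false c     = z≤n
  ⟦xor⟧-triangle false true  false = ≤-refl
  ⟦xor⟧-triangle false true  true  = ≤-refl
  ⟦xor⟧-triangle true  false false = ≤-refl
  ⟦xor⟧-triangle true  false true  = ≤-refl
  ⟦xor⟧-triangle true  true  c     = z≤n

  -- Total in the decision, so that every `s` is assigned a function; zero stands in where no
  -- codeword is near.
  codeword : (f : BoolFun n) → Dec (Near d f) → BoolFun n
  codeword f (yes (g , _)) = g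
  codeword f (no _)        = λ _ → false

  codeword-deg : (f : BoolFun n) (f? : Dec (Near d f)) → does f? ≡ true →
    Deg< (suc d) (codeword f f?)
  codeword-deg f (yes (_ , dg , _)) _ = dg

  codeword-close : (f : BoolFun n) (f? : Dec (Near d f)) → does f? ≡ true →
    8 * (2 ^ d * count (f ⊻ codeword f f?)) < 2 ^ n
  codeword-close f (yes (_ , _ , close)) _ = close

  module NearHyperplanes {m : ℕ} (d : ℕ) (f : BoolFun (suc m)) where

    near : BoolFun (suc m)
    near s = does (near? d (f ∘ graph s))

    P : 𝔽₂^ suc m → BoolFun m
    P s = codeword (f ∘ graph s) (near? d (f ∘ graph s))

    degP : ∀ s → near s ≡ true → Deg< (suc d) (P s)
    degP s = codeword-deg (f ∘ graph s) (near? d (f ∘ graph s))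

    error : 𝔽₂^ suc m → ℕ
    error s = count ((f ∘ graph s) ⊻ P s)

    close : ∀ s → near s ≡ true → 8 * (2 ^ d * error s) < 2 ^ m
    close s = codeword-close (f ∘ graph s) (near? d (f ∘ graph s))

    -- Otherwise (P s + P t)(form s + form t + 1), of degree at most d + 1, has a
    -- support that is nonempty but covered by the two sets of errors.
    compatible : ∀ s t z → near s ≡ true → near t ≡ true → off s z ≡ false → off t z ≡ false →
      P s (tail z) ≡ P t (tail z)
    compatible s t (y ∷ x) ns nt s∋z t∋z = decidable-stable (P s x ≟ᵇ P t x) λ ne → contradiction
      (absurd (2 ^ m) (2 ^ d) (error s) (error t) (close s ns) (close t nt)
        (≤-trans (schwartz-zippel deg-h x (hx ne)) (*-monoʳ-≤ (2 * 2 ^ d) h≤)))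
      (<-irrefl refl)
      where
      meet h : BoolFun m
      meet x = form s x xor (true xor form t x)
      h x = meet x ∧ (P s x xor P t x)
      meet-affine : AffineForm meet
      meet-affine = xor-affineForm (form s) (λ x → true xor form t x) (form-affine s)
        (xor-affineForm (λ _ → true) (form t) (const-affineForm true) (form-affine t))
      deg-h : Deg< (suc (suc d)) h
      deg-h = deg<-∧ meet-affine (deg<-xor (degP s ns) (degP t nt))
      same-height : ∀ y a b → y xor a ≡ false → y xor b ≡ false → a xor (true xor b) ≡ true
      same-height false false false p q = refl
      same-height true  true  true  p q = refl
      hx : P s x ≢ P t x → h x ≡ true
      hx ne = cong₂ _∧_ (same-height y (form s x) (form t x) s∋z t∋z) (≢⇒xor ne)
      h≤ : count h ≤ error s + error t
      h≤ = ≤-trans (∑-mono (cube m) le) (≤-reflexive (∑-+ (cube m) _ _))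
        where
        le : ∀ x → ⟦ h x ⟧ ≤ ⟦ f (graph s x) xor P s x ⟧ + ⟦ f (graph t x) xor P t x ⟧
        le x with form s x | form t x
        ... | false | false = ⟦xor⟧-triangle (P s x) (P t x) (f (false ∷ x))
        ... | false | true  = z≤n
        ... | true  | false = z≤n
        ... | true  | true  = ⟦xor⟧-triangle (P s x) (P t x) (f (true ∷ x))
      absurd : ∀ q D a b → 8 * (D * a) < q → 8 * (D * b) < q → q ≤ 2 * D * (a + b) → 2 * q < 2 * q
      absurd q D a b a< b< q≤ = begin-strict
        2 * q                               ≤⟨ *-monoʳ-≤ 2 q≤ ⟩
        2 * (2 * D * (a + b))               ≤⟨ m≤m+n _ _ ⟩
        2 * (2 * D * (a + b)) + 4 * (D * (a + b)) ≡⟨ regroup D a b ⟩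
        8 * (D * a) + 8 * (D * b)           <⟨ +-mono-< a< b< ⟩
        q + q                               ≡⟨ cong (q +_) (sym (+-identityʳ q)) ⟩
        2 * q                               ∎
        where
        open ≤-Reasoning
        regroup : ∀ D a b → 2 * (2 * D * (a + b)) + 4 * (D * (a + b)) ≡ 8 * (D * a) + 8 * (D * b)
        regroup = solve-∀

    -- Writing M z for the number of near graphs through z, points where f ≠ Q and
    -- M z is large are few by the errors on the graphs, and points with M z far
    -- from its mean K/2 are few by the second moment; for a point with f ≠ Q the
    -- trade-off is K² ≤ 4 K M + (2 M - K)².
    interpolation-close : (Q : BoolFun (suc m)) → 8 * 2 ^ d < count near →
      (∀ s → near s ≡ true → ∀ x → Q (graph s x) ≡ P s x) →
      8 * (2 ^ d * count (f ⊻ Q)) ≤ 3 * 2 ^ suc m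
    interpolation-close Q K-large agrees =
      combine K N E (2 ^ d) (2 ^ m) (<⇒≤ K-large) (≤-<-trans z≤n K-large) moments errors
      where
      wrong = f ⊻ Q
      K = count near
      N = count wrong
      M : 𝔽₂^ suc m → ℕ
      M z = count (near ∘ graph z)
      E = ∑ᶜ (suc m) (λ s → ⟦ near s ⟧ * count (wrong ∘ graph s))

      errors : 8 * (2 ^ d * E) ≤ K * 2 ^ m
      errors = begin
        8 * (2 ^ d * E)
          ≡⟨ trans (sym (*-assoc 8 (2 ^ d) E)) (sym (∑-*ˡ (cube (suc m)) (8 * 2 ^ d) _)) ⟩
        ∑ᶜ (suc m) (λ s → 8 * 2 ^ d * (⟦ near s ⟧ * count (wrong ∘ graph s)))
          ≤⟨ ∑-mono (cube (suc m)) le ⟩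
        ∑ᶜ (suc m) (λ s → ⟦ near s ⟧ * 2 ^ m)
          ≡⟨ ∑-*ʳ (cube (suc m)) _ (2 ^ m) ⟩
        K * 2 ^ m ∎
        where
        open ≤-Reasoning
        le : ∀ s → 8 * 2 ^ d * (⟦ near s ⟧ * count (wrong ∘ graph s)) ≤ ⟦ near s ⟧ * 2 ^ m
        le s = go (near s) refl
          where
          go : ∀ b → near s ≡ b → 8 * 2 ^ d * (⟦ b ⟧ * count (wrong ∘ graph s)) ≤ ⟦ b ⟧ * 2 ^ m
          go false _  = ≤-reflexive (*-zeroʳ (8 * 2 ^ d))
          go true  ns = begin
            8 * 2 ^ d * (1 * count (wrong ∘ graph s))
              ≡⟨ cong (8 * 2 ^ d *_) (trans (*-identityˡ _)
                   (∑-cong (cube m) (λ x → cong (λ b → ⟦ f (graph s x) xor b ⟧) (agrees s ns x)))) ⟩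
            8 * 2 ^ d * error s     ≡⟨ *-assoc 8 (2 ^ d) (error s) ⟩
            8 * (2 ^ d * error s)   ≤⟨ <⇒≤ (close s ns) ⟩
            2 ^ m                   ≡⟨ sym (*-identityˡ (2 ^ m)) ⟩
            1 * 2 ^ m               ∎

      trade-off : ∀ b M → K * K * ⟦ b ⟧ + 4 * K * M ≤ 4 * K * (⟦ b ⟧ * M) + (4 * (M * M) + K * K)
      trade-off false M = begin
        K * K * 0 + 4 * K * M            ≡⟨ double K M ⟩
        2 * (2 * M * K)                  ≤⟨ 2xy≤x²+y² (2 * M) K ⟩
        2 * M * (2 * M) + K * K          ≡⟨ square K M ⟩
        4 * K * 0 + (4 * (M * M) + K * K) ∎
        where
        open ≤-Reasoning
        double : ∀ K M → K * K * 0 + 4 * K * M ≡ 2 * (2 * M * K)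
        double = solve-∀
        square : ∀ K M → 2 * M * (2 * M) + K * K ≡ 4 * K * 0 + (4 * (M * M) + K * K)
        square = solve-∀
      trade-off true M = ≤-trans (m≤m+n _ (4 * (M * M))) (≤-reflexive (regroup K M))
        where
        regroup : ∀ K M → K * K * 1 + 4 * K * M + 4 * (M * M) ≡ 4 * K * (1 * M) + (4 * (M * M) + K * K)
        regroup = solve-∀

      q = 2 ^ suc m

      moments : K * K * N + 2 * K * (q * K) ≤ 4 * K * E + (q * (K * K + K) + q * (K * K))
      moments = begin
        K * K * N + 2 * K * (q * K)
          ≡⟨ cong (λ a → K * K * N + 2 * K * a) (sym (first-moment near)) ⟩
        K * K * N + 2 * K * (2 * ∑ᶜ (suc m) M)
          ≡⟨ cong (K * K * N +_) (four K (∑ᶜ (suc m) M)) ⟩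
        K * K * N + 4 * K * ∑ᶜ (suc m) M
          ≡⟨ sym (trans (∑-+ (cube (suc m)) _ _) (cong₂ _+_ (∑-*ˡ (cube (suc m)) (K * K) _) (∑-*ˡ (cube (suc m)) (4 * K) M))) ⟩
        ∑ᶜ (suc m) (λ z → K * K * ⟦ wrong z ⟧ + 4 * K * M z)
          ≤⟨ ∑-mono (cube (suc m)) (λ z → trade-off (wrong z) (M z)) ⟩
        ∑ᶜ (suc m) (λ z → 4 * K * (⟦ wrong z ⟧ * M z) + (4 * (M z * M z) + K * K))
          ≡⟨ trans (∑-+ (cube (suc m)) _ _) (cong₂ _+_ (∑-*ˡ (cube (suc m)) (4 * K) _)
               (trans (∑-+ (cube (suc m)) _ _) (cong₂ _+_ (∑-*ˡ (cube (suc m)) 4 _) (∑ᶜ-const (suc m) (K * K))))) ⟩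
        4 * K * ∑ᶜ (suc m) (λ z → ⟦ wrong z ⟧ * M z) + (4 * ∑ᶜ (suc m) (λ z → M z * M z) + q * (K * K))
          ≤⟨ +-mono-≤ (≤-reflexive (cong (4 * K *_) (∑-duality wrong near))) (+-monoˡ-≤ (q * (K * K)) (second-moment near)) ⟩
        4 * K * E + (q * (K * K + K) + q * (K * K)) ∎
        where
        open ≤-Reasoning
        four : ∀ a b → 2 * a * (2 * b) ≡ 4 * a * b
        four = solve-∀

      combine : ∀ K N E D p → 8 * D ≤ K → 0 < K →
        K * K * N + 2 * K * (2 * p * K) ≤ 4 * K * E + (2 * p * (K * K + K) + 2 * p * (K * K)) →
        8 * (D * E) ≤ K * p → 8 * (D * N) ≤ 3 * (2 * p)
      combine K@(suc _) N E D p D≤K _ mom err = *-cancelˡ-≤ K (begin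
        K * (8 * (D * N))                 ≡⟨ regroup₁ K D N ⟩
        8 * D * (K * N)                   ≤⟨ *-monoʳ-≤ (8 * D) KN≤ ⟩
        8 * D * (4 * E + 2 * p)           ≡⟨ regroup₂ D E p ⟩
        4 * (8 * (D * E)) + 8 * D * (2 * p) ≤⟨ +-mono-≤ (*-monoʳ-≤ 4 err) (*-monoˡ-≤ (2 * p) D≤K) ⟩
        4 * (K * p) + K * (2 * p)         ≡⟨ regroup₃ K p ⟩
        K * (3 * (2 * p))                 ∎)
        where
        open ≤-Reasoning
        regroup₁ : ∀ K D N → K * (8 * (D * N)) ≡ 8 * D * (K * N)
        regroup₁ = solve-∀
        regroup₂ : ∀ D E p → 8 * D * (4 * E + 2 * p) ≡ 4 * (8 * (D * E)) + 8 * D * (2 * p)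
        regroup₂ = solve-∀
        regroup₃ : ∀ K p → 4 * (K * p) + K * (2 * p) ≡ K * (3 * (2 * p))
        regroup₃ = solve-∀
        regroup₄ : ∀ K N p → K * (K * N) + 2 * K * (2 * p * K) ≡ K * K * N + 2 * K * (2 * p * K)
        regroup₄ = solve-∀
        regroup₅ : ∀ K E p → 4 * K * E + (2 * p * (K * K + K) + 2 * p * (K * K)) ≡
          K * (4 * E + 2 * p) + 2 * K * (2 * p * K)
        regroup₅ = solve-∀
        KN≤ : K * N ≤ 4 * E + 2 * p
        KN≤ = *-cancelˡ-≤ K (+-cancelʳ-≤ (2 * K * (2 * p * K)) _ _
          (subst₂ _≤_ (sym (regroup₄ K N p)) (regroup₅ K E p) mom))

    near-codeword : 8 * 2 ^ d < count near →
      ∃[ Q ] Deg< (suc d) Q × 8 * (2 ^ d * count (f ⊻ Q)) ≤ 3 * 2 ^ suc m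
    near-codeword K-large =
      -- Interpolation asks for more than `4 · 2ᵈ` near graphs; the factor 8 is what the distance
      -- estimate asks for.
      let Q , degQ , agrees = Interpolation.interpolate near P degP compatible
            (≤-<-trans (*-monoˡ-≤ (2 ^ d) (m≤m+n 4 4)) K-large)
      in Q , degQ , interpolation-close Q K-large agrees

  -- `half-bad` applies at each step because the dimension stays above `d`. The factor `2 ^ i` is
  -- affordable only for a bounded `i`; it is used with `i` at most 3.
  half-chain : ∀ i {f : BoolFun (i + suc d)} →
    chains i (suc d) * bad d f ≤ 2 ^ i * chainSum i (bad d) f
  half-chain         zero    = ≤-refl
  half-chain {d = d} (suc i) {f} with deg<? d f
  ... | yes _  = ≤-trans (≤-reflexive (*-zeroʳ (chains (suc i) (suc d)))) z≤n
  ... | no ¬df = ≤-trans (≤-reflexive (trans (*-identityʳ _) (*-comm (2 ^ suc (i + suc d)) C))) (begin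
    C * 2 ^ suc (i + suc d)                             ≤⟨ *-monoʳ-≤ C (half-bad (m≤n+m (suc d) i) ¬df) ⟩
    C * (2 * ∑ᶜ (suc (i + suc d)) (λ s → bad d (f ∘ graph s))) ≡⟨ swap₂ C _ ⟩
    2 * (C * ∑ᶜ (suc (i + suc d)) (λ s → bad d (f ∘ graph s))) ≡⟨ cong (2 *_) (sym (∑-*ˡ (cube (suc (i + suc d))) C _)) ⟩
    2 * ∑ᶜ (suc (i + suc d)) (λ s → C * bad d (f ∘ graph s)) ≤⟨ *-monoʳ-≤ 2 (∑-mono (cube (suc (i + suc d))) (λ s → half-chain i)) ⟩
    2 * ∑ᶜ (suc (i + suc d)) (λ s → 2 ^ i * W s)        ≡⟨ cong (2 *_) (∑-*ˡ (cube (suc (i + suc d))) (2 ^ i) W) ⟩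
    2 * (2 ^ i * ∑ᶜ (suc (i + suc d)) W)                ≡⟨ sym (*-assoc 2 (2 ^ i) _) ⟩
    2 ^ suc i * ∑ᶜ (suc (i + suc d)) W                  ∎)
    where
    open ≤-Reasoning
    C = chains i (suc d)
    W : 𝔽₂^ suc (i + suc d) → ℕ
    W s = chainSum i (bad d) (f ∘ graph s)
    swap₂ : ∀ a b → a * (2 * b) ≡ 2 * (a * b)
    swap₂ = solve-∀

  -- A nonzero polynomial of degree ≤ d in d + 4 variables has at least 16 ones, so
  -- if f is bad on fewer points then f itself has degree > d.
  bad-or-dense : {f g : BoolFun (4 + d)} → Deg< (suc d) (f ⊻ g) →
    16 * count g ≤ 64 * bad d f + count g * count g
  bad-or-dense {d} {f} {g} dfg with deg<? d f
  -- The quadratic `x (16 - x)` never exceeds its value 64 at `x = 8`.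
  ... | no _ = ≤-trans (≤-reflexive (double (count g))) (2xy≤x²+y² 8 (count g))
    where
    double : ∀ x → 16 * x ≡ 2 * (8 * x)
    double = solve-∀
  ... | yes df = dense (anySubset? (λ x → g x ≟ᵇ true))
    where
    deg-g : Deg< (suc d) g
    deg-g = deg<-cong (λ x → xor-cancelˡ (f x) (g x))
      (deg<-xor df dfg)
    dense : Dec (∃ (λ x → g x ≡ true)) → 16 * count g ≤ count g * count g
    dense (yes (x , gx)) = *-monoˡ-≤ (count g) (*-cancelˡ-≤ (2 ^ d) {{m^n≢0 2 d}}
      (≤-trans (≤-reflexive (sixteen (2 ^ d))) (schwartz-zippel deg-g x gx)))
      where
      sixteen : ∀ a → a * 16 ≡ 2 * (2 * (2 * (2 * a)))
      sixteen = solve-∀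
    dense (no none) = subst (λ c → 16 * c ≤ c * c) (sym g≡0) z≤n
      where
      g≡0 : count g ≡ 0
      g≡0 = ∑≡0 (cube (4 + d)) g (λ x _ → ¬-not (λ gx → none (x , gx)))

  -- The pointwise inequality is linear in `bad`, the count and its square, so it survives
  -- averaging, and two moments of the count bound the probability of `bad` from below.
  chain-bad-or-dense : ∀ j {f g : BoolFun (j + (4 + d))} → Deg< (suc d) (f ⊻ g) →
    16 * chainSum j count g ≤
    64 * chainSum j (bad d) f + chainSum j (λ h → count h * count h) g
  chain-bad-or-dense zero dfg = bad-or-dense dfg
  chain-bad-or-dense {d} (suc j) {f} {g} dfg = begin
    16 * ∑ Ω (λ s → chainSum j count (g ∘ graph s))
      ≡⟨ sym (∑-*ˡ Ω 16 _) ⟩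
    ∑ Ω (λ s → 16 * chainSum j count (g ∘ graph s))
      ≤⟨ ∑-mono Ω (λ s → chain-bad-or-dense j (deg<-∘ (graph-affine s) dfg)) ⟩
    ∑ Ω (λ s → 64 * B s + X s)
      ≡⟨ trans (∑-+ Ω _ _) (cong (_+ ∑ Ω X) (∑-*ˡ Ω 64 B)) ⟩
    64 * ∑ Ω B + ∑ Ω X ∎
    where
    open ≤-Reasoning
    Ω = cube (suc (j + (4 + d)))
    B X : 𝔽₂^ suc (j + (4 + d)) → ℕ
    B s = chainSum j (bad d) (f ∘ graph s)
    X s = chainSum j (λ h → count h * count h) (g ∘ graph s)

  -- If f is at distance about 2⁻ᵈ from a codeword, the number of errors on a random
  -- (d+4)-dimensional restriction has mean between 2 and 6, by pairwise independence
  -- it is concentrated, and every value strictly between 0 and 16 is detected.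
  chain-close : ∀ j {f g : BoolFun (j + (4 + d))} → Deg< (suc d) g →
    2 ^ (j + (4 + d)) ≤ 8 * (2 ^ d * count (f ⊻ g)) →
    8 * (2 ^ d * count (f ⊻ g)) ≤ 3 * 2 ^ (j + (4 + d)) →
    chains j (4 + d) * 2 ≤ 8 * chainSum j (bad d) f
  chain-close {d} j {f} {g} dg lower upper =
    conclude (chains j (4 + d)) (2 ^ j) N (chainSum j (bad d) f) (chainSum j count (f ⊻ g))
      (chainSum j (λ h → count h * count h) (f ⊻ g)) {{m^n≢0 2 j}}
      (*-cancelˡ-≤ (8 * 2 ^ d) {{8*2^d≢0}} (≤-trans (≤-reflexive (trans (regroup₁ (2 ^ d) (2 ^ j)) (sym 2^n)))
        (≤-trans lower (≤-reflexive (sym (*-assoc 8 (2 ^ d) N))))))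
      (*-cancelˡ-≤ (8 * 2 ^ d) {{8*2^d≢0}} (≤-trans (≤-reflexive (*-assoc 8 (2 ^ d) N)) (≤-trans upper
        (≤-reflexive (trans (cong (3 *_) 2^n) (regroup₂ (2 ^ d) (2 ^ j)))))))
      (chain-first-moment j (f ⊻ g))
      (≤-trans (m≤m+n _ _) (≤-trans (≤-reflexive (cong (λ a → a * S + chains j (4 + d) * N) (sym (4^ j)))) (chain-second-moment j (f ⊻ g))))
      (chain-bad-or-dense j (deg<-cong (λ x → sym (xor-cancelˡ (f x) (g x))) dg))
    where
    N = count (f ⊻ g)
    S = chainSum j (λ h → count h * count h) (f ⊻ g)
    8*2^d≢0 : NonZero (8 * 2 ^ d)
    8*2^d≢0 = m*n≢0 8 (2 ^ d) {{_}} {{m^n≢0 2 d}}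
    4^ : ∀ j → 4 ^ j ≡ 2 ^ j * 2 ^ j
    4^ zero    = refl
    4^ (suc j) = trans (cong (4 *_) (4^ j)) (regroup (2 ^ j))
      where
      regroup : ∀ a → 4 * (a * a) ≡ 2 * a * (2 * a)
      regroup = solve-∀
    2^n : 2 ^ (j + (4 + d)) ≡ 16 * (2 ^ d * 2 ^ j)
    2^n = trans (^-distribˡ-+-* 2 j (4 + d)) (regroup (2 ^ j) (2 ^ d))
      where
      regroup : ∀ a b → a * (2 * (2 * (2 * (2 * b)))) ≡ 16 * (b * a)
      regroup = solve-∀
    regroup₁ : ∀ D q → 8 * D * (2 * q) ≡ 16 * (D * q)
    regroup₁ = solve-∀
    regroup₂ : ∀ D q → 3 * (16 * (D * q)) ≡ 8 * D * (6 * q)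
    regroup₂ = solve-∀
    -- With mean `μ = N / q` between 2 and 6, the expectation of `X (16 - X)` is at least
    -- `16 μ - (μ² + μ) ≥ 9 μ ≥ 18`. Hence `bad` has probability at least 18/64, which is more than
    -- 1/4.
    conclude : ∀ C q N B X Y .{{_ : NonZero q}} → 2 * q ≤ N → N ≤ 6 * q → q * X ≡ C * N →
      q * q * Y ≤ C * (N * N + q * N) → 16 * X ≤ 64 * B + Y → C * 2 ≤ 8 * B
    conclude C q N B X Y 2q≤N N≤6q first second pointwise =
      *-cancelˡ-≤ (8 * (q * q)) {{m*n≢0 8 (q * q) {{_}} {{m*n≢0 q q}}}} (begin
        8 * (q * q) * (C * 2)      ≤⟨ m≤m+n _ (2 * (C * q * q)) ⟩
        8 * (q * q) * (C * 2) + 2 * (C * q * q) ≡⟨ step₁ C q ⟩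
        9 * q * C * (2 * q)        ≤⟨ *-monoʳ-≤ (9 * q * C) 2q≤N ⟩
        9 * q * C * N              ≤⟨ nine ⟩
        64 * (q * q) * B           ≡⟨ step₂ q B ⟩
        8 * (q * q) * (8 * B)      ∎)
      where
      open ≤-Reasoning
      step₁ : ∀ C q → 8 * (q * q) * (C * 2) + 2 * (C * q * q) ≡ 9 * q * C * (2 * q)
      step₁ = solve-∀
      step₂ : ∀ q B → 64 * (q * q) * B ≡ 8 * (q * q) * (8 * B)
      step₂ = solve-∀
      nine : 9 * q * C * N ≤ 64 * (q * q) * B
      nine = +-cancelʳ-≤ (7 * q * C * N) _ _ (begin
        9 * q * C * N + 7 * q * C * N    ≡⟨ s₁ q C N ⟩
        16 * q * (C * N)                 ≡⟨ cong (16 * q *_) (sym first) ⟩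
        16 * q * (q * X)                 ≡⟨ s₂ q X ⟩
        q * q * (16 * X)                 ≤⟨ *-monoʳ-≤ (q * q) pointwise ⟩
        q * q * (64 * B + Y)             ≡⟨ s₃ q B Y ⟩
        64 * (q * q) * B + q * q * Y     ≤⟨ +-monoʳ-≤ (64 * (q * q) * B) (begin
          q * q * Y                        ≤⟨ second ⟩
          C * (N * N + q * N)              ≤⟨ *-monoʳ-≤ C (+-monoˡ-≤ (q * N) (*-monoˡ-≤ N N≤6q)) ⟩
          C * (6 * q * N + q * N)          ≡⟨ s₄ q C N ⟩
          7 * q * C * N                    ∎) ⟩
        64 * (q * q) * B + 7 * q * C * N ∎)
        where
        s₁ : ∀ q C N → 9 * q * C * N + 7 * q * C * N ≡ 16 * q * (C * N)
        s₁ = solve-∀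
        s₂ : ∀ q X → 16 * q * (q * X) ≡ q * q * (16 * X)
        s₂ = solve-∀
        s₃ : ∀ q B Y → q * q * (64 * B + Y) ≡ 64 * (q * q) * B + q * q * Y
        s₃ = solve-∀
        s₄ : ∀ q C N → C * (6 * q * N + q * N) ≡ 7 * q * C * N
        s₄ = solve-∀

  -- The surplus 2⁻ʲ pays for the near graphs. In the averaging case they number at most `8 · 2ᵈ`
  -- out of 2ʲ⁺⁵⁺ᵈ, a fraction 2⁻ʲ⁻², and `(1 - 2⁻ʲ⁻²)(1 + 2⁻ʲ) ≥ 1 + 2⁻ʲ⁻¹`. The induction starts
  -- at 1/4, where the function itself is bad.
  chain-far : ∀ j {f : BoolFun (j + (4 + d))} → ¬ Near d f →
    chains j (4 + d) * (2 ^ j + 1) ≤ 8 * (2 ^ j * chainSum j (bad d) f)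
  chain-far {d} zero {f} ¬near = ≤-trans (m≤m+n 2 6)
    (≤-reflexive (cong (λ b → 8 * (1 * b)) (sym (bad-intro (¬near ∘ deg<⇒near)))))
  chain-far {d} (suc j) {f} ¬near with 8 * 2 ^ d <? count (NearHyperplanes.near d f)
  ... | yes many = from-codeword (NearHyperplanes.near-codeword d f many)
    where
    C = chains (suc j) (4 + d)
    B = chainSum (suc j) (bad d) f
    from-codeword : ∃[ Q ] Deg< (suc d) Q × 8 * (2 ^ d * count (f ⊻ Q)) ≤ 3 * 2 ^ (suc j + (4 + d)) →
      C * (2 ^ suc j + 1) ≤ 8 * (2 ^ suc j * B)
    -- Since `f` is not near, `Q` cannot be closer than 2⁻ᵈ / 8, which is the lower bound asked for
    -- by `chain-close`. The resulting 1/4 covers `(1 + 2⁻ʲ⁻¹) / 8`, because the bracket is at most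
    -- 2.
    from-codeword (Q , degQ , close) = weaken C (2 ^ suc j) B (m^n>0 2 (suc j))
      (chain-close (suc j) {f} {Q} degQ (≮⇒≥ (λ lt → ¬near (Q , degQ , lt))) close)
      where
      weaken : ∀ C q B → 1 ≤ q → C * 2 ≤ 8 * B → C * (q + 1) ≤ 8 * (q * B)
      weaken C q B 1≤q le = begin
        C * (q + 1)     ≤⟨ *-monoʳ-≤ C (+-monoʳ-≤ q 1≤q) ⟩
        C * (q + q)     ≡⟨ s₁ C q ⟩
        q * (C * 2)     ≤⟨ *-monoʳ-≤ q le ⟩
        q * (8 * B)     ≡⟨ s₂ q B ⟩
        8 * (q * B)     ∎
        where
        open ≤-Reasoning
        s₁ : ∀ C q → C * (q + q) ≡ q * (C * 2)
        s₁ = solve-∀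
        s₂ : ∀ q B → q * (8 * B) ≡ 8 * (q * B)
        s₂ = solve-∀
  ... | no few = average (chains j (4 + d)) (2 ^ j) (2 ^ d) (count near) (∑ Ω B) (2 ^ suc (j + (4 + d)))
      (m^n>0 2 j) (≮⇒≥ few) 2^n summed
    where
    open NearHyperplanes d f using (near)
    open ≤-Reasoning
    Ω = cube (suc (j + (4 + d)))
    T = chains j (4 + d) * (2 ^ j + 1)
    B : 𝔽₂^ suc (j + (4 + d)) → ℕ
    B s = chainSum j (bad d) (f ∘ graph s)
    2^n : 2 ^ suc (j + (4 + d)) ≡ 32 * (2 ^ d * 2 ^ j)
    2^n = trans (cong (2 *_) (^-distribˡ-+-* 2 j (4 + d))) (regroup (2 ^ j) (2 ^ d))
      where
      regroup : ∀ a b → 2 * (a * (2 * (2 * (2 * (2 * b))))) ≡ 32 * (b * a)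
      regroup = solve-∀
    pointwise : ∀ s → T ≤ 8 * (2 ^ j * B s) + ⟦ near s ⟧ * T
    pointwise s = go (near? d (f ∘ graph s))
      where
      go : (D : Dec (Near d (f ∘ graph s))) → T ≤ 8 * (2 ^ j * B s) + ⟦ does D ⟧ * T
      go (yes _)  = ≤-trans (≤-reflexive (sym (*-identityˡ T))) (m≤n+m (1 * T) (8 * (2 ^ j * B s)))
      go (no far) = ≤-trans (chain-far j far) (m≤m+n (8 * (2 ^ j * B s)) 0)
    summed : 2 ^ suc (j + (4 + d)) * T ≤ 8 * (2 ^ j * ∑ Ω B) + count near * T
    summed = begin
      2 ^ suc (j + (4 + d)) * T                         ≡⟨ sym (∑ᶜ-const (suc (j + (4 + d))) T) ⟩
      ∑ Ω (λ _ → T)                                     ≤⟨ ∑-mono Ω pointwise ⟩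
      ∑ Ω (λ s → 8 * (2 ^ j * B s) + ⟦ near s ⟧ * T)    ≡⟨ ∑-+ Ω _ _ ⟩
      _                                                 ≡⟨ cong₂ _+_ (trans (∑-*ˡ Ω 8 _) (cong (8 *_) (∑-*ˡ Ω (2 ^ j) B))) (∑-*ʳ Ω _ T) ⟩
      8 * (2 ^ j * ∑ Ω B) + count near * T              ∎
    average : ∀ C q D K B p → 1 ≤ q → K ≤ 8 * D → p ≡ 32 * (D * q) →
      p * (C * (q + 1)) ≤ 8 * (q * B) + K * (C * (q + 1)) → p * C * (2 * q + 1) ≤ 8 * (2 * q * B)
    average C q D K B p 1≤q K≤ p≡ sum = +-cancelʳ-≤ (p * C) _ _ (begin
      p * C * (2 * q + 1) + p * C            ≡⟨ s₁ C q p ⟩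
      2 * (p * (C * (q + 1)))                ≤⟨ *-monoʳ-≤ 2 sum ⟩
      2 * (8 * (q * B) + K * (C * (q + 1)))  ≡⟨ s₂ C q B K ⟩
      8 * (2 * q * B) + 2 * K * (q + 1) * C  ≤⟨ +-monoʳ-≤ (8 * (2 * q * B)) (*-monoˡ-≤ C (begin
        2 * K * (q + 1)                        ≤⟨ *-mono-≤ (*-monoʳ-≤ 2 K≤) (+-monoʳ-≤ q 1≤q) ⟩
        2 * (8 * D) * (q + q)                  ≡⟨ s₃ D q ⟩
        32 * (D * q)                           ≡⟨ sym p≡ ⟩
        p                                      ∎)) ⟩
      8 * (2 * q * B) + p * C                ∎)
      where
      s₁ : ∀ C q p → p * C * (2 * q + 1) + p * C ≡ 2 * (p * (C * (q + 1)))
      s₁ = solve-∀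
      s₂ : ∀ C q B K → 2 * (8 * (q * B) + K * (C * (q + 1))) ≡ 8 * (2 * q * B) + 2 * K * (q + 1) * C
      s₂ = solve-∀
      s₃ : ∀ D q → 2 * (8 * D) * (q + q) ≡ 32 * (D * q)
      s₃ = solve-∀

  -- Independent tuples and affine maps

  independent? : (vs : Vec (𝔽₂^ n) k) → Dec (LinearlyIndependent vs)
  independent? vs = map′
    (λ none ts eq → decidable-stable (ts ≟ⱽ 𝟎) (λ ne → none (ts , λ h → ne (h eq))))
    (λ ind (ts , ¬h) → ¬h (ind ts))
    (¬? (anySubset? (λ ts → ¬? ((combination ts vs ≟ⱽ 𝟎) →-dec (ts ≟ⱽ 𝟎)))))

  apply-injective : (φ : AffineMap k n) → LinearlyIndependent (proj₂ φ) →
    ∀ x y → apply φ x ≡ apply φ y → x ≡ y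
  apply-injective (u , vs) ind x y eq = ⊕≡𝟎⇒≡ x y (ind (x ⊕ y) (begin
    combination (x ⊕ y) vs               ≡⟨ combination-⊕ x y vs ⟩
    combination x vs ⊕ combination y vs  ≡⟨ cong (_⊕ combination y vs) same ⟩
    combination y vs ⊕ combination y vs  ≡⟨ ⊕-self _ ⟩
    𝟎                                    ∎))
    where
    open ≡-Reasoning
    undo : ∀ w → u ⊕ (u ⊕ w) ≡ w
    undo w = trans (⊕-comm u _) (trans (cong (_⊕ u) (⊕-comm u w)) (⊕-cancelʳ w u))
    same : combination x vs ≡ combination y vs
    same = trans (sym (undo _)) (trans (cong (u ⊕_) eq) (undo _))

  count-injective : (ψ : 𝔽₂^ m → 𝔽₂^ n) → (∀ x y → ψ x ≡ ψ y → x ≡ y) →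
    (p : BoolFun m) (q : BoolFun n) → (∀ x → p x ≡ true → q (ψ x) ≡ true) → count p ≤ count q
  count-injective {m} ψ inj p q h = ∑-inject (cube-unique m) (⟦_⟧ ∘ p) (⟦_⟧ ∘ q)
    (λ x y → does (ψ x ≟ⱽ y))
    (λ x x′ y e e′ → inj x x′ (trans (does⇒ (ψ x ≟ⱽ y) e) (sym (does⇒ (ψ x′ ≟ⱽ y) e′))))
    (λ x → ψ x , cube-complete (ψ x) , ≤-trans (⟦⟧-mono (h x)) (≤-reflexive
      (sym (trans (cong (λ b → ⟦ b ⟧ * ⟦ q (ψ x) ⟧) (does-true (ψ x ≟ⱽ ψ x) refl)) (+-identityʳ _)))))

  injective⇒surjective : (ψ : 𝔽₂^ n → 𝔽₂^ n) → (∀ x y → ψ x ≡ ψ y → x ≡ y) →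
    ∀ y → ∃[ x ] ψ x ≡ y
  injective⇒surjective {n} ψ inj y = decidable-stable (anySubset? (λ x → ψ x ≟ⱽ y)) λ missed →
    contradiction
      (begin-strict
        count {n} (λ _ → true)    ≤⟨ count-injective ψ inj (λ _ → true) other
                                       (λ x _ → cong not (does-false (ψ x ≟ⱽ y) (λ eq → missed (x , eq)))) ⟩
        count other               <⟨ m<n+m (count other) (≤-trans (≤-reflexive (sym (cong ⟦_⟧ (does-true (y ≟ⱽ y) refl))))
                                       (∑-∈ (λ z → ⟦ does (z ≟ⱽ y) ⟧) (cube-complete y))) ⟩
        count (λ z → does (z ≟ⱽ y)) + count other ≡⟨ sym (∑-+ (cube n) _ _) ⟩
        ∑ᶜ n (λ z → ⟦ does (z ≟ⱽ y) ⟧ + ⟦ other z ⟧) ≡⟨ ∑-cong (cube n) (λ z → ⟦⟧+⟦not⟧ (does (z ≟ⱽ y))) ⟩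
        count {n} (λ _ → true)    ∎)
      (<-irrefl refl)
    where
    open ≤-Reasoning
    other : BoolFun n
    other z = not (does (z ≟ⱽ y))

  -- A codeword near `f ∘ apply Φ` is carried back to one near `f` by the inverse of `Φ`. The
  -- inverse is affine because `apply Φ` is injective and preserves sums of three points.
  far-∘ : (f : BoolFun n) (Φ : AffineMap n n) → LinearlyIndependent (proj₂ Φ) →
    ¬ Near d f → ¬ Near d (f ∘ apply Φ)
  far-∘ {n} {d} f Φ ind far (g , dg , close) = far
    ( g ∘ Ψ , deg<-∘ Ψ-affine dg
    , ≤-<-trans (*-monoʳ-≤ 8 (*-monoʳ-≤ (2 ^ d) (count-injective Ψ Ψ-injective _ _
        (λ z → trans (cong (λ w → f w xor g (Ψ z)) (ΦΨ z)))))) close)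
    where
    onto : ∀ z → ∃[ x ] apply Φ x ≡ z
    onto = injective⇒surjective (apply Φ) (apply-injective Φ ind)
    Ψ : 𝔽₂^ n → 𝔽₂^ n
    Ψ z = proj₁ (onto z)
    ΦΨ : ∀ z → apply Φ (Ψ z) ≡ z
    ΦΨ z = proj₂ (onto z)
    Ψ-injective : ∀ x y → Ψ x ≡ Ψ y → x ≡ y
    Ψ-injective x y eq = trans (sym (ΦΨ x)) (trans (cong (apply Φ) eq) (ΦΨ y))
    Ψ-affine : Affine Ψ
    Ψ-affine x y = apply-injective Φ ind _ _ (begin
      apply Φ (Ψ (x ⊕ y))                                  ≡⟨ trans (ΦΨ (x ⊕ y)) (id-affine x y) ⟩
      (x ⊕ y) ⊕ 𝟎                                          ≡⟨ sym (cong₂ _⊕_ (cong₂ _⊕_ (ΦΨ x) (ΦΨ y)) (ΦΨ 𝟎)) ⟩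
      (apply Φ (Ψ x) ⊕ apply Φ (Ψ y)) ⊕ apply Φ (Ψ 𝟎)      ≡⟨ sym (apply-⊕₃ (Ψ x) (Ψ y) (Ψ 𝟎)) ⟩
      apply Φ ((Ψ x ⊕ Ψ y) ⊕ Ψ 𝟎)                          ∎)
      where
      open ≡-Reasoning
      apply-⊕₃ : ∀ x y z → apply Φ ((x ⊕ y) ⊕ z) ≡ (apply Φ x ⊕ apply Φ y) ⊕ apply Φ z
      apply-⊕₃ x y z = begin
        apply Φ ((x ⊕ y) ⊕ z)                    ≡⟨ aΦ (x ⊕ y) z ⟩
        (apply Φ (x ⊕ y) ⊕ apply Φ z) ⊕ c        ≡⟨ cong (λ w → (w ⊕ apply Φ z) ⊕ c) (aΦ x y) ⟩
        (((apply Φ x ⊕ apply Φ y) ⊕ c) ⊕ apply Φ z) ⊕ c ≡⟨ ⊕-assoc _ (apply Φ z) c ⟩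
        ((apply Φ x ⊕ apply Φ y) ⊕ c) ⊕ (apply Φ z ⊕ c) ≡⟨ ⊕-interchange (apply Φ x ⊕ apply Φ y) c (apply Φ z) c ⟩
        ((apply Φ x ⊕ apply Φ y) ⊕ apply Φ z) ⊕ (c ⊕ c) ≡⟨ trans (cong (((apply Φ x ⊕ apply Φ y) ⊕ apply Φ z) ⊕_) (⊕-self c)) (⊕-identityʳ _) ⟩
        (apply Φ x ⊕ apply Φ y) ⊕ apply Φ z      ∎
        where
        c = apply Φ 𝟎
        aΦ = apply-affine Φ

  -- Counting affine maps and independent tuples

  tuples : ∀ k n → List (Vec (𝔽₂^ n) k)
  tuples k n = vecs (cube n) k

  affineMaps : ∀ k n → List (AffineMap k n)
  affineMaps k n = cartesianProduct (cube n) (tuples k n)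

  vecs-complete : {A : Set} {xs : List A} → (∀ x → x ∈ xs) → ∀ {k} (vs : Vec A k) → vs ∈ vecs xs k
  vecs-complete all []       = here refl
  vecs-complete all (v ∷ vs) = ∈-cartesianProductWith⁺ _∷_ (all v) (vecs-complete all vs)

  vecs-unique : {A : Set} {xs : List A} → Unique xs → ∀ k → Unique (vecs xs k)
  vecs-unique u zero    = [] ∷ []
  vecs-unique u (suc k) = cartesianProductWith⁺ _∷_ ∷-injective u (vecs-unique u k)

  affineMaps-complete : (φ : AffineMap k n) → φ ∈ affineMaps k n
  affineMaps-complete (u , vs) = ∈-cartesianProduct⁺ (cube-complete u) (vecs-complete cube-complete vs)

  affineMaps-unique : ∀ k n → Unique (affineMaps k n)
  affineMaps-unique k n = cartesianProduct⁺ (cube-unique n) (vecs-unique (cube-unique n) k)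

  ∑-affineMaps : ∀ k n (F : AffineMap k n → ℕ) →
    ∑ (affineMaps k n) F ≡ ∑ᶜ n (λ u → ∑ (tuples k n) (λ vs → F (u , vs)))
  ∑-affineMaps k n F = ∑-cartesianProductWith _,_ (cube n) (tuples k n) F

  ∑-tuples-suc : ∀ k n (F : Vec (𝔽₂^ n) (suc k) → ℕ) →
    ∑ (tuples (suc k) n) F ≡ ∑ᶜ n (λ v → ∑ (tuples k n) (λ vs → F (v ∷ vs)))
  ∑-tuples-suc k n F = ∑-cartesianProductWith _∷_ (cube n) (tuples k n) F

  ∑-tuples-one : ∀ k n → ∑ (tuples k n) (λ _ → 1) ≡ (2 ^ n) ^ k
  ∑-tuples-one zero    n = refl
  ∑-tuples-one (suc k) n = trans (∑-tuples-suc k n _) (trans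
    (∑-cong (cube n) (λ _ → ∑-tuples-one k n)) (∑ᶜ-const n ((2 ^ n) ^ k)))

  independent : Vec (𝔽₂^ n) k → Bool
  independent vs = does (independent? vs)

  #independent : ∀ k n → ℕ
  #independent k n = ∑ (tuples k n) (⟦_⟧ ∘ independent)

  -- Every vector outside the span of `vs` extends it independently, and the span has at most 2ᵏ
  -- elements.
  ∑-independent-∷ : (vs : Vec (𝔽₂^ n) k) →
    2 ^ n * ⟦ independent vs ⟧ ≤ ∑ᶜ n (λ v → ⟦ independent (v ∷ vs) ⟧) + 2 ^ k * ⟦ independent vs ⟧
  ∑-independent-∷ {n} {k} vs = go (independent? vs)
    where
    open ≤-Reasoning
    I : ℕ
    I = ∑ᶜ n (λ v → ⟦ independent (v ∷ vs) ⟧)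
    go : (D : Dec (LinearlyIndependent vs)) → 2 ^ n * ⟦ does D ⟧ ≤ I + 2 ^ k * ⟦ does D ⟧
    go (no _)    = ≤-trans (≤-reflexive (*-zeroʳ (2 ^ n))) z≤n
    go (yes ind) = begin
      2 ^ n * 1
        ≡⟨ sym (∑ᶜ-const n 1) ⟩
      ∑ᶜ n (λ _ → 1)
        ≤⟨ ∑-mono (cube n) (λ v → extend v (anySubset? (λ t → combination t vs ≟ⱽ v))) ⟩
      ∑ᶜ n (λ v → ⟦ independent (v ∷ vs) ⟧ + ∑ᶜ k (λ t → same t v))
        ≡⟨ trans (∑-+ (cube n) _ _) (cong (I +_) (∑-swap (cube n) (cube k) _)) ⟩
      I + ∑ᶜ k (λ t → ∑ᶜ n (same t))
        ≤⟨ +-monoʳ-≤ I (∑-mono (cube k) (λ t → ∑≤1 (cube-unique n) (λ v → does (combination t vs ≟ⱽ v))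
             (λ v w e e′ → trans (sym (does⇒ (combination t vs ≟ⱽ v) e)) (does⇒ (combination t vs ≟ⱽ w) e′)))) ⟩
      I + ∑ᶜ k (λ _ → 1)
        ≡⟨ cong (I +_) (∑ᶜ-const k 1) ⟩
      I + 2 ^ k * 1 ∎
      where
      same : 𝔽₂^ k → 𝔽₂^ n → ℕ
      same t v = ⟦ does (combination t vs ≟ⱽ v) ⟧
      extend : ∀ v → Dec (∃[ t ] combination t vs ≡ v) →
        1 ≤ ⟦ independent (v ∷ vs) ⟧ + ∑ᶜ k (λ t → same t v)
      extend v (yes (t , eq)) = ≤-trans
        (≤-trans (≤-reflexive (sym (cong ⟦_⟧ (does-true (combination t vs ≟ⱽ v) eq))))
          (∑-∈ (λ t → same t v) (cube-complete t)))
        (m≤n+m _ ⟦ independent (v ∷ vs) ⟧)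
      extend v (no outside) = ≤-trans
        (≤-reflexive (sym (cong ⟦_⟧ (does-true (independent? (v ∷ vs)) ind′)))) (m≤m+n _ _)
        where
        ind′ : LinearlyIndependent (v ∷ vs)
        ind′ (false ∷ t) eq = cong (false ∷_) (ind t (trans (sym (⊕-identityˡ _))
          (trans (cong (_⊕ combination t vs) (sym (·-zeroˡ v))) eq)))
        ind′ (true ∷ t) eq = contradiction
          (t , sym (⊕≡𝟎⇒≡ v _ (trans (cong (_⊕ combination t vs) (sym (·-identityˡ v))) eq))) outside

  #independent≤ : ∀ k n → #independent k n ≤ (2 ^ n) ^ k
  #independent≤ k n = ≤-trans (∑-mono (tuples k n) (λ vs → ⟦⟧≤1 (independent vs)))
    (≤-reflexive (∑-tuples-one k n))

  #independent-suc : ∀ k n → 2 ^ n * #independent k n ≤ #independent (suc k) n + 2 ^ k * #independent k n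
  #independent-suc k n = begin
    2 ^ n * #independent k n
      ≡⟨ sym (∑-*ˡ (tuples k n) (2 ^ n) _) ⟩
    ∑ (tuples k n) (λ vs → 2 ^ n * ⟦ independent vs ⟧)
      ≤⟨ ∑-mono (tuples k n) ∑-independent-∷ ⟩
    ∑ (tuples k n) (λ vs → ∑ᶜ n (λ v → ⟦ independent (v ∷ vs) ⟧) + 2 ^ k * ⟦ independent vs ⟧)
      ≡⟨ ∑-+ (tuples k n) _ _ ⟩
    ∑ (tuples k n) (λ vs → ∑ᶜ n (λ v → ⟦ independent (v ∷ vs) ⟧)) + ∑ (tuples k n) (λ vs → 2 ^ k * ⟦ independent vs ⟧)
      ≡⟨ cong₂ _+_ (trans (∑-swap (tuples k n) (cube n) _) (sym (∑-tuples-suc k n _))) (∑-*ˡ (tuples k n) (2 ^ k) _) ⟩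
    #independent (suc k) n + 2 ^ k * #independent k n ∎
    where open ≤-Reasoning

  -- A union bound for the product of the factors 1 - 2ⁱ⁻ⁿ: the density of independent tuples is at
  -- least 1 - 2ᵏ⁻ⁿ. For `k = n` this says nothing.
  #independent-lower : ∀ k n → 2 ^ n * (2 ^ n) ^ k ≤ 2 ^ n * #independent k n + 2 ^ k * (2 ^ n) ^ k
  #independent-lower zero n = ≤-trans (*-monoʳ-≤ (2 ^ n)
    (≤-reflexive (sym (cong (λ b → ⟦ b ⟧ + 0) (does-true (independent? {n} []) (λ { [] _ → refl })))))) (m≤m+n _ _)
  #independent-lower (suc k) n = step (2 ^ n) (2 ^ k) ((2 ^ n) ^ k) (#independent k n) (#independent (suc k) n)
    (#independent-suc k n) (#independent-lower k n) (#independent≤ k n)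
    where
    step : ∀ Q K P I J → Q * I ≤ J + K * I → Q * P ≤ Q * I + K * P → I ≤ P →
      Q * (Q * P) ≤ Q * J + 2 * K * (Q * P)
    step Q K P I J QI≤ QP≤ I≤P = begin
      Q * (Q * P)                      ≤⟨ *-monoʳ-≤ Q QP≤ ⟩
      Q * (Q * I + K * P)              ≤⟨ *-monoʳ-≤ Q (+-monoˡ-≤ (K * P) QI≤) ⟩
      Q * (J + K * I + K * P)          ≤⟨ *-monoʳ-≤ Q (+-monoˡ-≤ (K * P) (+-monoʳ-≤ J (*-monoʳ-≤ K I≤P))) ⟩
      Q * (J + K * P + K * P)          ≡⟨ regroup Q J K P ⟩
      Q * J + 2 * K * (Q * P)          ∎
      where
      open ≤-Reasoning
      regroup : ∀ Q J K P → Q * (J + K * P + K * P) ≡ Q * J + 2 * K * (Q * P)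
      regroup = solve-∀

  -- All vectors but the last are independent with density at least 1/2 by `#independent-lower`;
  -- they span at most half of the space, so the last one costs another factor 2.
  #independent-quarter : ∀ n → 0 < n → (2 ^ n) ^ n ≤ 4 * #independent n n
  #independent-quarter (suc n) _ = step (2 ^ n) ((2 ^ suc n) ^ n) (#independent n (suc n)) (#independent (suc n) (suc n))
    (m^n>0 2 n) (#independent-lower n (suc n)) (#independent-suc n (suc n))
    where
    step : ∀ q P I J → 1 ≤ q → 2 * q * P ≤ 2 * q * I + q * P → 2 * q * I ≤ J + q * I → 2 * q * P ≤ 4 * J
    step q@(suc _) P I J _ lower next = begin
      2 * q * P       ≡⟨ s₁ q P ⟩
      q * (2 * P)     ≤⟨ *-monoʳ-≤ q (*-monoʳ-≤ 2 P≤2I) ⟩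
      q * (2 * (2 * I)) ≡⟨ s₂ q I ⟩
      4 * (q * I)     ≤⟨ *-monoʳ-≤ 4 (+-cancelʳ-≤ (q * I) (q * I) J (≤-trans (≤-reflexive (s₃ q I)) next)) ⟩
      4 * J           ∎
      where
      open ≤-Reasoning
      s₁ : ∀ q P → 2 * q * P ≡ q * (2 * P)
      s₁ = solve-∀
      s₂ : ∀ q I → q * (2 * (2 * I)) ≡ 4 * (q * I)
      s₂ = solve-∀
      s₃ : ∀ q I → q * I + q * I ≡ 2 * q * I
      s₃ = solve-∀
      s₄ : ∀ q P → q * P + q * P ≡ 2 * q * P
      s₄ = solve-∀
      s₅ : ∀ q I → 2 * q * I ≡ q * (2 * I)
      s₅ = solve-∀
      P≤2I : P ≤ 2 * I
      P≤2I = *-cancelˡ-≤ q (≤-trans (+-cancelʳ-≤ (q * P) _ _ (≤-trans (≤-reflexive (s₄ q P)) lower))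
        (≤-reflexive (s₅ q I)))

  ·-distribˡ-⊕ : ∀ t (v w : 𝔽₂^ n) → t · (v ⊕ w) ≡ t · v ⊕ t · w
  ·-distribˡ-⊕ t []      []      = refl
  ·-distribˡ-⊕ t (b ∷ v) (c ∷ w) = cong₂ _∷_ (∧-distribˡ-xor t b c) (·-distribˡ-⊕ t v w)

  ·-assoc : ∀ s t (v : 𝔽₂^ n) → (s ∧ t) · v ≡ s · (t · v)
  ·-assoc s t []      = refl
  ·-assoc s t (b ∷ v) = cong₂ _∷_ (∧-assoc s t b) (·-assoc s t v)

  -- Restricting affine maps to graphs

  shear : 𝔽₂^ k → 𝔽₂^ n → Vec (𝔽₂^ n) k → Vec (𝔽₂^ n) k
  shear a w = zipWith (λ t v → v ⊕ t · w) a

  combination-shear : (x a : 𝔽₂^ k) (w : 𝔽₂^ n) (vs : Vec (𝔽₂^ n) k) →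
    combination x (shear a w vs) ≡ (a ∙ x) · w ⊕ combination x vs
  combination-shear []      []      w []       = sym (trans (cong (_⊕ 𝟎) (·-zeroˡ w)) (⊕-self 𝟎))
  combination-shear (s ∷ x) (t ∷ a) w (v ∷ vs) = begin
    s · (v ⊕ t · w) ⊕ combination x (shear a w vs)
      ≡⟨ cong₂ _⊕_ (trans (·-distribˡ-⊕ s v _) (trans (⊕-comm _ _) (cong (_⊕ s · v)
           (trans (sym (·-assoc s t w)) (cong (_· w) (∧-comm s t)))))) (combination-shear x a w vs) ⟩
    ((t ∧ s) · w ⊕ s · v) ⊕ ((a ∙ x) · w ⊕ combination x vs)
      ≡⟨ ⊕-interchange ((t ∧ s) · w) (s · v) _ _ ⟩
    ((t ∧ s) · w ⊕ (a ∙ x) · w) ⊕ (s · v ⊕ combination x vs)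
      ≡⟨ cong (_⊕ (s · v ⊕ combination x vs)) (sym (·-distribʳ-xor (t ∧ s) (a ∙ x) w)) ⟩
    ((t ∧ s) xor (a ∙ x)) · w ⊕ (s · v ⊕ combination x vs) ∎
    where open ≡-Reasoning

  infixl 7 _∘ᴳ_

  _∘ᴳ_ : AffineMap (suc m) n → 𝔽₂^ suc m → AffineMap m n
  (u , w ∷ vs) ∘ᴳ (b ∷ a) = u ⊕ b · w , shear a w vs

  apply-∘ᴳ : (Φ : AffineMap (suc m) n) (s : 𝔽₂^ suc m) → apply (Φ ∘ᴳ s) ≗ apply Φ ∘ graph s
  apply-∘ᴳ (u , w ∷ vs) (b ∷ a) x = begin
    (u ⊕ b · w) ⊕ combination x (shear a w vs)            ≡⟨ cong ((u ⊕ b · w) ⊕_) (combination-shear x a w vs) ⟩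
    (u ⊕ b · w) ⊕ ((a ∙ x) · w ⊕ combination x vs)        ≡⟨ ⊕-assoc u _ _ ⟩
    u ⊕ (b · w ⊕ ((a ∙ x) · w ⊕ combination x vs))        ≡⟨ cong (u ⊕_) (sym (⊕-assoc (b · w) _ _)) ⟩
    u ⊕ ((b · w ⊕ (a ∙ x) · w) ⊕ combination x vs)        ≡⟨ cong (λ v → u ⊕ (v ⊕ combination x vs)) (sym (·-distribʳ-xor b (a ∙ x) w)) ⟩
    u ⊕ ((b xor (a ∙ x)) · w ⊕ combination x vs)          ∎
    where open ≡-Reasoning

  independent-∘ᴳ : (Φ : AffineMap (suc m) n) (s : 𝔽₂^ suc m) →
    LinearlyIndependent (proj₂ Φ) → LinearlyIndependent (proj₂ (Φ ∘ᴳ s))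
  independent-∘ᴳ (u , w ∷ vs) (b ∷ a) ind x eq =
    cong tail (ind ((a ∙ x) ∷ x) (trans (sym (combination-shear x a w vs)) eq))

  ∑-shear : (a : 𝔽₂^ k) (w : 𝔽₂^ n) (F : Vec (𝔽₂^ n) k → ℕ) →
    ∑ (tuples k n) (F ∘ shear a w) ≡ ∑ (tuples k n) F
  ∑-shear                 []      w F = refl
  ∑-shear {suc k} {n} (t ∷ a) w F = begin
    ∑ (tuples (suc k) n) (F ∘ shear (t ∷ a) w)
      ≡⟨ ∑-tuples-suc k n _ ⟩
    ∑ᶜ n (λ v → ∑ (tuples k n) (λ vs → F ((v ⊕ t · w) ∷ shear a w vs)))
      ≡⟨ ∑-cong (cube n) (λ v → ∑-shear a w (λ vs → F ((v ⊕ t · w) ∷ vs))) ⟩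
    ∑ᶜ n (λ v → ∑ (tuples k n) (λ vs → F ((v ⊕ t · w) ∷ vs)))
      ≡⟨ ∑ᶜ-translate (t · w) (λ v → ∑ (tuples k n) (λ vs → F (v ∷ vs))) ⟩
    ∑ᶜ n (λ v → ∑ (tuples k n) (λ vs → F (v ∷ vs)))
      ≡⟨ sym (∑-tuples-suc k n F) ⟩
    ∑ (tuples (suc k) n) F ∎
    where open ≡-Reasoning

  -- For a fixed `s`, restriction carries uniform maps to uniform maps. Once the first direction `w`
  -- is fixed, the base point and the other directions are merely translated by multiples of `w`;
  -- the choice of `w` accounts for the factor `2 ^ n`.
  ∑-∘ᴳ : (s : 𝔽₂^ suc m) (F : AffineMap m n → ℕ) →
    ∑ (affineMaps (suc m) n) (λ Φ → F (Φ ∘ᴳ s)) ≡ 2 ^ n * ∑ (affineMaps m n) F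
  ∑-∘ᴳ {m} {n} (b ∷ a) F = begin
    ∑ (affineMaps (suc m) n) (λ Φ → F (Φ ∘ᴳ (b ∷ a)))
      ≡⟨ ∑-affineMaps (suc m) n _ ⟩
    ∑ᶜ n (λ u → ∑ (tuples (suc m) n) (λ vs → F ((u , vs) ∘ᴳ (b ∷ a))))
      ≡⟨ ∑-cong (cube n) (λ u → ∑-tuples-suc m n _) ⟩
    ∑ᶜ n (λ u → ∑ᶜ n (λ w → ∑ (tuples m n) (λ vs → F (u ⊕ b · w , shear a w vs))))
      ≡⟨ ∑-cong (cube n) (λ u → ∑-cong (cube n) (λ w → ∑-shear a w (λ vs → F (u ⊕ b · w , vs)))) ⟩
    ∑ᶜ n (λ u → ∑ᶜ n (λ w → G (u ⊕ b · w)))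
      ≡⟨ ∑-swap (cube n) (cube n) _ ⟩
    ∑ᶜ n (λ w → ∑ᶜ n (λ u → G (u ⊕ b · w)))
      ≡⟨ ∑-cong (cube n) (λ w → ∑ᶜ-translate (b · w) G) ⟩
    ∑ᶜ n (λ w → ∑ᶜ n G)
      ≡⟨ ∑ᶜ-const n _ ⟩
    2 ^ n * ∑ᶜ n G
      ≡⟨ cong (2 ^ n *_) (sym (∑-affineMaps m n F)) ⟩
    2 ^ n * ∑ (affineMaps m n) F ∎
    where
    open ≡-Reasoning
    G : 𝔽₂^ n → ℕ
    G u = ∑ (tuples m n) (λ vs → F (u , vs))

  mapChainSum : ∀ j → (AffineMap m n → ℕ) → AffineMap (j + m) n → ℕ
  mapChainSum zero    F Φ = F Φ
  mapChainSum (suc j) F Φ = ∑ᶜ (suc (j + _)) (λ s → mapChainSum j F (Φ ∘ᴳ s))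

  -- Each smaller map is reached equally often: once for every chain and every choice of the `j`
  -- directions that are forgotten.
  ∑-mapChainSum : ∀ j (F : AffineMap m n → ℕ) →
    ∑ (affineMaps (j + m) n) (mapChainSum j F) ≡
    chains j m * ((2 ^ n) ^ j * ∑ (affineMaps m n) F)
  ∑-mapChainSum zero F = sym (trans (*-identityˡ _) (*-identityˡ _))
  ∑-mapChainSum {m} {n} (suc j) F = begin
    ∑ (affineMaps (suc (j + m)) n) (λ Φ → ∑ Ω (λ s → mapChainSum j F (Φ ∘ᴳ s)))
      ≡⟨ ∑-swap (affineMaps (suc (j + m)) n) Ω _ ⟩
    ∑ Ω (λ s → ∑ (affineMaps (suc (j + m)) n) (λ Φ → mapChainSum j F (Φ ∘ᴳ s)))
      ≡⟨ ∑-cong Ω (λ s → trans (∑-∘ᴳ s (mapChainSum j F)) (cong (2 ^ n *_) (∑-mapChainSum j F))) ⟩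
    ∑ Ω (λ s → 2 ^ n * (chains j m * ((2 ^ n) ^ j * S)))
      ≡⟨ ∑ᶜ-const (suc (j + m)) _ ⟩
    2 ^ suc (j + m) * (2 ^ n * (chains j m * ((2 ^ n) ^ j * S)))
      ≡⟨ regroup (2 ^ suc (j + m)) (2 ^ n) (chains j m) ((2 ^ n) ^ j) S ⟩
    2 ^ suc (j + m) * chains j m * (2 ^ n * (2 ^ n) ^ j * S) ∎
    where
    open ≡-Reasoning
    Ω = cube (suc (j + m))
    S = ∑ (affineMaps m n) F
    regroup : ∀ p q C r S → p * (q * (C * (r * S))) ≡ p * C * (q * r * S)
    regroup = solve-∀

  -- g ranges over all functions with the values of f ∘ apply φ, for want of
  -- function extensionality.
  _DominatedBy_along_ : (BoolFun m → ℕ) → (AffineMap m n → ℕ) → BoolFun n → Set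
  w DominatedBy F along f =
    ∀ φ → LinearlyIndependent (proj₂ φ) → ∀ g → g ≗ f ∘ apply φ → w g ≤ F φ

  chainSum-dominated : ∀ j {f : BoolFun n} {w : BoolFun m → ℕ} {F : AffineMap m n → ℕ} →
    w DominatedBy F along f → chainSum j w DominatedBy mapChainSum j F along f
  chainSum-dominated zero    dom = dom
  chainSum-dominated (suc j) {f} dom Φ ind g g≗ = ∑-mono (cube (suc (j + _))) λ s →
    chainSum-dominated j {f = f} dom (Φ ∘ᴳ s) (independent-∘ᴳ Φ s ind) (g ∘ graph s)
      (λ x → trans (g≗ (graph s x)) (cong f (sym (apply-∘ᴳ Φ s x))))

  rejecting : ∀ d → BoolFun n → AffineMap (suc d) n → ℕ
  rejecting d f φ = ⟦ independent (proj₂ φ) ⟧ * bad d (f ∘ apply φ)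

  bad-cong : {f g : BoolFun n} → f ≗ g → bad d f ≤ bad d g
  bad-cong {d = d} {f} {g} f≗g = go (deg<? d f) (deg<? d g)
    where
    go : (D : Dec (Deg< (suc d) f)) (E : Dec (Deg< (suc d) g)) → ⟦ not (does D) ⟧ ≤ ⟦ not (does E) ⟧
    go (yes _)  _       = z≤n
    go (no _)   (no _)  = ≤-refl
    go (no ¬df) (yes dg) = contradiction (deg<-cong (λ x → sym (f≗g x)) dg) ¬df

  bad-dominated : (f : BoolFun n) → bad d DominatedBy rejecting d f along f
  bad-dominated {d = d} f φ ind g g≗ = ≤-trans (bad-cong g≗) (≤-reflexive (sym
    (trans (cong (λ b → ⟦ b ⟧ * bad d (f ∘ apply φ)) (does-true (independent? (proj₂ φ)) ind)) (+-identityʳ _))))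

  chainSum-mono : ∀ j {w w′ : BoolFun m → ℕ} → (∀ g → w g ≤ w′ g) →
    ∀ f → chainSum j w f ≤ chainSum j w′ f
  chainSum-mono zero    le f = le f
  chainSum-mono (suc j) le f = ∑-mono (cube (suc (j + _))) (λ s → chainSum-mono j le (f ∘ graph s))

  chainSum-*ˡ : ∀ j c (w : BoolFun m → ℕ) f → chainSum j (λ g → c * w g) f ≡ c * chainSum j w f
  chainSum-*ˡ zero    c w f = refl
  chainSum-*ˡ (suc j) c w f = trans (∑-cong (cube (suc (j + _))) (λ s → chainSum-*ˡ j c w (f ∘ graph s)))
    (∑-*ˡ (cube (suc (j + _))) c _)

  chains>0 : ∀ j m → 0 < chains j m
  chains>0 zero    m = s≤s z≤n
  chains>0 (suc j) m = *-mono-≤ (m^n>0 2 (suc (j + m))) (chains>0 j m)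

  -- A quarter of the affine maps Φ of the whole space are invertible, and then f ∘ Φ
  -- is as far from RM(d, n) as f.
  average-over-maps : ∀ n → 0 < n → (F : AffineMap n n → ℕ) → ∀ C M R →
    0 < C → 0 < M →
    (∀ Φ → LinearlyIndependent (proj₂ Φ) → C ≤ 64 * F Φ) →
    ∑ (affineMaps n n) F ≡ C * (M * R) →
    ∀ N → (2 ^ n) ^ suc n ≡ M * N → N ≤ 256 * R
  average-over-maps dim 0<dim F C M R 0<C 0<M far total N split =
    cancel C M R N 0<C 0<M (begin
      C * (M * N)                                 ≡⟨ cong (C *_) (sym split) ⟩
      C * (Q * Q ^ dim)                             ≤⟨ *-monoʳ-≤ C (*-monoʳ-≤ Q (#independent-quarter dim 0<dim)) ⟩
      C * (Q * (4 * #independent dim dim))            ≡⟨ regroup C Q (#independent dim dim) ⟩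
      4 * (Q * #independent dim dim * C)              ≡⟨ cong (λ a → 4 * (a * C)) (sym total-independent) ⟩
      4 * (∑ Ω (λ Φ → ⟦ independent (proj₂ Φ) ⟧) * C) ≡⟨ cong (4 *_) (sym (∑-*ʳ Ω _ C)) ⟩
      4 * ∑ Ω (λ Φ → ⟦ independent (proj₂ Φ) ⟧ * C) ≤⟨ *-monoʳ-≤ 4 (∑-mono Ω (λ Φ → go Φ (independent? (proj₂ Φ)))) ⟩
      4 * ∑ Ω (λ Φ → 64 * F Φ)                    ≡⟨ cong (4 *_) (trans (∑-*ˡ Ω 64 F) (cong (64 *_) total)) ⟩
      4 * (64 * (C * (M * R)))                    ∎)
    where
    open ≤-Reasoning
    Q = 2 ^ dim
    Ω = affineMaps dim dim
    total-independent : ∑ Ω (λ Φ → ⟦ independent (proj₂ Φ) ⟧) ≡ Q * #independent dim dim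
    total-independent = trans (∑-affineMaps dim dim _) (∑ᶜ-const dim _)
    go : ∀ Φ (D : Dec (LinearlyIndependent (proj₂ Φ))) → ⟦ does D ⟧ * C ≤ 64 * F Φ
    go Φ (yes ind) = ≤-trans (≤-reflexive (*-identityˡ C)) (far Φ ind)
    go Φ (no _)    = z≤n
    regroup : ∀ C Q I → C * (Q * (4 * I)) ≡ 4 * (Q * I * C)
    regroup = solve-∀
    cancel : ∀ C M R N → 0 < C → 0 < M → C * (M * N) ≤ 4 * (64 * (C * (M * R))) → N ≤ 256 * R
    cancel C@(suc _) M@(suc _) R N _ _ le = *-cancelˡ-≤ M (*-cancelˡ-≤ C (≤-trans le (≤-reflexive (assemble C M R))))
      where
      assemble : ∀ C M R → 4 * (64 * (C * (M * R))) ≡ C * (M * (256 * R))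
      assemble = solve-∀

  -- In the dimensions below `d + 4`, a function that is not near has degree above `d`, and at most
  -- two halvings lead down to dimension `d + 1`. The constant 64 matches the deep case.
  rejecting-lower-shallow : ∀ i → i ≤ 2 → (f : BoolFun (i + suc d)) → ¬ Near d f →
    (2 ^ (i + suc d)) ^ suc (suc d) ≤ 256 * ∑ (affineMaps (suc d) (i + suc d)) (rejecting d f)
  rejecting-lower-shallow {d} i i≤2 f far = average-over-maps dim (≤-trans (s≤s z≤n) (m≤n+m (suc d) i))
    (mapChainSum i (rejecting d f)) (chains i (suc d)) ((2 ^ dim) ^ i) _
    (chains>0 i (suc d)) (m^n>0 (2 ^ dim) {{m^n≢0 2 dim}} i) each
    (∑-mapChainSum i (rejecting d f)) _
    (trans (cong ((2 ^ dim) ^_) (sym (+-suc i (suc d)))) (^-distribˡ-+-* (2 ^ dim) i (suc (suc d))))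
    where
    open ≤-Reasoning
    dim = i + suc d
    C = chains i (suc d)
    each : ∀ Φ → LinearlyIndependent (proj₂ Φ) → C ≤ 64 * mapChainSum i (rejecting d f) Φ
    each Φ ind = begin
      C                                                  ≡⟨ sym (*-identityʳ C) ⟩
      C * 1                                              ≡⟨ cong (C *_) (sym (bad-intro (far-∘ f Φ ind far ∘ deg<⇒near))) ⟩
      C * bad d (f ∘ apply Φ)                            ≤⟨ half-chain i ⟩
      2 ^ i * chainSum i (bad d) (f ∘ apply Φ)           ≤⟨ *-mono-≤ (≤-trans (^-monoʳ-≤ 2 i≤2) (m≤m+n 4 60))
        (chainSum-dominated i {f = f} (bad-dominated f) Φ ind (f ∘ apply Φ) (λ _ → refl)) ⟩
      64 * mapChainSum i (rejecting d f) Φ               ∎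

  -- The constant 64 is 8 from `chain-far` times 2³ from the three halvings between dimensions
  -- `d + 4` and `d + 1`.
  rejecting-lower-deep : ∀ j (f : BoolFun (j + (4 + d))) → ¬ Near d f →
    (2 ^ (j + (4 + d))) ^ suc (suc d) ≤
    256 * ∑ (affineMaps (suc d) (j + (4 + d))) (rejecting d f)
  rejecting-lower-deep {d} j f far = average-over-maps dim (≤-trans (s≤s z≤n) (m≤n+m (4 + d) j))
    (mapChainSum j F₃) (Cⱼ * C₃) (Q ^ j * Q ^ 3) R
    (*-mono-≤ (chains>0 j (4 + d)) (chains>0 3 (suc d)))
    (*-mono-≤ (m^n>0 Q {{m^n≢0 2 dim}} j) (m^n>0 Q {{m^n≢0 2 dim}} 3)) each
    (trans (∑-mapChainSum j F₃) (trans (cong (λ a → Cⱼ * (Q ^ j * a)) (∑-mapChainSum 3 (rejecting d f)))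
      (regroup Cⱼ (Q ^ j) C₃ (Q ^ 3) R)))
    (Q ^ suc (suc d))
    (trans (cong (Q ^_) (sym (+-suc j (4 + d)))) (trans (^-distribˡ-+-* Q j (5 + d))
      (trans (cong (Q ^ j *_) (^-distribˡ-+-* Q 3 (suc (suc d)))) (sym (*-assoc (Q ^ j) (Q ^ 3) _)))))
    where
    dim = j + (4 + d)
    Q = 2 ^ dim
    R = ∑ (affineMaps (suc d) dim) (rejecting d f)
    F₃ : AffineMap (4 + d) dim → ℕ
    F₃ = mapChainSum 3 (rejecting d f)
    Cⱼ = chains j (4 + d)
    C₃ = chains 3 (suc d)
    regroup : ∀ C q D r R → C * (q * (D * (r * R))) ≡ C * D * (q * r * R)
    regroup = solve-∀
    each : ∀ Φ → LinearlyIndependent (proj₂ Φ) → Cⱼ * C₃ ≤ 64 * mapChainSum j F₃ Φ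
    each Φ ind = ≤-trans
      (combine (2 ^ j) Cⱼ C₃ (chainSum j (bad d) g) (chainSum j (chainSum 3 (bad d)) g) (m^n>0 2 j) (chain-far j (far-∘ f Φ ind far)) (begin
        C₃ * chainSum j (bad d) g             ≡⟨ sym (chainSum-*ˡ j C₃ (bad d) g) ⟩
        chainSum j (λ h → C₃ * bad d h) g     ≤⟨ chainSum-mono j (λ h → half-chain {d = d} 3 {h}) g ⟩
        chainSum j (λ h → 8 * chainSum 3 (bad d) h) g ≡⟨ chainSum-*ˡ j 8 (chainSum 3 (bad d)) g ⟩
        8 * chainSum j (chainSum 3 (bad d)) g ∎))
      (*-monoʳ-≤ 64 (chainSum-dominated j {f = f} (chainSum-dominated 3 {f = f} (bad-dominated f))
        Φ ind g (λ _ → refl)))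
      where
      open ≤-Reasoning
      g : BoolFun dim
      g = f ∘ apply Φ
      combine : ∀ q C D X Y → 0 < q → C * (q + 1) ≤ 8 * (q * X) → D * X ≤ 8 * Y → C * D ≤ 64 * Y
      combine q@(suc _) C D X Y _ CX DX = *-cancelˡ-≤ q (begin
        q * (C * D)           ≡⟨ s₁ q C D ⟩
        D * (C * q)           ≤⟨ *-monoʳ-≤ D (≤-trans (*-monoʳ-≤ C (m≤m+n q 1)) CX) ⟩
        D * (8 * (q * X))     ≡⟨ s₂ q D X ⟩
        8 * (q * (D * X))     ≤⟨ *-monoʳ-≤ 8 (*-monoʳ-≤ q DX) ⟩
        8 * (q * (8 * Y))     ≡⟨ s₃ q Y ⟩
        q * (64 * Y)          ∎)
        where
        s₁ : ∀ q C D → q * (C * D) ≡ D * (C * q)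
        s₁ = solve-∀
        s₂ : ∀ q D X → D * (8 * (q * X)) ≡ 8 * (q * (D * X))
        s₂ = solve-∀
        s₃ : ∀ q Y → 8 * (q * (8 * Y)) ≡ q * (64 * Y)
        s₃ = solve-∀

  rejecting-lower : ∀ d n → suc d ≤ n → (f : BoolFun n) → ¬ Near d f →
    (2 ^ n) ^ suc (suc d) ≤ 256 * ∑ (affineMaps (suc d) n) (rejecting d f)
  rejecting-lower d n d<n = subst Goal (m∸n+n≡m d<n) (go (n ∸ suc d))
    where
    Goal : ℕ → Set
    Goal n = (f : BoolFun n) → ¬ Near d f →
      (2 ^ n) ^ suc (suc d) ≤ 256 * ∑ (affineMaps (suc d) n) (rejecting d f)
    go : ∀ i → Goal (i + suc d)
    go 0 = rejecting-lower-shallow 0 z≤n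
    go 1 = rejecting-lower-shallow 1 (s≤s z≤n)
    go 2 = rejecting-lower-shallow 2 ≤-refl
    go (suc (suc (suc j))) = subst Goal shift (rejecting-lower-deep j)
      where
      shift : j + (4 + d) ≡ 3 + j + suc d
      shift = trans (sym (+-assoc j 3 (suc d))) (cong (_+ suc d) (+-comm j 3))

  -- Images and composites of affine maps

  parametrizes : AffineMap k n → BoolFun n → Bool
  parametrizes φ A = does (φ parametrizes? A)

  parametrizes-≗ : (φ : AffineMap k n) {A B : BoolFun n} → A ≗ B → φ Parametrizes A → φ Parametrizes B
  parametrizes-≗ φ A≗B (ind , image) = ind , λ x → mk⇔
    (λ Bx → Equivalence.to (image x) (trans (A≗B x) Bx))
    (λ hit → trans (sym (A≗B x)) (Equivalence.from (image x) hit))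

  image : AffineMap k n → BoolFun n
  image φ x = does (anySubset? (λ t → apply φ t ≟ⱽ x))

  parametrizes-image : (φ : AffineMap k n) → LinearlyIndependent (proj₂ φ) → φ Parametrizes image φ
  parametrizes-image φ ind = ind , λ x → mk⇔ (does⇒ (anySubset? (λ t → apply φ t ≟ⱽ x)))
    (does-true (anySubset? (λ t → apply φ t ≟ⱽ x)))

  bool-ext : ∀ {a b} → (a ≡ true → b ≡ true) → (b ≡ true → a ≡ true) → a ≡ b
  bool-ext {false} {false} f g = refl
  bool-ext {false} {true}  f g = g refl
  bool-ext {true}  {b}     f g = sym (f refl)

  -- The only set that `φ` can parametrize is its image, which `functions` lists exactly once up to
  -- `_≗_`.
  ∑-parametrizes : (φ : AffineMap k n) →
    ∑ (functions n) (λ A → ⟦ parametrizes φ A ⟧) ≡ ⟦ independent (proj₂ φ) ⟧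
  ∑-parametrizes {n = n} φ = go (independent? (proj₂ φ))
    where
    go : (D : Dec (LinearlyIndependent (proj₂ φ))) →
      ∑ (functions n) (λ A → ⟦ parametrizes φ A ⟧) ≡ ⟦ does D ⟧
    go (no dep) = ∑≡0 (functions n) (parametrizes φ)
      (λ A _ → does-false (φ parametrizes? A) (dep ∘ proj₁))
    go (yes ind) = ≤-antisym
      (∑≤1-AllPairs (functions-unique n) (parametrizes φ) (λ A B pA pB A≇B → A≇B (λ x →
        let _ , imA = does⇒ (φ parametrizes? A) pA ; _ , imB = does⇒ (φ parametrizes? B) pB in
        bool-ext (Equivalence.from (imB x) ∘ Equivalence.to (imA x))
                 (Equivalence.from (imA x) ∘ Equivalence.to (imB x)))))
      (let A , A∈ , im≗A = find (functions-complete (image φ)) in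
        ≤-trans (≤-reflexive (sym (cong ⟦_⟧ (does-true (φ parametrizes? A)
          (parametrizes-≗ φ im≗A (parametrizes-image φ ind))))))
          (∑-∈ (λ A → ⟦ parametrizes φ A ⟧) A∈))

  infixl 7 _∘ᴬ_

  _∘ᴬ_ : ∀ {l} → AffineMap k n → AffineMap l k → AffineMap l n
  φ ∘ᴬ (u , vs) = apply φ u , mapᵛ (λ v → combination v (proj₂ φ)) vs

  combination-· : ∀ t (v : 𝔽₂^ k) (ws : Vec (𝔽₂^ n) k) → combination (t · v) ws ≡ t · combination v ws
  combination-· false v ws = trans (cong (λ z → combination z ws) (·-zeroˡ v))
    (trans (combination-𝟎 ws) (sym (·-zeroˡ _)))
  combination-· true  v ws = trans (cong (λ z → combination z ws) (·-identityˡ v)) (sym (·-identityˡ _))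

  combination-combination : ∀ {l} (t : 𝔽₂^ l) (vs : Vec (𝔽₂^ k) l) (ws : Vec (𝔽₂^ n) k) →
    combination t (mapᵛ (λ v → combination v ws) vs) ≡ combination (combination t vs) ws
  combination-combination []      []       ws = sym (combination-𝟎 ws)
  combination-combination (b ∷ t) (v ∷ vs) ws = trans
    (cong₂ _⊕_ (sym (combination-· b v ws)) (combination-combination t vs ws))
    (sym (combination-⊕ (b · v) (combination t vs) ws))

  apply-∘ᴬ : ∀ {l} (φ : AffineMap k n) (ψ : AffineMap l k) → apply (φ ∘ᴬ ψ) ≗ apply φ ∘ apply ψ
  apply-∘ᴬ (w , ws) (u , vs) t = begin
    (w ⊕ combination u ws) ⊕ combination t (mapᵛ (λ v → combination v ws) vs)
      ≡⟨ cong ((w ⊕ combination u ws) ⊕_) (combination-combination t vs ws) ⟩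
    (w ⊕ combination u ws) ⊕ combination (combination t vs) ws
      ≡⟨ ⊕-assoc w _ _ ⟩
    w ⊕ (combination u ws ⊕ combination (combination t vs) ws)
      ≡⟨ cong (w ⊕_) (sym (combination-⊕ u (combination t vs) ws)) ⟩
    w ⊕ combination (u ⊕ combination t vs) ws ∎
    where open ≡-Reasoning

  -- Parametrizations of affine subspaces

  compose-parametrizes : (φ : AffineMap k n) {A : BoolFun n} → φ Parametrizes A →
    (ψ : AffineMap k k) → LinearlyIndependent (proj₂ ψ) → (φ ∘ᴬ ψ) Parametrizes A
  compose-parametrizes φ (ind , image-A) ψ ψ-ind =
    (λ t eq → ψ-ind t (ind _ (trans (sym (combination-combination t (proj₂ ψ) (proj₂ φ))) eq))) ,
    λ x → mk⇔
      (λ Ax → let t , φt = Equivalence.to (image-A x) Ax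
                  s , ψs = injective⇒surjective (apply ψ) (apply-injective ψ ψ-ind) t in
        s , trans (apply-∘ᴬ φ ψ s) (trans (cong (apply φ) ψs) φt))
      (λ (t , eq) → Equivalence.from (image-A x) (apply ψ t , trans (sym (apply-∘ᴬ φ ψ t)) eq))

  combination-injective : (ws : Vec (𝔽₂^ n) k) → LinearlyIndependent ws →
    ∀ x y → combination x ws ≡ combination y ws → x ≡ y
  combination-injective ws ind x y eq = apply-injective (𝟎 , ws) ind x y (cong (𝟎 ⊕_) eq)

  ∘ᴬ-injective : ∀ {l} (φ : AffineMap k n) → LinearlyIndependent (proj₂ φ) →
    (ψ ψ′ : AffineMap l k) → φ ∘ᴬ ψ ≡ φ ∘ᴬ ψ′ → ψ ≡ ψ′
  ∘ᴬ-injective φ ind (u , vs) (u′ , vs′) eq = cong₂ _,_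
    (apply-injective φ ind u u′ (cong proj₁ eq)) (go vs vs′ (cong proj₂ eq))
    where
    go : ∀ {l} (vs vs′ : Vec _ l) → mapᵛ (λ v → combination v (proj₂ φ)) vs ≡
      mapᵛ (λ v → combination v (proj₂ φ)) vs′ → vs ≡ vs′
    go []       []         eq = refl
    go (v ∷ vs) (v′ ∷ vs′) eq = cong₂ _∷_
      (combination-injective (proj₂ φ) ind v v′ (proj₁ (∷-injective eq))) (go vs vs′ (proj₂ (∷-injective eq)))

  -- The image of φ ∘ᴬ ψ determines the images of the base point and of its translates
  -- by the basis vectors, which lie in A.
  factor : (φ : AffineMap k n) {A : BoolFun n} → φ Parametrizes A →
    (χ : AffineMap k n) → χ Parametrizes A →
    ∃[ ψ ] LinearlyIndependent (proj₂ ψ) × φ ∘ᴬ ψ ≡ χ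
  factor {k} {n} φ@(w , ws) (ind , image-A) χ@(u , vs) (χ-ind , image-χ) =
    (a , proj₁ bs) , ψ-ind , cong₂ _,_ φa (proj₂ bs)
    where
    lift : ∀ t → ∃[ s ] apply φ s ≡ apply χ t
    lift t = Equivalence.to (image-A _) (Equivalence.from (image-χ _) (t , refl))
    χ𝟎 : apply χ 𝟎 ≡ u
    χ𝟎 = trans (cong (u ⊕_) (combination-𝟎 vs)) (⊕-identityʳ u)
    a : 𝔽₂^ k
    a = proj₁ (lift 𝟎)
    φa : apply φ a ≡ u
    φa = trans (proj₂ (lift 𝟎)) χ𝟎
    direction : ∀ t → ∃[ b ] combination b ws ≡ combination t vs
    direction t = let s , φs = lift t in a ⊕ s , (begin
      combination (a ⊕ s) ws                 ≡⟨ combination-⊕ a s ws ⟩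
      combination a ws ⊕ combination s ws    ≡⟨ sym (trans (⊕-interchange w _ w _) (trans (cong (_⊕ (combination a ws ⊕ combination s ws)) (⊕-self w)) (⊕-identityˡ _))) ⟩
      apply φ a ⊕ apply φ s                  ≡⟨ cong₂ _⊕_ φa φs ⟩
      u ⊕ (u ⊕ combination t vs)             ≡⟨ trans (sym (⊕-assoc u u _)) (trans (cong (_⊕ combination t vs) (⊕-self u)) (⊕-identityˡ _)) ⟩
      combination t vs                       ∎)
      where open ≡-Reasoning
    preimages : ∀ {l} (us : Vec (𝔽₂^ n) l) → (∀ t → ∃[ b ] combination b ws ≡ combination t us) →
      ∃[ bs ] mapᵛ (λ v → combination v ws) bs ≡ us
    preimages []       h = [] , refl
    preimages (v ∷ us) h =
      let b , eq   = h (true ∷ 𝟎)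
          bs , eqs = preimages us (λ t → let c , ceq = h (false ∷ t) in
            c , trans ceq (trans (cong (_⊕ combination t us) (·-zeroˡ v)) (⊕-identityˡ _)))
      in b ∷ bs , cong₂ _∷_ (trans eq (trans (cong₂ _⊕_ (·-identityˡ v) (combination-𝟎 us)) (⊕-identityʳ v))) eqs
    bs : ∃[ bs ] mapᵛ (λ v → combination v ws) bs ≡ vs
    bs = preimages vs direction
    ψ-ind : LinearlyIndependent (proj₁ bs)
    ψ-ind t eq = χ-ind t (begin
      combination t vs                                          ≡⟨ cong (combination t) (sym (proj₂ bs)) ⟩
      combination t (mapᵛ (λ v → combination v ws) (proj₁ bs))  ≡⟨ combination-combination t (proj₁ bs) ws ⟩
      combination (combination t (proj₁ bs)) ws                 ≡⟨ cong (λ v → combination v ws) eq ⟩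
      combination 𝟎 ws                                          ≡⟨ combination-𝟎 ws ⟩
      𝟎                                                         ∎)
      where open ≡-Reasoning

  _≟ᴬ_ : (φ ψ : AffineMap k n) → Dec (φ ≡ ψ)
  _≟ᴬ_ = Product.≡-dec _≟ⱽ_ (≡-dec _≟ⱽ_)

  -- The order of the affine group of 𝔽₂ᵏ.
  #parametrizations : ℕ → ℕ
  #parametrizations k = ∑ (affineMaps k k) (λ ψ → ⟦ independent (proj₂ ψ) ⟧)

  -- The affine group acts simply transitively on the parametrizations of a subspace: after one `φ`
  -- is fixed, composition with it is injective, and `factor` makes it surjective.
  count-parametrizations : ∀ k (A : BoolFun n) →
    ∑ (affineMaps k n) (λ φ → ⟦ parametrizes φ A ⟧) ≡
    ⟦ does (isAffineSubspace? k A) ⟧ * #parametrizations k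
  count-parametrizations {n} k A = go (isAffineSubspace? k A)
    where
    go : (D : Dec (IsAffineSubspace k A)) →
      ∑ (affineMaps k n) (λ φ → ⟦ parametrizes φ A ⟧) ≡ ⟦ does D ⟧ * #parametrizations k
    go (no none) = ∑≡0 (affineMaps k n) (λ φ → parametrizes φ A)
      (λ φ _ → does-false (φ parametrizes? A) (λ p → none (φ , p)))
    go (yes (φ , φA)) = trans (≤-antisym
      (∑-inject (affineMaps-unique k n) _ _ (λ χ ψ → does ((φ ∘ᴬ ψ) ≟ᴬ χ))
        (λ χ χ′ ψ e e′ → trans (sym (does⇒ ((φ ∘ᴬ ψ) ≟ᴬ χ) e)) (does⇒ ((φ ∘ᴬ ψ) ≟ᴬ χ′) e′))
        (λ χ → below χ (χ parametrizes? A)))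
      (∑-inject (affineMaps-unique k k) _ _ (λ ψ χ → does ((φ ∘ᴬ ψ) ≟ᴬ χ))
        (λ ψ ψ′ χ e e′ → ∘ᴬ-injective φ (proj₁ φA) ψ ψ′
          (trans (does⇒ ((φ ∘ᴬ ψ) ≟ᴬ χ) e) (sym (does⇒ ((φ ∘ᴬ ψ′) ≟ᴬ χ) e′))))
        (λ ψ → φ ∘ᴬ ψ , affineMaps-complete (φ ∘ᴬ ψ) , above ψ (independent? (proj₂ ψ)))))
      (sym (*-identityˡ _))
      where
      below : ∀ χ (D : Dec (χ Parametrizes A)) → ∃[ ψ ] ψ ∈ affineMaps k k ×
        ⟦ does D ⟧ ≤ ⟦ does ((φ ∘ᴬ ψ) ≟ᴬ χ) ⟧ * ⟦ independent (proj₂ ψ) ⟧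
      -- The left side is 0 here, so any listed map can serve as the witness.
      below χ (no _)   = (𝟎 , replicate k 𝟎) , affineMaps-complete _ , z≤n
      below χ (yes χA) = let ψ , ind , eq = factor φ φA χ χA in
        ψ , affineMaps-complete ψ , ≤-reflexive (sym (cong₂ (λ b c → ⟦ b ⟧ * ⟦ c ⟧)
          (does-true ((φ ∘ᴬ ψ) ≟ᴬ χ) eq) (does-true (independent? (proj₂ ψ)) ind)))
      above : ∀ ψ (D : Dec (LinearlyIndependent (proj₂ ψ))) →
        ⟦ does D ⟧ ≤ ⟦ does ((φ ∘ᴬ ψ) ≟ᴬ (φ ∘ᴬ ψ)) ⟧ * ⟦ parametrizes (φ ∘ᴬ ψ) A ⟧
      above ψ (no _)    = z≤n
      above ψ (yes ind) = ≤-reflexive (sym (cong₂ (λ b c → ⟦ b ⟧ * ⟦ c ⟧)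
        (does-true ((φ ∘ᴬ ψ) ≟ᴬ (φ ∘ᴬ ψ)) refl)
        (does-true ((φ ∘ᴬ ψ) parametrizes? A) (compose-parametrizes φ φA ψ ind))))

  -- Every subspace has the same number of parametrizations, so a uniform independent map has a
  -- uniform subspace as its image. Sums over subspaces thereby become sums over maps.
  double-count : ∀ k (c : BoolFun n → ℕ) →
    #parametrizations k * ∑ (affineSubspaces k n) c ≡
    ∑ (affineMaps k n) (λ φ → ∑ (functions n) (λ A → ⟦ parametrizes φ A ⟧ * c A))
  double-count {n} k c = begin
    p * ∑ (affineSubspaces k n) c
      ≡⟨ cong (p *_) (∑-filter (functions n) (isAffineSubspace? k) c) ⟩
    p * ∑ (functions n) (λ A → ⟦ does (isAffineSubspace? k A) ⟧ * c A)
      ≡⟨ sym (∑-*ˡ (functions n) p _) ⟩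
    ∑ (functions n) (λ A → p * (⟦ does (isAffineSubspace? k A) ⟧ * c A))
      ≡⟨ ∑-cong (functions n) (λ A → trans (exchange p ⟦ does (isAffineSubspace? k A) ⟧ (c A))
           (trans (cong (_* c A) (sym (count-parametrizations k A))) (sym (∑-*ʳ (affineMaps k n) _ (c A))))) ⟩
    ∑ (functions n) (λ A → ∑ (affineMaps k n) (λ φ → ⟦ parametrizes φ A ⟧ * c A))
      ≡⟨ ∑-swap (functions n) (affineMaps k n) _ ⟩
    ∑ (affineMaps k n) (λ φ → ∑ (functions n) (λ A → ⟦ parametrizes φ A ⟧ * c A)) ∎
    where
    open ≡-Reasoning
    p = #parametrizations k
    exchange : ∀ a b c → a * (b * c) ≡ b * a * c
    exchange = solve-∀

  #affineSubspaces : ∀ k n →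
    #parametrizations k * length (affineSubspaces k n) ≡ 2 ^ n * #independent k n
  #affineSubspaces k n = begin
    #parametrizations k * length (affineSubspaces k n)
      ≡⟨ cong (#parametrizations k *_) (sym (∑-length (affineSubspaces k n))) ⟩
    #parametrizations k * ∑ (affineSubspaces k n) (λ _ → 1)
      ≡⟨ double-count {n} k (λ _ → 1) ⟩
    ∑ (affineMaps k n) (λ φ → ∑ (functions n) (λ A → ⟦ parametrizes φ A ⟧ * 1))
      ≡⟨ ∑-cong (affineMaps k n) (λ φ → trans (∑-cong (functions n) (λ A → *-identityʳ _)) (∑-parametrizes φ)) ⟩
    ∑ (affineMaps k n) (λ φ → ⟦ independent (proj₂ φ) ⟧)
      ≡⟨ trans (∑-affineMaps k n _) (∑ᶜ-const n _) ⟩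
    2 ^ n * #independent k n ∎
    where open ≡-Reasoning

  -- For `k < n` the general density bound is positive; for `k = n` it degenerates, and the bound
  -- 1/4 takes its place.
  #independent>0 : ∀ k n → 0 < k → k ≤ n → 0 < #independent k n
  #independent>0 k n 0<k k≤n with #independent k n in I≡0
  ... | suc _ = s≤s z≤n
  ... | zero with m≤n⇒m<n∨m≡n k≤n
  ...   | inj₁ k<n = contradiction
    (subst (λ I → 2 ^ n * (2 ^ n) ^ k ≤ 2 ^ n * I + 2 ^ k * (2 ^ n) ^ k) I≡0 (#independent-lower k n))
    (<⇒≱ (≤-<-trans (≤-reflexive (cong (_+ 2 ^ k * (2 ^ n) ^ k) (*-zeroʳ (2 ^ n))))
      (*-monoˡ-< ((2 ^ n) ^ k) {{m^n≢0 (2 ^ n) k {{m^n≢0 2 n}}}} (^-monoʳ-< 2 ≤-refl k<n))))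
  ...   | inj₂ refl = contradiction
    (subst (λ I → (2 ^ n) ^ n ≤ 4 * I) I≡0 (#independent-quarter n 0<k))
    (<⇒≱ (m^n>0 (2 ^ n) {{m^n≢0 2 n}} n))

  #parametrizations>0 : ∀ k → 0 < k → 0 < #parametrizations k
  #parametrizations>0 k 0<k = ≤-trans
    (*-mono-≤ (m^n>0 2 k) (#independent>0 k k 0<k ≤-refl))
    (≤-reflexive (sym (trans (∑-affineMaps k k _) (∑ᶜ-const k _))))

  affineSubspaces-nonempty : ∀ k n → 0 < k → k ≤ n → 0 < length (affineSubspaces k n)
  affineSubspaces-nonempty k n 0<k k≤n = positive (length (affineSubspaces k n))
    (<-≤-trans (*-mono-≤ (m^n>0 2 n) (#independent>0 k n 0<k k≤n)) (≤-reflexive (sym (#affineSubspaces k n))))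
    where
    positive : ∀ l → 0 < #parametrizations k * l → 0 < l
    positive zero    lt = subst (0 <_) (*-zeroʳ (#parametrizations k)) lt
    positive (suc l) lt = s≤s z≤n

  -- Rejection probability of a single run

  rejects : ∀ d → BoolFun n → BoolFun n → Bool
  rejects d f A = not (does (gnAccepts? d f A))

  #rejecting : ∀ d → BoolFun n → ℕ
  #rejecting {n} d f = ∑ (affineSubspaces (suc d) n) (⟦_⟧ ∘ rejects d f)

  -- The rejecting maps were counted as a proportion of all maps. The independent ones are no more
  -- numerous and include all the rejecting ones, so the proportion among subspaces is at least as
  -- large.
  many-rejecting : ∀ d n → suc d ≤ n → (f : BoolFun n) → ¬ Near d f →
    length (affineSubspaces (suc d) n) ≤ 256 * #rejecting d f
  many-rejecting d n d<n f far = cancel (#parametrizations (suc d)) _ _ (#parametrizations>0 (suc d) (s≤s z≤n)) (begin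
    p * length (affineSubspaces (suc d) n)    ≡⟨ #affineSubspaces (suc d) n ⟩
    2 ^ n * #independent (suc d) n            ≤⟨ *-monoʳ-≤ (2 ^ n) (#independent≤ (suc d) n) ⟩
    (2 ^ n) ^ suc (suc d)                     ≤⟨ rejecting-lower d n d<n f far ⟩
    256 * ∑ (affineMaps (suc d) n) (rejecting d f) ≤⟨ *-monoʳ-≤ 256 (∑-mono (affineMaps (suc d) n) (λ φ → le φ (independent? (proj₂ φ)))) ⟩
    256 * ∑ (affineMaps (suc d) n) (λ φ → ∑ (functions n) (λ A → ⟦ parametrizes φ A ⟧ * ⟦ rejects d f A ⟧))
                                              ≡⟨ cong (256 *_) (sym (double-count (suc d) (⟦_⟧ ∘ rejects d f))) ⟩
    256 * (p * #rejecting d f)                ∎)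
    where
    open ≤-Reasoning
    p = #parametrizations (suc d)
    le : ∀ φ (D : Dec (LinearlyIndependent (proj₂ φ))) → ⟦ does D ⟧ * bad d (f ∘ apply φ) ≤
      ∑ (functions n) (λ A → ⟦ parametrizes φ A ⟧ * ⟦ rejects d f A ⟧)
    le φ (no _)    = z≤n
    le φ (yes ind) = go (deg<? d (f ∘ apply φ)) (find (functions-complete (image φ)))
      where
      go : (D : Dec (Deg< (suc d) (f ∘ apply φ))) → ∃[ A ] A ∈ functions n × image φ ≗ A →
        1 * ⟦ not (does D) ⟧ ≤ ∑ (functions n) (λ A → ⟦ parametrizes φ A ⟧ * ⟦ rejects d f A ⟧)
      go (yes _)  _              = z≤n
      go (no ¬df) (A , A∈ , im≗A) = ≤-trans
        (≤-reflexive (sym (cong₂ (λ b c → ⟦ b ⟧ * ⟦ c ⟧) (does-true (φ parametrizes? A) φA)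
          (cong not (does-false (gnAccepts? d f A) (λ acc → ¬df (deg≤⇒deg< (acc φ φA))))))))
        (∑-∈ (λ A → ⟦ parametrizes φ A ⟧ * ⟦ rejects d f A ⟧) A∈)
        where
        φA : φ Parametrizes A
        φA = parametrizes-≗ φ im≗A (parametrizes-image φ ind)
    cancel : ∀ p a b → 0 < p → p * a ≤ 256 * (p * b) → a ≤ 256 * b
    cancel p@(suc _) a b _ le = *-cancelˡ-≤ p (≤-trans le (≤-reflexive (assoc p b)))
      where
      assoc : ∀ p b → 256 * (p * b) ≡ p * (256 * b)
      assoc = solve-∀

  hits : BoolFun n → AffineMap k n → ℕ
  hits e φ = count (e ∘ apply φ)

  -- A subspace that avoids the errors is accepted, and each of the 2ᵈ⁺¹ points of a
  -- random subspace is uniformly distributed.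
  few-rejecting : ∀ d n (f g : BoolFun n) → Deg< (suc d) g →
    2 ^ n * #rejecting d f ≤ 2 ^ suc d * count (f ⊻ g) * length (affineSubspaces (suc d) n)
  few-rejecting d n f g dg = cancel (#parametrizations (suc d)) (2 ^ n) _ (2 ^ suc d) (count (f ⊻ g)) _ (#independent (suc d) n)
    (#parametrizations>0 (suc d) (s≤s z≤n)) (#affineSubspaces (suc d) n) (begin
    p * #rejecting d f
      ≡⟨ double-count (suc d) (⟦_⟧ ∘ rejects d f) ⟩
    ∑ Φs (λ φ → ∑ (functions n) (λ A → ⟦ parametrizes φ A ⟧ * ⟦ rejects d f A ⟧))
      ≤⟨ ∑-mono Φs (λ φ → ∑-mono (functions n) (λ A → le φ A (φ parametrizes? A) (gnAccepts? d f A))) ⟩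
    ∑ Φs (λ φ → ∑ (functions n) (λ A → ⟦ parametrizes φ A ⟧ * hits wrong φ))
      ≡⟨ ∑-cong Φs (λ φ → trans (∑-*ʳ (functions n) _ (hits wrong φ)) (cong (_* hits wrong φ) (∑-parametrizes φ))) ⟩
    ∑ Φs (λ φ → ⟦ independent (proj₂ φ) ⟧ * hits wrong φ)
      ≡⟨ ∑-affineMaps (suc d) n _ ⟩
    ∑ᶜ n (λ u → ∑ (tuples (suc d) n) (λ vs → ⟦ independent vs ⟧ * hits wrong (u , vs)))
      ≡⟨ ∑-swap (cube n) (tuples (suc d) n) _ ⟩
    ∑ (tuples (suc d) n) (λ vs → ∑ᶜ n (λ u → ⟦ independent vs ⟧ * hits wrong (u , vs)))
      ≡⟨ ∑-cong (tuples (suc d) n) (λ vs → trans (∑-*ˡ (cube n) ⟦ independent vs ⟧ _)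
           (cong (⟦ independent vs ⟧ *_) (uniform vs))) ⟩
    ∑ (tuples (suc d) n) (λ vs → ⟦ independent vs ⟧ * (2 ^ suc d * count wrong))
      ≡⟨ ∑-*ʳ (tuples (suc d) n) _ _ ⟩
    #independent (suc d) n * (2 ^ suc d * count wrong) ∎)
    where
    open ≤-Reasoning
    p = #parametrizations (suc d)
    Φs = affineMaps (suc d) n
    wrong = f ⊻ g
    uniform : ∀ vs → ∑ᶜ n (λ u → hits wrong (u , vs)) ≡ 2 ^ suc d * count wrong
    uniform vs = trans (∑-swap (cube n) (cube (suc d)) _)
      (trans (∑-cong (cube (suc d)) (λ t → ∑ᶜ-translate (combination t vs) (⟦_⟧ ∘ wrong))) (∑ᶜ-const (suc d) _))
    le : ∀ φ A (D : Dec (φ Parametrizes A)) (E : Dec (GNAccepts d f A)) →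
      ⟦ does D ⟧ * ⟦ not (does E) ⟧ ≤ ⟦ does D ⟧ * hits wrong φ
    le φ A (no _)   E       = z≤n
    le φ A (yes φA) (yes _) = z≤n
    le φ A (yes (_ , imφ)) (no ¬acc) = *-monoʳ-≤ 1 (hit (anySubset? (λ t → wrong (apply φ t) ≟ᵇ true)))
      where
      hit : Dec (∃[ t ] wrong (apply φ t) ≡ true) → 1 ≤ hits wrong φ
      hit (yes (t , eq)) = ≤-trans (≤-reflexive (sym (cong ⟦_⟧ eq)))
        (∑-∈ (λ t → ⟦ wrong (apply φ t) ⟧) (cube-complete t))
      -- Acceptance quantifies over every parametrization `χ` of `A`. Each point of `χ` is also a
      -- point of `φ`, where `f` and `g` agree, so `f ∘ apply χ` inherits the degree of `g`.
      hit (no missed) = contradiction (λ χ (_ , imχ) → deg<⇒deg≤ (deg<-cong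
        (λ t → let s , φs = Equivalence.to (imφ _) (Equivalence.from (imχ (apply χ t)) (t , refl)) in
          sym (subst (λ x → f x ≡ g x) φs (xor≡false (f (apply φ s)) _ (¬-not (λ eq → missed (s , eq))))))
        (deg<-∘ (apply-affine χ) dg))) ¬acc
        where
        xor≡false : ∀ a b → a xor b ≡ false → a ≡ b
        xor≡false false b eq = sym eq
        xor≡false true true eq = refl
    cancel : ∀ p Q r K N T I → 0 < p → p * T ≡ Q * I → p * r ≤ I * (K * N) → Q * r ≤ K * N * T
    cancel p@(suc _) Q r K N T I _ pT≡QI le = *-cancelˡ-≤ p (begin
      p * (Q * r)           ≡⟨ s₁ p Q r ⟩
      Q * (p * r)           ≤⟨ *-monoʳ-≤ Q le ⟩
      Q * (I * (K * N))     ≡⟨ s₂ Q I (K * N) ⟩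
      K * N * (Q * I)       ≡⟨ cong (K * N *_) (sym pT≡QI) ⟩
      K * N * (p * T)       ≡⟨ s₃ p (K * N) T ⟩
      p * (K * N * T)       ∎)
      where
      s₁ : ∀ a b c → a * (b * c) ≡ b * (a * c)
      s₁ = solve-∀
      s₂ : ∀ a b c → a * (b * c) ≡ c * (a * b)
      s₂ = solve-∀
      s₃ : ∀ a b c → b * (a * c) ≡ a * (b * c)
      s₃ = solve-∀

module Probability where

  open Counting
  open import Data.Integer.Base using (+_)
  open import Data.Nat.Base hiding (_/_)
  open import Data.Nat.Properties
  open import Data.Rational.Base as ℚ using (_/_; toℚᵘ)
  open import Data.Rational.Unnormalised.Base as ℚᵘ using (mkℚᵘ)

  private variable n d : ℕ

  -- Fractions and cross-multiplication

  /-mono : ∀ a b c e .{{_ : NonZero b}} .{{_ : NonZero e}} →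
    a * e ≤ c * b → + a / b ℚ.≤ + c / e
  /-mono a b@(suc b-1) c e@(suc e-1) le = ℚ.toℚᵘ-cancel-≤ (begin
    toℚᵘ (+ a / b)    ≃⟨ ℚ.toℚᵘ-fromℚᵘ (mkℚᵘ (+ a) b-1) ⟩
    mkℚᵘ (+ a) b-1    ≤⟨ ℚᵘ.*≤* (subst₂ ℤ._≤_ (ℤ.pos-* a e) (ℤ.pos-* c b) (ℤ.+≤+ le)) ⟩
    mkℚᵘ (+ c) e-1    ≃⟨ ℚᵘ.≃-sym (ℚ.toℚᵘ-fromℚᵘ (mkℚᵘ (+ c) e-1)) ⟩
    toℚᵘ (+ c / e)    ∎)
    where open ℚᵘ.≤-Reasoning

  /-mono⁻¹ : ∀ a b c e .{{_ : NonZero b}} .{{_ : NonZero e}} →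
    + a / b ℚ.≤ + c / e → a * e ≤ c * b
  /-mono⁻¹ a b@(suc b-1) c e@(suc e-1) le = ℤ.drop‿+≤+
    (subst₂ ℤ._≤_ (sym (ℤ.pos-* a e)) (sym (ℤ.pos-* c b)) (ℚᵘ.drop-*≤* (begin
      mkℚᵘ (+ a) b-1    ≃⟨ ℚᵘ.≃-sym (ℚ.toℚᵘ-fromℚᵘ (mkℚᵘ (+ a) b-1)) ⟩
      toℚᵘ (+ a / b)    ≤⟨ ℚ.toℚᵘ-mono-≤ le ⟩
      toℚᵘ (+ c / e)    ≃⟨ ℚ.toℚᵘ-fromℚᵘ (mkℚᵘ (+ c) e-1) ⟩
      mkℚᵘ (+ c) e-1    ∎)))
    where open ℚᵘ.≤-Reasoning

  1/-* : ∀ a b .{{_ : NonZero a}} .{{_ : NonZero b}} .{{_ : NonZero (a * b)}} →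
    + 1 / a ℚ.* (+ 1 / b) ≡ + 1 / (a * b)
  1/-* a@(suc a-1) b@(suc b-1) = ℚ.toℚᵘ-injective (begin-equality
    toℚᵘ (+ 1 / a ℚ.* (+ 1 / b))             ≃⟨ ℚ.toℚᵘ-homo-* (+ 1 / a) (+ 1 / b) ⟩
    toℚᵘ (+ 1 / a) ℚᵘ.* toℚᵘ (+ 1 / b)       ≃⟨ ℚᵘ.*-cong (ℚ.toℚᵘ-fromℚᵘ (mkℚᵘ (+ 1) a-1)) (ℚ.toℚᵘ-fromℚᵘ (mkℚᵘ (+ 1) b-1)) ⟩
    mkℚᵘ (+ 1) a-1 ℚᵘ.* mkℚᵘ (+ 1) b-1       ≃⟨ ℚᵘ.≃-sym (ℚ.toℚᵘ-fromℚᵘ (mkℚᵘ (+ 1) (pred (a * b)))) ⟩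
    toℚᵘ (+ 1 / (a * b))                     ∎)
    where open ℚᵘ.≤-Reasoning

  Pr-/ : {A : Set} (Ω : List A) {P : Pred A 0ℓ} (P? : Decidable P) →
    ∀ {a b} .{{_ : NonZero b}} → ∑ Ω (λ x → ⟦ does (P? x) ⟧) ≡ a → length Ω ≡ b →
    Pr Ω P? ≡ + a / b
  Pr-/ []        P? {b = suc _} _  ()
  Pr-/ Ω@(_ ∷ _) P? refl refl = cong (λ a → + a / length Ω) (length-filter Ω P?)

  length-cube : ∀ n → length (cube n) ≡ 2 ^ n
  length-cube n = trans (sym (∑-length (cube n))) (∑ᶜ-one n)

  dist-/ : (f g : BoolFun n) → dist f g ≡ (+ count (f ⊻ g) / 2 ^ n) {{m^n≢0 2 n}}
  dist-/ {n} f g = Pr-/ (cube n) (λ x → ¬? (f x ≟ᵇ g x)) {{m^n≢0 2 n}}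
    (∑-cong (cube n) (λ x → differ (f x) (g x))) (length-cube n)
    where
    differ : ∀ a b → ⟦ does (¬? (a ≟ᵇ b)) ⟧ ≡ ⟦ a xor b ⟧
    differ false false = refl
    differ false true  = refl
    differ true  false = refl
    differ true  true  = refl

  -- Independent repetition

  length-vecs : {A : Set} (xs : List A) → ∀ r → length (vecs xs r) ≡ length xs ^ r
  length-vecs xs zero    = refl
  length-vecs xs (suc r) = trans (sym (∑-length (vecs xs (suc r))))
    (trans (∑-cartesianProductWith _∷_ xs (vecs xs r) _)
      (trans (∑-const xs _) (cong (length xs *_) (trans (∑-length (vecs xs r)) (length-vecs xs r)))))

  ∑-all? : {A : Set} (xs : List A) {P : Pred A 0ℓ} (P? : Decidable P) → ∀ r →
    ∑ (vecs xs r) (λ v → ⟦ does (all? P? v) ⟧) ≡ ∑ xs (λ x → ⟦ does (P? x) ⟧) ^ r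
  ∑-all? xs P? zero    = refl
  ∑-all? xs P? (suc r) = trans (∑-cartesianProductWith _∷_ xs (vecs xs r) _)
    (trans (∑-cong xs (λ x → ∑-cong (vecs xs r) (λ v → ⟦∧⟧ (does (P? x)) (does (all? P? v)))))
      (trans (sym (∑-* xs (vecs xs r) _ _)) (cong (∑ xs (λ x → ⟦ does (P? x) ⟧) *_) (∑-all? xs P? r))))
    where
    ⟦∧⟧ : ∀ a b → ⟦ a ∧ b ⟧ ≡ ⟦ a ⟧ * ⟦ b ⟧
    ⟦∧⟧ false b = refl
    ⟦∧⟧ true  b = sym (+-identityʳ _)

  -- Bernoulli's inequality `(1 - x)ʳ ≥ 1 - r x` at `x = b / (a + b)`, cleared of denominators.
  bernoulli-upper : ∀ a b r → (a + b) ^ r * (a + b) ≤ a ^ r * (a + b) + r * b * (a + b) ^ r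
  bernoulli-upper a b zero    = ≤-reflexive (sym (+-identityʳ _))
  bernoulli-upper a b (suc r) = begin
    (a + b) * T * (a + b)                                     ≡⟨ s₁ a b T ⟩
    a * (T * (a + b)) + b * (T * (a + b))                     ≤⟨ +-monoˡ-≤ _ (*-monoʳ-≤ a (bernoulli-upper a b r)) ⟩
    a * (a ^ r * (a + b) + r * b * T) + b * (T * (a + b))     ≤⟨ m≤m+n _ (b * (r * b * T)) ⟩
    a * (a ^ r * (a + b) + r * b * T) + b * (T * (a + b)) + b * (r * b * T) ≡⟨ s₂ a b (a ^ r) r T ⟩
    a * a ^ r * (a + b) + suc r * b * ((a + b) * T)           ∎
    where
    open ≤-Reasoning
    T = (a + b) ^ r
    s₁ : ∀ a b T → (a + b) * T * (a + b) ≡ a * (T * (a + b)) + b * (T * (a + b))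
    s₁ = solve-∀
    s₂ : ∀ a b p r T → a * (p * (a + b) + r * b * T) + b * (T * (a + b)) + b * (r * b * T) ≡
      a * p * (a + b) + (1 + r) * b * ((a + b) * T)
    s₂ = solve-∀

  -- Bernoulli's inequality `(1 + x)ʳ ≥ 1 + r x` at `x = b / a ≥ 1 / q`, cleared of denominators.
  bernoulli-lower : ∀ a b q → a ≤ q * b → ∀ r → (q + r) * a ^ r ≤ q * (a + b) ^ r
  bernoulli-lower a b q a≤qb zero    = ≤-reflexive (cong (_* 1) (+-identityʳ q))
  bernoulli-lower a b q a≤qb (suc r) = begin
    (q + suc r) * (a * p)                      ≡⟨ s₁ a q r p ⟩
    (q + r) * p * a + a * p                    ≤⟨ +-monoʳ-≤ _ (*-monoˡ-≤ p a≤qb) ⟩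
    (q + r) * p * a + q * b * p                ≤⟨ m≤m+n _ (r * b * p) ⟩
    (q + r) * p * a + q * b * p + r * b * p    ≡⟨ s₂ a b q r p ⟩
    (a + b) * ((q + r) * p)                    ≤⟨ *-monoʳ-≤ (a + b) (bernoulli-lower a b q a≤qb r) ⟩
    (a + b) * (q * (a + b) ^ r)                ≡⟨ s₃ (a + b) q ((a + b) ^ r) ⟩
    q * ((a + b) * (a + b) ^ r)                ∎
    where
    open ≤-Reasoning
    p = a ^ r
    s₁ : ∀ a q r p → (q + (1 + r)) * (a * p) ≡ (q + r) * p * a + a * p
    s₁ = solve-∀
    s₂ : ∀ a b q r p → (q + r) * p * a + q * b * p + r * b * p ≡ (a + b) * ((q + r) * p)
    s₂ = solve-∀
    s₃ : ∀ a b c → a * (b * c) ≡ b * (a * c)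
    s₃ = solve-∀

  module Repetition (r d : ℕ) {n : ℕ} (f : BoolFun n) (nonempty : 0 < length (affineSubspaces (suc d) n)) where

    private
      As = affineSubspaces (suc d) n
      T = length As
      acc rej : ℕ
      acc = ∑ As (λ A → ⟦ does (gnAccepts? d f A) ⟧)
      rej = #rejecting d f
      split : acc + rej ≡ T
      split = trans (sym (∑-+ As _ _)) (trans (∑-cong As (λ A → ⟦⟧+⟦not⟧ (does (gnAccepts? d f A)))) (∑-length As))
      instance
        T^r≢0 : NonZero (T ^ r)
        T^r≢0 = m^n≢0 T r {{>-nonZero nonempty}}
      all-accept : ∑ (runs r d n) (λ v → ⟦ does (allAccept? d f v) ⟧) ≡ acc ^ r
      all-accept = ∑-all? As (gnAccepts? d f) r

    Pr-accept-≥ : 3 * (r * rej) ≤ T → + 2 / 3 ℚ.≤ Pr[accept] r d f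
    Pr-accept-≥ few = subst (+ 2 / 3 ℚ.≤_) (sym (Pr-/ (runs r d n) (allAccept? d f) all-accept (length-vecs As r)))
      (/-mono 2 3 (acc ^ r) (T ^ r) (≤-trans (*-cancelʳ-≤ _ _ T {{>-nonZero nonempty}} bound)
        (≤-reflexive (*-comm 3 (acc ^ r)))))
      where
      open ≤-Reasoning
      s₁ : ∀ P T → 2 * P * T + T * P ≡ 3 * (P * T)
      s₁ = solve-∀
      s₂ : ∀ p T r b P → 3 * (p * T + r * b * P) ≡ 3 * p * T + 3 * (r * b) * P
      s₂ = solve-∀
      bound : 2 * T ^ r * T ≤ 3 * acc ^ r * T
      bound = +-cancelʳ-≤ (T * T ^ r) _ _ (begin
        2 * T ^ r * T + T * T ^ r                   ≡⟨ s₁ (T ^ r) T ⟩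
        3 * (T ^ r * T)                             ≤⟨ *-monoʳ-≤ 3 (subst
          (λ T → T ^ r * T ≤ acc ^ r * T + r * rej * T ^ r) split (bernoulli-upper acc rej r)) ⟩
        3 * (acc ^ r * T + r * rej * T ^ r)         ≡⟨ s₂ (acc ^ r) T r rej (T ^ r) ⟩
        3 * acc ^ r * T + 3 * (r * rej) * T ^ r     ≤⟨ +-monoʳ-≤ (3 * acc ^ r * T) (*-monoˡ-≤ (T ^ r) few) ⟩
        3 * acc ^ r * T + T * T ^ r                 ∎)

    -- A number of runs equal to twice the inverse rejection probability makes the factor `q + r` in
    -- `bernoulli-lower` equal to `3 q`, so all runs accept with probability at most 1/3.
    Pr-reject-≥ : ∀ q → r ≡ 2 * suc q → T ≤ suc q * rej → + 2 / 3 ℚ.≤ Pr[reject] r d f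
    Pr-reject-≥ q r≡2q many = subst (+ 2 / 3 ℚ.≤_)
      (sym (Pr-/ (runs r d n) (λ v → ¬? (allAccept? d f v)) refl (length-vecs As r)))
      (/-mono 2 3 R (T ^ r) (+-cancelʳ-≤ (3 * acc ^ r) _ _ (begin
        2 * T ^ r + 3 * acc ^ r      ≤⟨ +-monoʳ-≤ (2 * T ^ r) three ⟩
        2 * T ^ r + T ^ r            ≡⟨ s₁ (T ^ r) ⟩
        3 * T ^ r                    ≡⟨ cong (3 *_) (sym total) ⟩
        3 * (acc ^ r + R)            ≡⟨ s₂ (acc ^ r) R ⟩
        R * 3 + 3 * acc ^ r          ∎)))
      where
      open ≤-Reasoning
      R : ℕ
      R = ∑ (runs r d n) (λ v → ⟦ does (¬? (allAccept? d f v)) ⟧)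
      s₁ : ∀ P → 2 * P + P ≡ 3 * P
      s₁ = solve-∀
      s₂ : ∀ p R → 3 * (p + R) ≡ R * 3 + 3 * p
      s₂ = solve-∀
      total : acc ^ r + R ≡ T ^ r
      total = trans (cong (_+ R) (sym all-accept)) (trans (sym (∑-+ (runs r d n) _ _))
        (trans (∑-cong (runs r d n) (λ v → ⟦⟧+⟦not⟧ (does (allAccept? d f v))))
          (trans (∑-length (runs r d n)) (length-vecs As r))))
      three : 3 * acc ^ r ≤ T ^ r
      three = *-cancelˡ-≤ (suc q) (begin
        suc q * (3 * acc ^ r)            ≡⟨ s₃ (suc q) (acc ^ r) ⟩
        (suc q + 2 * suc q) * acc ^ r    ≡⟨ cong (λ t → (suc q + t) * acc ^ r) (sym r≡2q) ⟩
        (suc q + r) * acc ^ r            ≤⟨ bernoulli-lower acc rej (suc q) (≤-trans (≤-trans (m≤m+n acc rej) (≤-reflexive split)) many) r ⟩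
        suc q * (acc + rej) ^ r          ≡⟨ cong (λ t → suc q * t ^ r) split ⟩
        suc q * T ^ r                    ∎)
        where
        s₃ : ∀ q p → q * (3 * p) ≡ (q + 2 * q) * p
        s₃ = solve-∀

  -- The two conditions in terms of relative distance

  close⇒few : ∀ c d n (f g : BoolFun n) → deg g ≤ d → .{{_ : NonZero c}} →
    dist f g ℚ.≤ + 1 / c ℚ.* 2^- d →
    c * #rejecting d f ≤ 2 * length (affineSubspaces (suc d) n)
  close⇒few c d n f g deg≤d near = combine (2 ^ n) (2 ^ d) c (count (f ⊻ g)) _ _ (m^n>0 2 n)
    (≤-trans (/-mono⁻¹ (count (f ⊻ g)) (2 ^ n) 1 (c * 2 ^ d) (subst₂ ℚ._≤_ (dist-/ f g) (1/-* c (2 ^ d)) near))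
      (≤-reflexive (*-identityˡ (2 ^ n))))
    (few-rejecting d n f g (deg≤⇒deg< deg≤d))
    where
    instance
      _ = m^n≢0 2 n
      _ = m^n≢0 2 d
      _ = m*n≢0 c (2 ^ d)
    combine : ∀ Q D c N r T → 0 < Q → N * (c * D) ≤ Q → Q * r ≤ 2 * D * N * T → c * r ≤ 2 * T
    combine Q@(suc _) D c N r T _ close few = *-cancelˡ-≤ Q (begin
      Q * (c * r)               ≡⟨ s₁ Q c r ⟩
      c * (Q * r)               ≤⟨ *-monoʳ-≤ c few ⟩
      c * (2 * D * N * T)       ≡⟨ s₂ c D N T ⟩
      N * (c * D) * (2 * T)     ≤⟨ *-monoˡ-≤ (2 * T) close ⟩
      Q * (2 * T)               ∎)
      where
      open ≤-Reasoning
      s₁ : ∀ a b c → a * (b * c) ≡ b * (a * c)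
      s₁ = solve-∀
      s₂ : ∀ c D N T → c * (2 * D * N * T) ≡ N * (c * D) * (2 * T)
      s₂ = solve-∀

  far⇒¬Near : (f : BoolFun n) → + 1 / 8 ℚ.* 2^- d ℚ.≤ δ d f → ¬ Near d f
  far⇒¬Near {n} {d} f far (g , dg , close) = contradiction close (≤⇒≯ (begin
    2 ^ n                            ≡⟨ sym (*-identityˡ (2 ^ n)) ⟩
    1 * 2 ^ n                        ≤⟨ /-mono⁻¹ 1 (8 * 2 ^ d) (count (f ⊻ g)) (2 ^ n) (subst₂ ℚ._≤_
      (1/-* 8 (2 ^ d)) (dist-/ f g) (ℚ.≤-trans far (δ-minimal d f g (deg<⇒deg≤ dg)))) ⟩
    count (f ⊻ g) * (8 * 2 ^ d)      ≡⟨ s₁ (count (f ⊻ g)) (2 ^ d) ⟩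
    8 * (2 ^ d * count (f ⊻ g))      ∎))
    where
    open ≤-Reasoning
    instance
      _ = m^n≢0 2 n
      _ = m^n≢0 2 d
      _ = m*n≢0 8 (2 ^ d)
    s₁ : ∀ N D → N * (8 * D) ≡ 8 * (D * N)
    s₁ = solve-∀

  -- At distance at most 2⁻ᵈ / c, the 2ᵈ⁺¹ points of a random subspace meet an error with
  -- probability at most 2 / c. With `c = 6 r` this is 1 / (3 r), and a union bound over the `r`
  -- runs leaves 1/3. For `r = 512` the distance constant is 1/3072.
  accepts-close : ∀ r .{{_ : NonZero r}} .{{_ : NonZero (6 * r)}} d n → suc d ≤ n → (f : BoolFun n) →
    δ d f ℚ.≤ + 1 / (6 * r) ℚ.* 2^- d → + 2 / 3 ℚ.≤ Pr[accept] r d f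
  accepts-close r d n d<n f near =
    let g , deg≤d , δ≡ = δ-attained d f in
    Repetition.Pr-accept-≥ r d f (affineSubspaces-nonempty (suc d) n (s≤s z≤n) d<n)
      (*-cancelˡ-≤ 2 (≤-trans (≤-reflexive (s₁ r (#rejecting d f)))
        (close⇒few (6 * r) d n f g deg≤d (subst (ℚ._≤ + 1 / (6 * r) ℚ.* 2^- d) δ≡ near))))
    where
    s₁ : ∀ r x → 2 * (3 * (r * x)) ≡ 6 * r * x
    s₁ = solve-∀

  rejects-far : ∀ d n → suc d ≤ n → (f : BoolFun n) →
    + 1 / 8 ℚ.* 2^- d ℚ.≤ δ d f → + 2 / 3 ℚ.≤ Pr[reject] 512 d f
  rejects-far d n d<n f far =
    -- The inverse rejection probability 256 is passed as `suc 255`, and 512 is its double.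
    Repetition.Pr-reject-≥ 512 d f (affineSubspaces-nonempty (suc d) n (s≤s z≤n) d<n) 255 refl
      (many-rejecting d n d<n f (far⇒¬Near f far))

open import Data.Nat.Base using (ℕ; suc) renaming (_≤_ to _≤ℕ_)
open import Data.Integer.Base using (+_)
open import Data.Rational.Base using (ℚ; 0ℚ; _/_; _*_; _≤_; _<_)
open import Data.Product.Base using (Σ-syntax; _×_)

theorem3 : Σ[ c₁ ∈ ℚ ] Σ[ c₂ ∈ ℚ ] Σ[ r ∈ ℕ ]
    0ℚ < c₁ × 0ℚ < c₂ × 1 ≤ℕ r ×
    (∀ (d n : ℕ) → suc d ≤ℕ n → (f : BoolFun n) →
    (δ d f ≤ c₁ * 2^- d → + 2 / 3 ≤ Pr[accept] r d f) ×
    (c₂ * 2^- d ≤ δ d f → + 2 / 3 ≤ Pr[reject] r d f))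
theorem3 = + 1 / 3072 , + 1 / 8 , 512 ,
  positive⁻¹ (+ 1 / 3072) , positive⁻¹ (+ 1 / 8) , s≤s z≤n ,
  λ d n d<n f → Probability.accepts-close 512 d n d<n f , Probability.rejects-far d n d<n f
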